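{- Let $q$ be a prime power and $m,n$ positive integers with $\max\{m,n\}>1$. Let $S_q(m,n)$ be the set of polynomials $f(X)\in\mathbb{F}_{q^m}[X]$ that are irreducible in $\mathbb{F}_{q^m}[X]$ and are of the form $X^n-\lambda g(X)$, where $\lambda\in\mathbb{F}_{q^m}$ satisfies $\mathbb{F}_{q^m}=\mathbb{F}_q(\lambda)$ and $g(X)\in\mathbb{F}_q[X]$ satisfies $g(0)=1$ and $\deg g\le n-1$. Then $$ |\mathrm{TSRI}(m,n;q)|=\frac{|S_q(m,n)|}{m}\cdot \frac{|\operatorname{GL}_m(\mathbb{F}_q)|}{q^m-1}. $$
   Context: An $(m,n)$-TSR matrix over $\mathbb{F}_q$ is a matrix $T\in \operatorname{M}_{mn}(\mathbb{F}_q)$ which, viewed as an $n\times n$ array of $m\times m$ blocks, has the identity matrix $I_m$ in block positions $(i+1,i)$ for $1\le i\le n-1$, has last block column $(c_0B, c_1B,\dots,c_{n-1}B)^{T}$ (blocks listed from top to bottom) for some $c_0,\dots,c_{n-1}\in\mathbb{F}_q$ and $B\in \operatorname{M}_m(\mathbb{F}_q)$, and has all other blocks zero. $\mathrm{TSR}(m,n;q)$ is the set of all such matrices and $\mathrm{TSRI}(m,n;q)$ the set of those whose characteristic polynomial $\det(XI_{mn}-T)$ is irreducible in $\mathbb{F}_q[X]$. -}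

module Defs where

open import Level using (Level; _⊔_) renaming (zero to lzero)
open import Data.Nat as ℕ using (ℕ; zero; suc; _≤_)
open import Data.Bool using (Bool; true; false; if_then_else_)
open import Data.Fin as Fin using (Fin; toℕ; combine)
open import Data.List as List using (List; []; _∷_; length; map; replicate; _++_)
open import Data.List.Relation.Unary.Any using (Any)
open import Data.List.Relation.Unary.AllPairs using (AllPairs)
open import Data.Vec as Vec using (Vec; lookup; tabulate; removeAt)
open import Data.Product using (Σ; ∃; ∃-syntax; _×_; _,_)
open import Data.Sum using (_⊎_)
open import Relation.Nullary using (¬_)
open import Relation.Nullary.Decidable using (⌊_⌋)
open import Relation.Binary.PropositionalEquality using (_≡_; _≢_)
open import Algebra.Bundles.Raw using (RawRing)
open import Algebra.Structures using (IsCommutativeRing)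
open import Function.Bundles using (_⇔_)

IsCard : ∀ {a ℓ p} {A : Set a} → (A → A → Set ℓ) → (A → Set p) → ℕ → Set (a ⊔ ℓ ⊔ p)
IsCard {A = A} _≈_ P k =
  Σ (List A) λ xs → length xs ≡ k
                  × AllPairs (λ x y → ¬ (x ≈ y)) xs
                  × (∀ x → P x ⇔ Any (x ≈_) xs)

record Field : Set₁ where
  infixl 7 _*_
  infixl 6 _+_
  infix  8 -_
  field
    Carrier : Set
    _+_ _*_ : Carrier → Carrier → Carrier
    -_      : Carrier → Carrier
    0# 1#   : Carrier
    isCommutativeRing : IsCommutativeRing _≡_ _+_ _*_ -_ 0# 1#
    0≢1     : 0# ≢ 1#
    inverse : ∀ x → x ≢ 0# → ∃[ y ] (x * y ≡ 1#)

  rawRing : RawRing lzero lzero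
  rawRing = record { Carrier = Carrier ; _≈_ = _≡_ ; _+_ = _+_ ; _*_ = _*_
                   ; -_ = -_ ; 0# = 0# ; 1# = 1# }

HasSize : Field → ℕ → Set
HasSize F q = IsCard {A = Field.Carrier F} _≡_ (λ _ → Data.Unit.⊤) q
  where import Data.Unit

-- A field extension K / F : a ring homomorphism ι : F → K
-- (automatically injective since F is a field).
record Extension (F K : Field) : Set where
  private
    module F = Field F
    module K = Field K
  field
    ι     : F.Carrier → K.Carrier
    ι-+   : ∀ a b → ι (a F.+ b) ≡ ι a K.+ ι b
    ι-*   : ∀ a b → ι (a F.* b) ≡ ι a K.* ι b
    ι-1   : ι F.1# ≡ K.1#

module _ {F K : Field} (E : Extension F K) where
  private
    module K = Field K
  open Extension E

  data InSubfield (λ₀ : K.Carrier) : K.Carrier → Set where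
    base : ∀ a → InSubfield λ₀ (ι a)
    gen  : InSubfield λ₀ λ₀
    add  : ∀ {x y} → InSubfield λ₀ x → InSubfield λ₀ y → InSubfield λ₀ (x K.+ y)
    mul  : ∀ {x y} → InSubfield λ₀ x → InSubfield λ₀ y → InSubfield λ₀ (x K.* y)
    neg  : ∀ {x} → InSubfield λ₀ x → InSubfield λ₀ (K.- x)
    inv  : ∀ {x y} → InSubfield λ₀ x → x K.* y ≡ K.1# → InSubfield λ₀ y

  Generates : K.Carrier → Set
  Generates λ₀ = ∀ x → InSubfield λ₀ x

-- Polynomials over a (raw) commutative ring, as coefficient lists
-- (constant term first), compared coefficientwise.

module Poly {c ℓ} (R : RawRing c ℓ) where
  open RawRing R

  Pol : Set c
  Pol = List Carrier

  infixl 6 _+ₚ_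
  infixl 7 _*ₚ_
  _+ₚ_ : Pol → Pol → Pol
  [] +ₚ q = q
  (a ∷ p) +ₚ [] = a ∷ p
  (a ∷ p) +ₚ (b ∷ q) = (a + b) ∷ (p +ₚ q)

  _·ₚ_ : Carrier → Pol → Pol
  a ·ₚ p = map (a *_) p

  -ₚ_ : Pol → Pol
  -ₚ p = map -_ p

  _*ₚ_ : Pol → Pol → Pol
  [] *ₚ q = []
  (a ∷ p) *ₚ q = (a ·ₚ q) +ₚ (0# ∷ (p *ₚ q))

  coeff : Pol → ℕ → Carrier
  coeff [] _ = 0#
  coeff (a ∷ p) zero = a
  coeff (a ∷ p) (suc i) = coeff p i

  infix 4 _≈ₚ_
  _≈ₚ_ : Pol → Pol → Set ℓ
  p ≈ₚ q = ∀ i → coeff p i ≈ coeff q i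

  0ₚ 1ₚ Xₚ : Pol
  0ₚ = []
  1ₚ = 1# ∷ []
  Xₚ = 0# ∷ 1# ∷ []

  Xpow : ℕ → Pol
  Xpow n = replicate n 0# ++ (1# ∷ [])

  DegAtMost : Pol → ℕ → Set ℓ
  DegAtMost p d = ∀ i → d ℕ.< i → coeff p i ≈ 0#

  IsUnitₚ : Pol → Set (c ⊔ ℓ)
  IsUnitₚ p = ∃[ u ] (p *ₚ u ≈ₚ 1ₚ)

  Irreducible : Pol → Set (c ⊔ ℓ)
  Irreducible p = ¬ (p ≈ₚ 0ₚ) × ¬ IsUnitₚ p
                × (∀ g h → p ≈ₚ g *ₚ h → IsUnitₚ g ⊎ IsUnitₚ h)

  polyRawRing : RawRing c ℓ
  polyRawRing = record { Carrier = Pol ; _≈_ = _≈ₚ_ ; _+_ = _+ₚ_ ; _*_ = _*ₚ_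
                       ; -_ = -ₚ_ ; 0# = 0ₚ ; 1# = 1ₚ }

Matrix : ∀ {a} → Set a → ℕ → Set a
Matrix A n = Vec (Vec A n) n

entry : ∀ {a} {A : Set a} {n} → Matrix A n → Fin n → Fin n → A
entry M i j = lookup (lookup M i) j

module Det {c ℓ} (R : RawRing c ℓ) where
  open RawRing R

  sgn : ∀ {k} → Fin k → Carrier → Carrier
  sgn Fin.zero x = x
  sgn (Fin.suc j) x = - sgn j x

  sumV : ∀ {k} → Vec Carrier k → Carrier
  sumV = Vec.foldr _ _+_ 0#

  det : ∀ {n} → Matrix Carrier n → Carrier
  det {zero} _ = 1#
  det {suc n} (row Vec.∷ rows) =
    sumV (tabulate λ j → sgn j (lookup row j * det (Vec.map (λ r → removeAt r j) rows)))

  δ : ∀ {n} → Fin n → Fin n → Carrier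
  δ i j = if ⌊ i Fin.≟ j ⌋ then 1# else 0#

  identity : ∀ {n} → Matrix Carrier n
  identity = tabulate λ i → tabulate λ j → δ i j

  _⊗_ : ∀ {n} → Matrix Carrier n → Matrix Carrier n → Matrix Carrier n
  A ⊗ B = tabulate λ i → tabulate λ j → sumV (tabulate λ k → entry A i k * entry B k j)

module OverField (F : Field) where
  open Field F
  module PF = Poly rawRing
  module DF = Det rawRing
  module PP = Poly PF.polyRawRing
  module DP = Det PF.polyRawRing
  open PF using (Pol; _+ₚ_; -ₚ_; Xₚ)

  charPoly : ∀ {N} → Matrix Carrier N → Pol
  charPoly T = DP.det (tabulate λ i → tabulate λ j →
                 (if ⌊ i Fin.≟ j ⌋ then Xₚ else PF.0ₚ) +ₚ (-ₚ (entry T i j ∷ [])))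

  IsInvertible : ∀ {m} → Matrix Carrier m → Set
  IsInvertible A = ∃[ B ] (A DF.⊗ B ≡ DF.identity × B DF.⊗ A ≡ DF.identity)

  -- the (i,j) block, entry (a,b), of the (m,n)-TSR matrix with data c, B:
  -- last block column (c_0 B, …, c_{n-1} B), identity blocks at (i+1,i),
  -- zero elsewhere
  tsrEntry : ∀ {m n} → Vec Carrier n → Matrix Carrier m →
             Fin n → Fin n → Fin m → Fin m → Carrier
  tsrEntry {m} {n} c B i j a b =
    if ⌊ toℕ j ℕ.≟ n ℕ.∸ 1 ⌋ then lookup c i * entry B a b
    else if ⌊ toℕ i ℕ.≟ suc (toℕ j) ⌋ then DF.δ a b
    else 0#

  -- T ∈ M_{mn}(F) (indexed so that row combine i a is row a of block row i)
  IsTSR : (m n : ℕ) → Matrix Carrier (n ℕ.* m) → Set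
  IsTSR m n T = ∃[ c ] ∃[ B ] (∀ i j a b →
                  entry T (combine i a) (combine j b) ≡ tsrEntry {m} {n} c B i j a b)

  IsTSRI : (m n : ℕ) → Matrix Carrier (n ℕ.* m) → Set
  IsTSRI m n T = IsTSR m n T × PF.Irreducible (charPoly T)

module _ {F K : Field} (E : Extension F K) where
  private
    module F = Field F
    module K = Field K
    module PF = Poly F.rawRing
    module PK = Poly K.rawRing
  open Extension E

  -- f ∈ S_q(m,n)  (here K plays F_{q^m}, F plays F_q)
  InS : ℕ → PK.Pol → Set
  InS n f = PK.Irreducible f
          × ∃[ λ₀ ] ∃[ g ] (Generates E λ₀
                            × PF.coeff g 0 ≡ F.1#
                            × PF.DegAtMost g (n ℕ.∸ 1)
                            × (f PK.≈ₚ (PK.Xpow n PK.+ₚ PK.-ₚ (λ₀ PK.·ₚ map ι g))))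

module Submission where

-- Matrices act on row vectors. A TSR matrix T with irreducible characteristic polynomial has
-- c₀B ≠ 0, so it has unique data normalised by c₀ = 1: a matrix B and g(X) = 1 + γ₁X + … .
-- For a finite k[X]-module V with |V| = |k|^n killed by a monic f of degree n, f is irreducible
-- iff V is simple; this follows from counting alone, since a map between finite sets of equal size
-- is injective iff it is surjective. By Cayley–Hamilton this applies to characteristic polynomials.
-- T acts on the sequences over F^m satisfying the recurrence w_{j+n} = (Σ g_i w_{j+i}) B. If T is
-- simple then so is B, so χ_B is irreducible and has exactly m roots λ in K, because it divides
-- X^(q^m) - X. A root λ and a nonzero u ∈ F^m determine an isomorphism K → F^m, p(λ) ↦ u p(B),
-- turning the sequences into those over K with w_{j+n} = λ Σ g_i w_{j+i}, which form a
-- K[X]-module killed by X^n - λ g. Its F[X]- and K[X]-submodules agree as λ = X^n / g there.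
-- Hence (T, λ, u) ↦ (X^n - λ g, the matrix with rows u B^i) is a bijection from triples as above
-- onto S × GL_m, and the triples number t · m · (q^m - 1).

-- Nothing is divided by m: the factor m(q^m - 1) is the number of pairs (λ, u), where λ is a root
-- of the characteristic polynomial of B and u is the image of 1 under the chosen isomorphism K →
-- F^m. The hypothesis mn > 1 enters as follows. If X killed a nonzero vector of a simple module
-- over F, that module would be a line, whereas the modules of sequences have q^(mn) elements. So X
-- acts without kernel, which gives c₀B ≠ 0 on the matrix side and λ ≠ 0 on the polynomial side.
-- These two facts make the normalised data of a matrix, and the pair (λ, g) of a polynomial,
-- unique. Polynomials are lists of coefficients up to `_≈ₚ_`, and little more than congruence and
-- coefficient formulas is proved about their products. They are used through their action on
-- modules, where any two polynomials in one operator commute. Accordingly F[X]/(h) never appears as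
-- a quotient ring but only as a module generated by one vector, and divisibility by h is read off
-- from what kills such a vector.

open import Defs
open import Level using (0ℓ)
open import Data.Nat as ℕ using (ℕ; zero; suc; _≤_; _<_; _⊔_; _^_; _∸_; z≤n; s≤s)
import Data.Nat.Properties as ℕ
open import Data.Fin as Fin using (Fin; toℕ; combine; remQuot; inject₁; fromℕ)
import Data.Fin.Properties as Fin
open import Data.Fin.Relation.Unary.Top using (view; ‵fromℕ; ‵inject₁)
open import Data.Fin.Permutation using (permutation)
open import Data.Bool using (Bool; true; false; if_then_else_)
open import Data.List as List using (List; []; _∷_; length; map; replicate)
open import Data.List.Relation.Unary.Any as Any using (Any; here; there)
open import Data.List.Relation.Unary.All as All using ([]; _∷_)
open import Data.List.Relation.Unary.AllPairs using (AllPairs; []; _∷_)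
open import Data.Vec as Vec using (Vec; lookup; tabulate; removeAt; []; _∷_; _∷ʳ_)
import Data.Vec.Properties as Vec
open import Data.Vec.Relation.Unary.All as VecAll using ([]; _∷_)
import Data.Vec.Relation.Unary.All.Properties as VecAll
open import Data.Product using (Σ; ∃-syntax; _×_; _,_; proj₁; proj₂)
open import Data.Product.Properties using (,-injectiveˡ; ,-injectiveʳ)
open import Data.Sum using (_⊎_; inj₁; inj₂)
open import Data.Empty using (⊥; ⊥-elim)
open import Data.Unit using (⊤; tt)
open import Function using (_∘_; id)
open import Function.Bundles using (Equivalence)
open import Relation.Nullary using (¬_; Dec; yes; no; contradiction)
open import Relation.Nullary.Decidable using (⌊_⌋)
open import Relation.Unary using (Decidable)
open import Relation.Binary using (IsEquivalence; tri<; tri≈; tri>; DecidableEquality)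
open import Relation.Binary.PropositionalEquality
  using (_≡_; _≢_; refl; sym; trans; cong; cong₂; subst; isEquivalence; module ≡-Reasoning)
open import Algebra.Bundles using (CommutativeRing; CommutativeMonoid; AbelianGroup)
open import Algebra.Structures using (IsAbelianGroup; IsCommutativeMonoid)

-- Finite enumerations

-- Indexing by `Fin k` gives access to the pigeonhole principle. Membership proofs are arguments of
-- `index`, so P may be undecidable and have many proofs.
record Enum {A : Set} (_≈_ : A → A → Set) (P : A → Set) (k : ℕ) : Set where
  field
    elem     : Fin k → A
    elem-P   : ∀ i → P (elem i)
    elem-inj : ∀ i j → elem i ≈ elem j → i ≡ j
    index    : ∀ x → P x → Fin k
    index-≈  : ∀ x p → x ≈ elem (index x p)

Finite : Set → ℕ → Set
Finite A = Enum {A} _≡_ (λ _ → ⊤)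

all-lookup : ∀ {A : Set} {P : A → Set} {xs} → All.All P xs → ∀ i → P (List.lookup xs i)
all-lookup (p ∷ _)  Fin.zero    = p
all-lookup (_ ∷ ps) (Fin.suc i) = all-lookup ps i

module _ {A : Set} {_≈_ : A → A → Set} (eq : IsEquivalence _≈_) where
  private module ≈ = IsEquivalence eq

  lookup-distinct : ∀ {xs} → AllPairs (λ x y → ¬ (x ≈ y)) xs →
    ∀ i j → List.lookup xs i ≈ List.lookup xs j → i ≡ j
  lookup-distinct (_ ∷ _)  Fin.zero    Fin.zero    _ = refl
  lookup-distinct (d ∷ _)  Fin.zero    (Fin.suc j) e = contradiction e (all-lookup d j)
  lookup-distinct (d ∷ _)  (Fin.suc i) Fin.zero    e = contradiction (≈.sym e) (all-lookup d i)
  lookup-distinct (_ ∷ ds) (Fin.suc i) (Fin.suc j) e = cong Fin.suc (lookup-distinct ds i j e)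

  lookup-any : ∀ xs i → Any (List.lookup xs i ≈_) xs
  lookup-any (_ ∷ _)  Fin.zero    = here ≈.refl
  lookup-any (_ ∷ xs) (Fin.suc i) = there (lookup-any xs i)

  enum : ∀ {P k} → IsCard _≈_ P k → Enum _≈_ P k
  enum (xs , refl , distinct , P⇔) = record
    { elem     = List.lookup xs
    ; elem-P   = λ i → Equivalence.from (P⇔ _) (lookup-any xs i)
    ; elem-inj = lookup-distinct distinct
    ; index    = λ x p → Any.index (Equivalence.to (P⇔ x) p)
    ; index-≈  = λ x p → lookup-index (Equivalence.to (P⇔ x) p)
    }
    where
    lookup-index : ∀ {x ys} (a : Any (x ≈_) ys) → x ≈ List.lookup ys (Any.index a)
    lookup-index (here e)  = e
    lookup-index (there a) = lookup-index a

module _ {A B : Set} {_≈₁_ : A → A → Set} {_≈₂_ : B → B → Set} (eq : IsEquivalence _≈₂_)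
         {P : A → Set} {Q : B → Set} where
  private module ≈ = IsEquivalence eq

  -- The map may consult the membership proof: in the final correspondence B is computed from a
  -- proof that P is invertible. Injectivity is therefore required across different proofs.
  enum-≤ : ∀ {k l} → Enum _≈₁_ P k → Enum _≈₂_ Q l →
    (f : ∀ x → P x → B) → (∀ x p → Q (f x p)) →
    (∀ {x y} p p′ → f x p ≈₂ f y p′ → x ≈₁ y) → k ≤ l
  enum-≤ E₁ E₂ f f-Q f-inj = Fin.injective⇒≤ {f = h} h-inj
    where
    module E₁ = Enum E₁
    module E₂ = Enum E₂
    h : _ → _
    h i = E₂.index (f (E₁.elem i) (E₁.elem-P i)) (f-Q _ _)
    h-inj : ∀ {i j} → h i ≡ h j → i ≡ j
    h-inj {i} {j} e = E₁.elem-inj i j (f-inj (E₁.elem-P i) (E₁.elem-P j)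
      (≈.trans (subst (λ z → f (E₁.elem i) (E₁.elem-P i) ≈₂ E₂.elem z) e (E₂.index-≈ _ _))
               (≈.sym (E₂.index-≈ _ _))))

  enum-map : ∀ {k} → Enum _≈₁_ P k →
    (f : ∀ x → P x → B) → (∀ x p → Q (f x p)) →
    (∀ {x y} p p′ → x ≈₁ y → f x p ≈₂ f y p′) →
    (∀ {x y} p p′ → f x p ≈₂ f y p′ → x ≈₁ y) →
    (∀ y → Q y → ∃[ x ] Σ (P x) λ p → y ≈₂ f x p) → Enum _≈₂_ Q k
  enum-map E f f-Q f-cong f-inj f-surj = record
    { elem     = λ i → f (E.elem i) (E.elem-P i)
    ; elem-P   = λ i → f-Q _ _
    ; elem-inj = λ i j e → E.elem-inj i j (f-inj _ _ e)
    ; index    = λ y q → let x , p , _ = f-surj y q in E.index x p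
    ; index-≈  = λ y q → let x , p , e = f-surj y q in ≈.trans e (f-cong p _ (E.index-≈ x p))
    }
    where module E = Enum E

-- The enumeration of a fibre may depend on the proof of `P x`, so an element over x is located in
-- the fibre over the listed copy of x, reached by `subst`.
enum-Σ : ∀ {A B : Set} {P : A → Set} {Q : A → B → Set} {k l} → Enum _≡_ P k →
  (∀ x → P x → Enum _≡_ (Q x) l) → Enum _≡_ (λ (xy : A × B) → P (proj₁ xy) × Q (proj₁ xy) (proj₂ xy)) (k ℕ.* l)
enum-Σ {A} {B} {P} {Q} {k} {l} E E′ = record
  { elem     = λ z → pair (remQuot l z)
  ; elem-P   = λ z → E.elem-P _ , Enum.elem-P (E′ _ _) _
  ; elem-inj = λ z z′ e → trans (sym (Fin.combine-remQuot {k} l z))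
      (trans (cong (λ ij → combine (proj₁ ij) (proj₂ ij)) (pair-inj (remQuot l z) (remQuot l z′) e))
             (Fin.combine-remQuot {k} l z′))
  ; index    = λ (x , y) (p , q) → combine (E.index x p) (idx x y p q)
  ; index-≈  = λ (x , y) (p , q) → trans (cong₂ _,_ (E.index-≈ x p) (Enum.index-≈ (E′ _ _) y _))
      (cong pair (sym (Fin.remQuot-combine (E.index x p) (idx x y p q))))
  }
  where
  module E = Enum E
  pair : Fin k × Fin l → A × B
  pair (i , j) = E.elem i , Enum.elem (E′ (E.elem i) (E.elem-P i)) j
  pair-inj : ∀ u v → pair u ≡ pair v → u ≡ v
  pair-inj (i , j) (i′ , j′) e with E.elem-inj i i′ (,-injectiveˡ e)
  ... | refl = cong (i ,_) (Enum.elem-inj (E′ _ _) j j′ (,-injectiveʳ e))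
  idx : ∀ x y (p : P x) → Q x y → Fin l
  idx x y p q = Enum.index (E′ _ (E.elem-P (E.index x p))) y (subst (λ z → Q z y) (E.index-≈ x p) q)

enum-× : ∀ {A B : Set} {P : A → Set} {Q : B → Set} {k l} → Enum _≡_ P k → Enum _≡_ Q l →
  Enum _≡_ (λ (xy : A × B) → P (proj₁ xy) × Q (proj₂ xy)) (k ℕ.* l)
enum-× E E′ = enum-Σ E (λ _ _ → E′)

module _ {k} {P : Fin (suc k) → Set} {r} (E : Enum _≡_ (P ∘ Fin.suc) r) where
  private module E = Enum E

  enum-cons : P Fin.zero → Enum _≡_ P (suc r)
  enum-cons p = record
    { elem     = el
    ; elem-P   = λ { Fin.zero → p ; (Fin.suc i) → E.elem-P i }
    ; elem-inj = λ { Fin.zero Fin.zero _ → refl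
                   ; (Fin.suc i) (Fin.suc j) e → cong Fin.suc (E.elem-inj i j (Fin.suc-injective e)) }
    ; index    = λ { Fin.zero _ → Fin.zero ; (Fin.suc x) q → Fin.suc (E.index x q) }
    ; index-≈  = λ { Fin.zero _ → refl ; (Fin.suc x) q → cong Fin.suc (E.index-≈ x q) }
    }
    where
    el : Fin (suc r) → Fin (suc k)
    el Fin.zero    = Fin.zero
    el (Fin.suc i) = Fin.suc (E.elem i)

  enum-skip : ¬ P Fin.zero → Enum _≡_ P r
  enum-skip ¬p = record
    { elem     = Fin.suc ∘ E.elem
    ; elem-P   = E.elem-P
    ; elem-inj = λ i j e → E.elem-inj i j (Fin.suc-injective e)
    ; index    = λ { Fin.zero q → contradiction q ¬p ; (Fin.suc x) q → E.index x q }
    ; index-≈  = λ { Fin.zero q → contradiction q ¬p ; (Fin.suc x) q → cong Fin.suc (E.index-≈ x q) }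
    }

-- Listing a predicate together with its complement keeps the identity r + s = k, by which roots are
-- later counted through the non-roots.
enum-dec-Fin : ∀ {k} {P : Fin k → Set} → Decidable P →
  ∃[ r ] ∃[ s ] Enum _≡_ P r × Enum _≡_ (¬_ ∘ P) s × r ℕ.+ s ≡ k
enum-dec-Fin {zero} P? = 0 , 0 , empty , empty , refl
  where
  empty : ∀ {Q : Fin 0 → Set} → Enum _≡_ Q 0
  empty = record { elem = λ () ; elem-P = λ () ; elem-inj = λ () ; index = λ () ; index-≈ = λ () }
enum-dec-Fin {suc k} P? with enum-dec-Fin {k} (P? ∘ Fin.suc) | P? Fin.zero
... | r , s , R , S , r+s | yes p = suc r , s , enum-cons R p , enum-skip S (λ ¬p → ¬p p) , cong suc r+s
... | r , s , R , S , r+s | no ¬p = r , suc s , enum-skip R ¬p , enum-cons S ¬p , trans (ℕ.+-suc r s) (cong suc r+s)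

finite-⊤ : Finite ⊤ 1
finite-⊤ = record { elem = λ _ → tt ; elem-P = λ _ → tt ; elem-inj = λ { Fin.zero Fin.zero _ → refl }
                  ; index = λ _ _ → Fin.zero ; index-≈ = λ _ _ → refl }

module _ {A : Set} {k} (E : Finite A k) where
  private module E = Enum E

  enum-dec : ∀ {P : A → Set} → Decidable P → ∃[ r ] ∃[ s ] Enum _≡_ P r × Enum _≡_ (¬_ ∘ P) s × r ℕ.+ s ≡ k
  enum-dec {P} P? with enum-dec-Fin (P? ∘ E.elem)
  ... | r , s , R , S , r+s = r , s , lift R , lift S , r+s
    where
    lift : ∀ {Q r} → Enum _≡_ (Q ∘ E.elem) r → Enum _≡_ Q r
    lift {Q} R = enum-map isEquivalence R (λ i _ → E.elem i) (λ _ q → q) (λ _ _ → cong E.elem)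
      (λ _ _ → E.elem-inj _ _) (λ y q → E.index y tt , subst Q (E.index-≈ y tt) q , E.index-≈ y tt)

  finite-≟ : DecidableEquality A
  finite-≟ x y with E.index x tt Fin.≟ E.index y tt
  ... | yes e = yes (trans (E.index-≈ x tt) (trans (cong E.elem e) (sym (E.index-≈ y tt))))
  ... | no ¬e = no λ { refl → ¬e refl }

  enum-remove : ∀ a → Enum _≡_ (_≢ a) (k ∸ 1)
  enum-remove a with enum-dec (λ x → finite-≟ x a)
  ... | r , s , R , S , r+s = subst (Enum _≡_ _) (sym (trans (cong (_∸ 1) (sym r+s)) (cong (λ z → z ℕ.+ s ∸ 1) r≡1))) S
    where
    r≡1 : r ≡ 1
    r≡1 = ℕ.≤-antisym (enum-≤ isEquivalence R finite-⊤ (λ _ _ → tt) (λ _ _ → tt) (λ { refl refl _ → refl }))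
                      (enum-≤ isEquivalence finite-⊤ R (λ _ _ → a) (λ _ _ → refl) (λ _ _ _ → refl))

  surjection-≥ : ∀ {B : Set} {l} → Finite B l → (f : A → B) → (∀ b → ∃[ a ] f a ≡ b) → l ≤ k
  surjection-≥ E′ f f-surj = enum-≤ isEquivalence E′ E (λ b _ → proj₁ (f-surj b)) (λ _ _ → tt)
    (λ {b} {b′} _ _ e → trans (sym (proj₂ (f-surj b))) (trans (cong f e) (proj₂ (f-surj b′))))

module _ {A B : Set} {k} (E : Finite A k) (E′ : Finite B k) where
  private module E = Enum E

  -- If b were missed, f would inject k elements into the k - 1 elements other than b. Together with
  -- its converse this stands in for dimension counts.
  injective⇒surjective : (f : A → B) → (∀ {x y} → f x ≡ f y → x ≡ y) → ∀ b → ∃[ a ] f a ≡ b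
  injective⇒surjective f f-inj b with Fin.any? (λ i → finite-≟ E′ (f (E.elem i)) b)
  ... | yes (i , e) = E.elem i , e
  ... | no ¬hit = contradiction (enum-≤ isEquivalence E (enum-remove E′ b) (λ x _ → f x)
      (λ x _ e → ¬hit (E.index x tt , trans (cong f (sym (E.index-≈ x tt))) e)) (λ _ _ → f-inj))
      (ℕ.<⇒≱ (pred< (Enum.index E′ b tt)))
    where
    pred< : ∀ {k} → Fin k → k ∸ 1 < k
    pred< {suc k} _ = ℕ.≤-refl

-- A section of f is injective, hence onto by the previous lemma, and therefore a two-sided inverse.
surjective⇒injective : ∀ {A B : Set} {k} → Finite A k → Finite B k → (f : A → B) → (∀ b → ∃[ a ] f a ≡ b) →
  ∀ {x y} → f x ≡ f y → x ≡ y
surjective⇒injective {A} {B} E E′ f f-surj {x} {y} e = trans (sym (left x)) (trans (cong g e) (left y))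
  where
  g : B → A
  g b = proj₁ (f-surj b)
  right : ∀ b → f (g b) ≡ b
  right b = proj₂ (f-surj b)
  g-surj : ∀ a → ∃[ b ] g b ≡ a
  g-surj = injective⇒surjective E′ E g (λ {b} {b′} e → trans (sym (right b)) (trans (cong f e) (right b′)))
  left : ∀ a → g (f a) ≡ a
  left a with g-surj a
  ... | b , refl = cong g (right b)

finite-Vec : ∀ {A : Set} {k} → Finite A k → ∀ n → Finite (Vec A n) (k ^ n)
finite-Vec E zero    = enum-map isEquivalence finite-⊤ (λ _ _ → []) (λ _ _ → tt) (λ _ _ _ → refl) (λ _ _ _ → refl)
  λ { [] _ → tt , tt , refl }
finite-Vec E (suc n) = enum-map isEquivalence (enum-× E (finite-Vec E n)) (λ (x , xs) _ → x ∷ xs) (λ _ _ → tt)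
  (λ { _ _ refl → refl }) (λ { _ _ refl → refl }) λ { (x ∷ xs) _ → (x , xs) , (tt , tt) , refl }

-- Polynomials over a field

module FieldProperties (k : Field) where
  open Field k

  commutativeRing : CommutativeRing 0ℓ 0ℓ
  commutativeRing = record { isCommutativeRing = isCommutativeRing }

  open CommutativeRing commutativeRing public
    using (+-assoc; +-comm; +-identityˡ; +-identityʳ; *-assoc; *-comm; *-identityˡ; *-identityʳ;
           distribˡ; distribʳ; zeroˡ; zeroʳ; -‿inverseˡ; -‿inverseʳ; +-commutativeMonoid; +-abelianGroup; ring; semiring)
  open import Algebra.Properties.Ring ring public
    using (-‿distribˡ-*; -‿distribʳ-*; -0#≈0#; -‿involutive; -‿+-comm; -1*x≈-x)

  *-cancel-0 : ∀ {x y} → x ≢ 0# → x * y ≡ 0# → y ≡ 0#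
  *-cancel-0 {x} {y} x≢0 xy≡0 with inverse x x≢0
  ... | z , xz≡1 = begin
    y  ≡⟨ *-identityˡ y ⟨
    1# * y  ≡⟨ cong (_* y) (trans (sym xz≡1) (*-comm x z)) ⟩
    z * x * y  ≡⟨ *-assoc z x y ⟩
    z * (x * y)  ≡⟨ trans (cong (z *_) xy≡0) (zeroʳ z) ⟩
    0#  ∎
    where open ≡-Reasoning

  *-≢0 : ∀ {x y} → x ≢ 0# → y ≢ 0# → x * y ≢ 0#
  *-≢0 x≢0 y≢0 = y≢0 ∘ *-cancel-0 x≢0

  x-y≡0⇒x≡y : ∀ {x y} → x + - y ≡ 0# → x ≡ y
  x-y≡0⇒x≡y {x} {y} e = begin
    x  ≡⟨ +-identityʳ x ⟨
    x + 0#  ≡⟨ cong (x +_) (-‿inverseˡ y) ⟨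
    x + (- y + y)  ≡⟨ +-assoc x (- y) y ⟨
    x + - y + y  ≡⟨ cong (_+ y) e ⟩
    0# + y  ≡⟨ +-identityˡ y ⟩
    y  ∎
    where open ≡-Reasoning

  +-interchange : ∀ a b c d → (a + b) + (c + d) ≡ (a + c) + (b + d)
  +-interchange = CM.interchange
    where import Algebra.Properties.CommutativeSemigroup
                   (CommutativeMonoid.commutativeSemigroup +-commutativeMonoid) as CM

module Polynomials (k : Field) where
  open Field k
  open FieldProperties k
  open Poly rawRing
  open ≡-Reasoning

  coeff-+ : ∀ p q i → coeff (p +ₚ q) i ≡ coeff p i + coeff q i
  coeff-+ []      q       i       = sym (+-identityˡ _)
  coeff-+ (a ∷ p) []      i       = sym (+-identityʳ _)
  coeff-+ (a ∷ p) (b ∷ q) zero    = refl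
  coeff-+ (a ∷ p) (b ∷ q) (suc i) = coeff-+ p q i

  coeff-· : ∀ a p i → coeff (a ·ₚ p) i ≡ a * coeff p i
  coeff-· a []      i       = sym (zeroʳ a)
  coeff-· a (b ∷ p) zero    = refl
  coeff-· a (b ∷ p) (suc i) = coeff-· a p i

  coeff-neg : ∀ p i → coeff (-ₚ p) i ≡ - coeff p i
  coeff-neg []      i       = sym -0#≈0#
  coeff-neg (b ∷ p) zero    = refl
  coeff-neg (b ∷ p) (suc i) = coeff-neg p i

  -- `_*ₚ_` recurses on its left factor, but long division extends the quotient, which is the right
  -- factor.
  coeff-*∷ : ∀ p c e i → coeff (p *ₚ (c ∷ e)) i ≡ c * coeff p i + coeff (0# ∷ p *ₚ e) i
  coeff-*∷ [] c e i = sym (trans (cong₂ _+_ (zeroʳ c) (0∷[] i)) (+-identityˡ 0#))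
    where
    0∷[] : ∀ i → coeff (0# ∷ []) i ≡ 0#
    0∷[] zero    = refl
    0∷[] (suc i) = refl
  coeff-*∷ (a ∷ p) c e zero = cong (_+ 0#) (*-comm a c)
  coeff-*∷ (a ∷ p) c e (suc i) = begin
    coeff (a ·ₚ e +ₚ p *ₚ (c ∷ e)) i
      ≡⟨ coeff-+ (a ·ₚ e) _ i ⟩
    coeff (a ·ₚ e) i + coeff (p *ₚ (c ∷ e)) i
      ≡⟨ cong (coeff (a ·ₚ e) i +_) (coeff-*∷ p c e i) ⟩
    coeff (a ·ₚ e) i + (c * coeff p i + coeff (0# ∷ p *ₚ e) i)
      ≡⟨ x∙yz≈y∙xz _ _ _ ⟩
    c * coeff p i + (coeff (a ·ₚ e) i + coeff (0# ∷ p *ₚ e) i)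
      ≡⟨ cong (c * coeff p i +_) (coeff-+ (a ·ₚ e) _ i) ⟨
    c * coeff p i + coeff (a ·ₚ e +ₚ (0# ∷ p *ₚ e)) i
      ∎
    where open import Algebra.Properties.CommutativeSemigroup
                   (CommutativeMonoid.commutativeSemigroup +-commutativeMonoid) using (x∙yz≈y∙xz)

  -- The strict bound makes the zero polynomial the case d = 0, where descents on the degree end.
  Deg< : Pol → ℕ → Set
  Deg< p d = ∀ i → d ≤ i → coeff p i ≡ 0#

  record Monic (n : ℕ) (p : Pol) : Set where
    constructor monic
    field
      leading : coeff p n ≡ 1#
      deg<    : Deg< p (suc n)

  deg<-∷ : ∀ {a p d} → Deg< (a ∷ p) (suc d) → Deg< p d
  deg<-∷ h i d≤i = h (suc i) (s≤s d≤i)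

  zero-*ₚ : ∀ p q → Deg< p 0 → Deg< (p *ₚ q) 0
  zero-*ₚ []      q h i _ = refl
  zero-*ₚ (a ∷ p) q h i _ = begin
    coeff (a ·ₚ q +ₚ (0# ∷ p *ₚ q)) i  ≡⟨ coeff-+ (a ·ₚ q) _ i ⟩
    coeff (a ·ₚ q) i + coeff (0# ∷ p *ₚ q) i  ≡⟨ cong₂ _+_ (coeff-· a q i) (shifted i) ⟩
    a * coeff q i + 0#  ≡⟨ +-identityʳ _ ⟩
    a * coeff q i  ≡⟨ cong (_* coeff q i) (h 0 z≤n) ⟩
    0# * coeff q i  ≡⟨ zeroˡ _ ⟩
    0#  ∎
    where
    shifted : ∀ i → coeff (0# ∷ p *ₚ q) i ≡ 0#
    shifted zero    = refl
    shifted (suc i) = zero-*ₚ p q (λ j _ → h (suc j) z≤n) i z≤n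

  *ₚ-zeroʳ : ∀ p q → q ≈ₚ 0ₚ → p *ₚ q ≈ₚ 0ₚ
  *ₚ-zeroʳ []      q h i = refl
  *ₚ-zeroʳ (a ∷ p) q h i = trans (coeff-+ (a ·ₚ q) _ i)
    (trans (cong₂ _+_ (trans (coeff-· a q i) (trans (cong (a *_) (h i)) (zeroʳ a))) (shifted i)) (+-identityˡ 0#))
    where
    shifted : ∀ i → coeff (0# ∷ p *ₚ q) i ≡ 0#
    shifted zero    = refl
    shifted (suc i) = *ₚ-zeroʳ p q h i

  +ₚ-cong : ∀ p p′ q q′ → p ≈ₚ p′ → q ≈ₚ q′ → p +ₚ q ≈ₚ p′ +ₚ q′
  +ₚ-cong p p′ q q′ h h′ i = trans (coeff-+ p q i) (trans (cong₂ _+_ (h i) (h′ i)) (sym (coeff-+ p′ q′ i)))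

  -ₚ-cong : ∀ p q → p ≈ₚ q → -ₚ p ≈ₚ -ₚ q
  -ₚ-cong p q h i = trans (coeff-neg p i) (trans (cong -_ (h i)) (sym (coeff-neg q i)))

  *ₚ-congˡ : ∀ p q q′ → q ≈ₚ q′ → p *ₚ q ≈ₚ p *ₚ q′
  *ₚ-congˡ []      q q′ h i = refl
  *ₚ-congˡ (a ∷ p) q q′ h   = +ₚ-cong (a ·ₚ q) (a ·ₚ q′) (0# ∷ p *ₚ q) (0# ∷ p *ₚ q′)
    (λ i → trans (coeff-· a q i) (trans (cong (a *_) (h i)) (sym (coeff-· a q′ i))))
    λ { zero → refl ; (suc i) → *ₚ-congˡ p q q′ h i }

  *ₚ-congʳ : ∀ p p′ q → p ≈ₚ p′ → p *ₚ q ≈ₚ p′ *ₚ q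
  *ₚ-congʳ []      p′       q h i = sym (zero-*ₚ p′ q (λ i _ → sym (h i)) i z≤n)
  *ₚ-congʳ (a ∷ p) []       q h i = zero-*ₚ (a ∷ p) q (λ i _ → h i) i z≤n
  *ₚ-congʳ (a ∷ p) (b ∷ p′) q h   = +ₚ-cong (a ·ₚ q) (b ·ₚ q) (0# ∷ p *ₚ q) (0# ∷ p′ *ₚ q)
    (λ i → cong (λ a → coeff (a ·ₚ q) i) (h 0))
    λ { zero → refl ; (suc i) → *ₚ-congʳ p p′ q (h ∘ suc) i }

  irreducible-cong : ∀ p p′ → p ≈ₚ p′ → Irreducible p → Irreducible p′
  irreducible-cong p p′ h (p≉0 , ¬unit , split) =
    (λ p′≈0 → p≉0 (λ i → trans (h i) (p′≈0 i))) ,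
    (λ { (u , p′u≈1) → ¬unit (u , λ i → trans (*ₚ-congʳ p p′ u h i) (p′u≈1 i)) }) ,
    λ g g′ p′≈ → split g g′ (λ i → trans (h i) (p′≈ i))

  -- Here and in `coeff-*ₚ`, a and b merely bound the degrees. The coefficients at a and b may
  -- vanish, so the induction can pass to tails of p without knowing their degree.
  deg<-*ₚ : ∀ p q {a b} → Deg< p (suc a) → Deg< q (suc b) → Deg< (p *ₚ q) (suc (a ℕ.+ b))
  coeff-*ₚ : ∀ p q {a b} → Deg< p (suc a) → Deg< q (suc b) → coeff (p *ₚ q) (a ℕ.+ b) ≡ coeff p a * coeff q b

  deg<-*ₚ []      q {a}     hp hq i _ = refl
  deg<-*ₚ (c ∷ p) q {a} {b} hp hq (suc i) (s≤s a+b≤i) = begin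
    coeff (c ·ₚ q +ₚ (0# ∷ p *ₚ q)) (suc i)  ≡⟨ coeff-+ (c ·ₚ q) _ (suc i) ⟩
    coeff (c ·ₚ q) (suc i) + coeff (p *ₚ q) i  ≡⟨ cong₂ _+_ (coeff-· c q (suc i)) (tail-zero a hp a+b≤i) ⟩
    c * coeff q (suc i) + 0#  ≡⟨ +-identityʳ _ ⟩
    c * coeff q (suc i)  ≡⟨ cong (c *_) (hq (suc i) (s≤s (ℕ.≤-trans (ℕ.m≤n+m b a) a+b≤i))) ⟩
    c * 0#  ≡⟨ zeroʳ c ⟩
    0#  ∎
    where
    tail-zero : ∀ a → Deg< (c ∷ p) (suc a) → a ℕ.+ b ≤ i → coeff (p *ₚ q) i ≡ 0#
    tail-zero zero    h _ = zero-*ₚ p q (deg<-∷ h) i z≤n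
    tail-zero (suc a) h l = deg<-*ₚ p q (deg<-∷ h) hq i l

  coeff-*ₚ []      q {a}     {b} hp hq = sym (zeroˡ _)
  coeff-*ₚ (c ∷ p) q {zero}  {b} hp hq = begin
    coeff (c ·ₚ q +ₚ (0# ∷ p *ₚ q)) b  ≡⟨ coeff-+ (c ·ₚ q) _ b ⟩
    coeff (c ·ₚ q) b + coeff (0# ∷ p *ₚ q) b  ≡⟨ cong₂ _+_ (coeff-· c q b) (shifted b) ⟩
    c * coeff q b + 0#  ≡⟨ +-identityʳ _ ⟩
    c * coeff q b  ∎
    where
    shifted : ∀ b → coeff (0# ∷ p *ₚ q) b ≡ 0#
    shifted zero    = refl
    shifted (suc b) = zero-*ₚ p q (deg<-∷ hp) b z≤n
  coeff-*ₚ (c ∷ p) q {suc a} {b} hp hq = begin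
    coeff (c ·ₚ q +ₚ (0# ∷ p *ₚ q)) (suc (a ℕ.+ b))  ≡⟨ coeff-+ (c ·ₚ q) _ _ ⟩
    coeff (c ·ₚ q) (suc (a ℕ.+ b)) + coeff (p *ₚ q) (a ℕ.+ b)  ≡⟨ cong₂ _+_ (coeff-· c q _) (coeff-*ₚ p q (deg<-∷ hp) hq) ⟩
    c * coeff q (suc (a ℕ.+ b)) + coeff p a * coeff q b  ≡⟨ cong (λ z → c * z + coeff p a * coeff q b) (hq _ (s≤s (ℕ.m≤n+m b a))) ⟩
    c * 0# + coeff p a * coeff q b  ≡⟨ cong (_+ coeff p a * coeff q b) (zeroʳ c) ⟩
    0# + coeff p a * coeff q b  ≡⟨ +-identityˡ _ ⟩
    coeff p a * coeff q b  ∎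

  deg<-+ : ∀ p q {d} → Deg< p d → Deg< q d → Deg< (p +ₚ q) d
  deg<-+ p q hp hq i d≤i = trans (coeff-+ p q i) (trans (cong₂ _+_ (hp i d≤i) (hq i d≤i)) (+-identityˡ 0#))

  deg<-· : ∀ a p {d} → Deg< p d → Deg< (a ·ₚ p) d
  deg<-· a p hp i d≤i = trans (coeff-· a p i) (trans (cong (a *_) (hp i d≤i)) (zeroʳ a))

  deg<-neg : ∀ p {d} → Deg< p d → Deg< (-ₚ p) d
  deg<-neg p hp i d≤i = trans (coeff-neg p i) (trans (cong -_ (hp i d≤i)) -0#≈0#)

  deg<-mono : ∀ p {c d} → c ≤ d → Deg< p c → Deg< p d
  deg<-mono p c≤d h i d≤i = h i (ℕ.≤-trans c≤d d≤i)

  deg<-pred : ∀ p {d} → coeff p d ≡ 0# → Deg< p (suc d) → Deg< p d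
  deg<-pred p {d} e h i d≤i with ℕ.m≤n⇒m<n∨m≡n d≤i
  ... | inj₁ d<i  = h i d<i
  ... | inj₂ refl = e

  deg<-length : ∀ p → Deg< p (length p)
  deg<-length []      i       _         = refl
  deg<-length (a ∷ p) (suc i) (s≤s l≤i) = deg<-length p i l≤i

  -- Induction along the coefficients of f: if f = p e + r then a + X f = p (X e) + (a + X r), and
  -- the only coefficient of a + X r in degree `suc n` is removed by subtracting a multiple c p,
  -- which puts c into the quotient.
  divide : ∀ {n p} → Monic (suc n) p → ∀ f → ∃[ e ] ∃[ r ] (f ≈ₚ p *ₚ e +ₚ r) × Deg< r (suc n)
  divide {n} {p} (monic lead deg) [] = [] , [] ,
    (λ i → sym (trans (coeff-+ (p *ₚ []) [] i) (trans (+-identityʳ _) (*[] p i)))) , λ _ _ → refl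
    where
    *[] : ∀ p i → coeff (p *ₚ []) i ≡ 0#
    *[] []      i       = refl
    *[] (a ∷ p) zero    = refl
    *[] (a ∷ p) (suc i) = *[] p i
  divide {n} {p} M@(monic lead deg) (a ∷ f) with divide M f
  ... | e , r , f≈ , r< = c ∷ e , r′ , eq , deg<-pred r′ top
        (deg<-+ (a ∷ r) (-ₚ (c ·ₚ p)) (λ { (suc i) (s≤s n≤i) → r< i n≤i }) (deg<-neg (c ·ₚ p) (deg<-· c p deg)))
    where
    c : Carrier
    c = coeff r n
    r′ : Pol
    r′ = (a ∷ r) +ₚ (-ₚ (c ·ₚ p))
    at : ∀ i → coeff r′ i ≡ coeff (a ∷ r) i + - (c * coeff p i)
    at i = trans (coeff-+ (a ∷ r) (-ₚ (c ·ₚ p)) i) (cong (coeff (a ∷ r) i +_) (trans (coeff-neg (c ·ₚ p) i) (cong -_ (coeff-· c p i))))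
    top : coeff r′ (suc n) ≡ 0#
    top = begin
      coeff r′ (suc n)  ≡⟨ at (suc n) ⟩
      c + - (c * coeff p (suc n))  ≡⟨ cong (λ z → c + - (c * z)) lead ⟩
      c + - (c * 1#)  ≡⟨ cong (λ z → c + - z) (*-identityʳ c) ⟩
      c + - c  ≡⟨ -‿inverseʳ c ⟩
      0#  ∎
    parts : ∀ i → coeff (a ∷ f) i ≡ coeff (0# ∷ p *ₚ e) i + coeff (a ∷ r) i
    parts zero    = sym (+-identityˡ a)
    parts (suc i) = trans (f≈ i) (coeff-+ (p *ₚ e) r i)
    eq : (a ∷ f) ≈ₚ p *ₚ (c ∷ e) +ₚ r′
    eq i = sym (begin
      coeff (p *ₚ (c ∷ e) +ₚ r′) i
        ≡⟨ coeff-+ (p *ₚ (c ∷ e)) r′ i ⟩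
      coeff (p *ₚ (c ∷ e)) i + coeff r′ i
        ≡⟨ cong₂ _+_ (coeff-*∷ p c e i) (trans (at i) (+-comm _ _)) ⟩
      (c * coeff p i + coeff (0# ∷ p *ₚ e) i) + (- (c * coeff p i) + coeff (a ∷ r) i)
        ≡⟨ +-interchange _ _ _ _ ⟩
      (c * coeff p i + - (c * coeff p i)) + (coeff (0# ∷ p *ₚ e) i + coeff (a ∷ r) i)
        ≡⟨ cong₂ _+_ (-‿inverseʳ _) (sym (parts i)) ⟩
      0# + coeff (a ∷ f) i
        ≡⟨ +-identityˡ _ ⟩
      coeff (a ∷ f) i
        ∎)

  module _ (_≟_ : DecidableEquality Carrier) where

    degree : ∀ p → p ≈ₚ 0ₚ ⊎ ∃[ d ] coeff p d ≢ 0# × Deg< p (suc d)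
    degree p = go (length p) (deg<-length p)
      where
      go : ∀ d → Deg< p d → p ≈ₚ 0ₚ ⊎ ∃[ d ] coeff p d ≢ 0# × Deg< p (suc d)
      go zero    h = inj₁ (λ i → h i z≤n)
      go (suc d) h with coeff p d ≟ 0#
      ... | yes e = go d (deg<-pred p e h)
      ... | no ¬e = inj₂ (d , ¬e , h)

    -- The product of the leading coefficients of e and of its inverse is nonzero and sits in degree
    -- d + d′, where 1 has coefficient zero unless d + d′ = 0.
    unit-deg : ∀ e {d} → IsUnitₚ e → coeff e d ≢ 0# → Deg< e (suc d) → d ≡ 0
    unit-deg e {d} (u , eu≈1) e≢0 e< with degree u
    ... | inj₁ u≈0 = contradiction (trans (sym (*ₚ-zeroʳ e u u≈0 0)) (eu≈1 0)) 0≢1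
    ... | inj₂ (d′ , u≢0 , u<) with d ℕ.+ d′ in eq
    ...   | zero  = ℕ.m+n≡0⇒m≡0 d eq
    ...   | suc j = contradiction (begin
            coeff e d * coeff u d′  ≡⟨ coeff-*ₚ e u e< u< ⟨
            coeff (e *ₚ u) (d ℕ.+ d′)  ≡⟨ cong (coeff (e *ₚ u)) eq ⟩
            coeff (e *ₚ u) (suc j)  ≡⟨ eu≈1 (suc j) ⟩
            0#  ∎) (*-≢0 e≢0 u≢0)

  constant-unit : ∀ g → coeff g 0 ≢ 0# → Deg< g 1 → IsUnitₚ g
  constant-unit g g≢0 g< with inverse _ g≢0
  ... | y , gy≡1 = (y ∷ []) , λ { zero → trans (coeff-*ₚ g (y ∷ []) g< y<) gy≡1
                                ; (suc i) → deg<-*ₚ g (y ∷ []) g< y< (suc i) (s≤s z≤n) }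
    where
    y< : Deg< (y ∷ []) 1
    y< (suc i) _ = refl

  make-monic : ∀ p {d} → coeff p d ≢ 0# → Deg< p (suc d) → ∃[ c ] Monic d (c ·ₚ p)
  make-monic p {d} p≢0 p< with inverse _ p≢0
  ... | y , py≡1 = y , monic (trans (coeff-· y p d) (trans (*-comm y _) py≡1)) (deg<-· y p p<)

-- Modules over k[X]

-- A module over k[X]: a vector space V over k with a linear operator T.
record Module (k : Field) : Set₁ where
  private module k = Field k
  infixl 6 _⊕_
  infixr 7 _•_
  infix  8 ⊖_
  field
    V   : Set
    _⊕_ : V → V → V
    ⊖_  : V → V
    𝟘   : V
    isAbelianGroup : IsAbelianGroup _≡_ _⊕_ 𝟘 ⊖_
    _•_ : k.Carrier → V → V
    •-distribˡ : ∀ a v w → a • (v ⊕ w) ≡ a • v ⊕ a • w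
    •-distribʳ : ∀ a b v → (a k.+ b) • v ≡ a • v ⊕ b • v
    •-assoc    : ∀ a b v → (a k.* b) • v ≡ a • b • v
    •-identity : ∀ v → k.1# • v ≡ v
    T   : V → V
    T-⊕ : ∀ v w → T (v ⊕ w) ≡ T v ⊕ T w
    T-• : ∀ a v → T (a • v) ≡ a • T v

  ⊕-abelianGroup : AbelianGroup 0ℓ 0ℓ
  ⊕-abelianGroup = record { isAbelianGroup = isAbelianGroup }

  open AbelianGroup ⊕-abelianGroup public
    using ()
    renaming (assoc to ⊕-assoc; comm to ⊕-comm; identityˡ to ⊕-identityˡ; identityʳ to ⊕-identityʳ;
              inverseˡ to ⊖-inverseˡ; inverseʳ to ⊖-inverseʳ; commutativeMonoid to ⊕-commutativeMonoid)
  open import Algebra.Properties.AbelianGroup ⊕-abelianGroup public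
    using ()
    renaming (⁻¹-∙-comm to ⊖-⊕-comm; ⁻¹-involutive to ⊖-involutive; ε⁻¹≈ε to ⊖𝟘≡𝟘; x∙y⁻¹≈ε⇒x≈y to v⊖w≡𝟘⇒v≡w;
              inverseʳ-unique to ⊖-unique; identityˡ-unique to 𝟘-unique; x≈y⇒x∙y⁻¹≈ε to v≡w⇒v⊖w≡𝟘)
  open import Algebra.Properties.CommutativeMonoid.Sum ⊕-commutativeMonoid public
    using (sum; sum-cong-≗; ∑-distrib-+; sum-replicate-zero)
  open import Algebra.Properties.CommutativeSemigroup
    (CommutativeMonoid.commutativeSemigroup ⊕-commutativeMonoid) public
    using () renaming (interchange to ⊕-interchange)

module Action {k : Field} (M : Module k) where
  open Field k
  open FieldProperties k
  open Poly rawRing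
  open Polynomials k
  open Module M
  open ≡-Reasoning

  •-zeroˡ : ∀ v → 0# • v ≡ 𝟘
  •-zeroˡ v = 𝟘-unique (0# • v) (0# • v)
    (trans (sym (•-distribʳ 0# 0# v)) (cong (_• v) (+-identityˡ 0#)))

  •-zeroʳ : ∀ a → a • 𝟘 ≡ 𝟘
  •-zeroʳ a = 𝟘-unique (a • 𝟘) (a • 𝟘) (trans (sym (•-distribˡ a 𝟘 𝟘)) (cong (a •_) (⊕-identityˡ 𝟘)))

  T-𝟘 : T 𝟘 ≡ 𝟘
  T-𝟘 = 𝟘-unique (T 𝟘) (T 𝟘) (trans (sym (T-⊕ 𝟘 𝟘)) (cong T (⊕-identityˡ 𝟘)))

  neg-• : ∀ a v → (- a) • v ≡ ⊖ (a • v)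
  neg-• a v = ⊖-unique (a • v) ((- a) • v) (begin
    a • v ⊕ (- a) • v  ≡⟨ •-distribʳ a (- a) v ⟨
    (a + - a) • v  ≡⟨ cong (_• v) (-‿inverseʳ a) ⟩
    0# • v  ≡⟨ •-zeroˡ v ⟩
    𝟘  ∎)

  act : Pol → V → V
  act []      v = 𝟘
  act (a ∷ p) v = a • v ⊕ T (act p v)

  act-⊕ : ∀ p v w → act p (v ⊕ w) ≡ act p v ⊕ act p w
  act-⊕ []      v w = sym (⊕-identityˡ 𝟘)
  act-⊕ (a ∷ p) v w = trans (cong₂ _⊕_ (•-distribˡ a v w) (trans (cong T (act-⊕ p v w)) (T-⊕ _ _))) (⊕-interchange _ _ _ _)

  act-𝟘 : ∀ p → act p 𝟘 ≡ 𝟘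
  act-𝟘 p = 𝟘-unique (act p 𝟘) (act p 𝟘) (trans (sym (act-⊕ p 𝟘 𝟘)) (cong (act p) (⊕-identityˡ 𝟘)))

  act-⊖ : ∀ p v → act p (⊖ v) ≡ ⊖ act p v
  act-⊖ p v = ⊖-unique (act p v) (act p (⊖ v)) (begin
    act p v ⊕ act p (⊖ v)  ≡⟨ act-⊕ p v (⊖ v) ⟨
    act p (v ⊕ ⊖ v)  ≡⟨ cong (act p) (⊖-inverseʳ v) ⟩
    act p 𝟘  ≡⟨ act-𝟘 p ⟩
    𝟘  ∎)

  act-• : ∀ p a v → act p (a • v) ≡ a • act p v
  act-• []      a v = sym (•-zeroʳ a)
  act-• (b ∷ p) a v = begin
    b • a • v ⊕ T (act p (a • v))
      ≡⟨ cong₂ _⊕_ (trans (sym (•-assoc b a v)) (trans (cong (_• v) (*-comm b a)) (•-assoc a b v)))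
                   (trans (cong T (act-• p a v)) (T-• a _)) ⟩
    a • b • v ⊕ a • T (act p v)  ≡⟨ •-distribˡ a _ _ ⟨
    a • (b • v ⊕ T (act p v))  ∎

  act-T : ∀ p v → act p (T v) ≡ T (act p v)
  act-T []      v = sym T-𝟘
  act-T (a ∷ p) v = trans (cong₂ _⊕_ (sym (T-• a v)) (cong T (act-T p v))) (sym (T-⊕ _ _))

  act-+ₚ : ∀ p q v → act (p +ₚ q) v ≡ act p v ⊕ act q v
  act-+ₚ []      q       v = sym (⊕-identityˡ _)
  act-+ₚ (a ∷ p) []      v = sym (⊕-identityʳ _)
  act-+ₚ (a ∷ p) (b ∷ q) v = trans
    (cong₂ _⊕_ (•-distribʳ a b v) (trans (cong T (act-+ₚ p q v)) (T-⊕ _ _))) (⊕-interchange _ _ _ _)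

  act-·ₚ : ∀ a p v → act (a ·ₚ p) v ≡ a • act p v
  act-·ₚ a []      v = sym (•-zeroʳ a)
  act-·ₚ a (b ∷ p) v = trans (cong₂ _⊕_ (•-assoc a b v) (trans (cong T (act-·ₚ a p v)) (T-• a _))) (sym (•-distribˡ a _ _))

  act-negₚ : ∀ p v → act (-ₚ p) v ≡ ⊖ act p v
  act-negₚ p v = begin
    act (-ₚ p) v  ≡⟨ as-scalar p ⟩
    (- 1#) • act p v  ≡⟨ neg-• 1# _ ⟩
    ⊖ (1# • act p v)  ≡⟨ cong ⊖_ (•-identity _) ⟩
    ⊖ act p v  ∎
    where
    as-scalar : ∀ p → act (-ₚ p) v ≡ (- 1#) • act p v
    as-scalar []      = sym (•-zeroʳ _)
    as-scalar (b ∷ p) = trans (cong₂ _⊕_ (trans (cong (_• v) (sym (-1*x≈-x b))) (•-assoc _ b v))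
      (trans (cong T (as-scalar p)) (T-• _ _))) (sym (•-distribˡ _ _ _))

  act-shift : ∀ p v → act (0# ∷ p) v ≡ T (act p v)
  act-shift p v = trans (cong (_⊕ T (act p v)) (•-zeroˡ v)) (⊕-identityˡ _)

  act-*ₚ : ∀ p q v → act (p *ₚ q) v ≡ act p (act q v)
  act-*ₚ []      q v = refl
  act-*ₚ (a ∷ p) q v = begin
    act (a ·ₚ q +ₚ (0# ∷ p *ₚ q)) v  ≡⟨ act-+ₚ (a ·ₚ q) _ v ⟩
    act (a ·ₚ q) v ⊕ act (0# ∷ p *ₚ q) v  ≡⟨ cong₂ _⊕_ (act-·ₚ a q v) (act-shift (p *ₚ q) v) ⟩
    a • act q v ⊕ T (act (p *ₚ q) v)  ≡⟨ cong (λ z → a • act q v ⊕ T z) (act-*ₚ p q v) ⟩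
    a • act q v ⊕ T (act p (act q v))  ∎

  -- This takes the place of commutativity of `_*ₚ_`: both polynomials are evaluated at the same
  -- operator.
  act-comm : ∀ p q v → act p (act q v) ≡ act q (act p v)
  act-comm []      q v = sym (act-𝟘 q)
  act-comm (a ∷ p) q v = begin
    a • act q v ⊕ T (act p (act q v))  ≡⟨ cong₂ _⊕_ (sym (act-• q a v)) (trans (cong T (act-comm p q v)) (sym (act-T q _))) ⟩
    act q (a • v) ⊕ act q (T (act p v)) ≡⟨ act-⊕ q _ _ ⟨
    act q (a • v ⊕ T (act p v))  ∎

  act-≈0 : ∀ p v → p ≈ₚ 0ₚ → act p v ≡ 𝟘
  act-≈0 []      v h = refl
  act-≈0 (a ∷ p) v h = begin
    a • v ⊕ T (act p v)  ≡⟨ cong₂ (λ a z → a • v ⊕ T z) (h 0) (act-≈0 p v (λ i → h (suc i))) ⟩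
    0# • v ⊕ T 𝟘  ≡⟨ cong₂ _⊕_ (•-zeroˡ v) T-𝟘 ⟩
    𝟘 ⊕ 𝟘  ≡⟨ ⊕-identityˡ 𝟘 ⟩
    𝟘  ∎

  act-≈ : ∀ p q v → p ≈ₚ q → act p v ≡ act q v
  act-≈ []      q       v h = sym (act-≈0 q v (λ i → sym (h i)))
  act-≈ (a ∷ p) []      v h = act-≈0 (a ∷ p) v h
  act-≈ (a ∷ p) (b ∷ q) v h = cong₂ (λ a z → a • v ⊕ T z) (h 0) (act-≈ p q v (λ i → h (suc i)))

  act-constant : ∀ a v → act (a ∷ []) v ≡ a • v
  act-constant a v = trans (cong (a • v ⊕_) T-𝟘) (⊕-identityʳ _)

  act-1 : ∀ v → act 1ₚ v ≡ v
  act-1 v = trans (act-constant 1# v) (•-identity v)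

  act-X : ∀ v → act Xₚ v ≡ T v
  act-X v = trans (act-shift 1ₚ v) (cong T (act-1 v))

  act-difference : ∀ p q v → act (p +ₚ -ₚ q) v ≡ act p v ⊕ ⊖ act q v
  act-difference p q v = trans (act-+ₚ p (-ₚ q) v) (cong (act p v ⊕_) (act-negₚ q v))

  act-unit : ∀ p v → IsUnitₚ p → act p v ≡ 𝟘 → v ≡ 𝟘
  act-unit p v (u , pu≈1) pv≡𝟘 = begin
    v  ≡⟨ act-1 v ⟨
    act 1ₚ v  ≡⟨ act-≈ (p *ₚ u) 1ₚ v pu≈1 ⟨
    act (p *ₚ u) v  ≡⟨ act-*ₚ p u v ⟩
    act p (act u v)  ≡⟨ act-comm p u v ⟩
    act u (act p v)  ≡⟨ cong (act u) pv≡𝟘 ⟩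
    act u 𝟘  ≡⟨ act-𝟘 u ⟩
    𝟘  ∎

  -- Every nonzero vector generates the module. The zero module satisfies this too, so results that
  -- draw a conclusion from simplicity also ask for a nonzero vector where it matters.
  Simple : Set
  Simple = ∀ v → v ≢ 𝟘 → ∀ w → ∃[ p ] act p v ≡ w

record Linear {k : Field} (M N : Module k) : Set where
  private
    module M = Module M
    module N = Module N
  field
    to   : M.V → N.V
    to-⊕ : ∀ v w → to (v M.⊕ w) ≡ to v N.⊕ to w
    to-• : ∀ a v → to (a M.• v) ≡ a N.• to v

  to-𝟘 : to M.𝟘 ≡ N.𝟘
  to-𝟘 = N.𝟘-unique (to M.𝟘) (to M.𝟘) (trans (sym (to-⊕ M.𝟘 M.𝟘)) (cong to (M.⊕-identityˡ M.𝟘)))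

  to-⊖ : ∀ v → to (M.⊖ v) ≡ N.⊖ to v
  to-⊖ v = N.⊖-unique (to v) (to (M.⊖ v)) (trans (sym (to-⊕ v (M.⊖ v))) (trans (cong to (M.⊖-inverseʳ v)) to-𝟘))

  to-sum : ∀ {n} (f : Fin n → M.V) → to (M.sum f) ≡ N.sum (to ∘ f)
  to-sum {zero}  f = to-𝟘
  to-sum {suc n} f = trans (to-⊕ _ _) (cong (to (f Fin.zero) N.⊕_) (to-sum (f ∘ Fin.suc)))

linear-∘ : ∀ {k} {L M N : Module k} → Linear M N → Linear L M → Linear L N
linear-∘ g f = record
  { to   = g.to ∘ f.to
  ; to-⊕ = λ v w → trans (cong g.to (f.to-⊕ v w)) (g.to-⊕ _ _)
  ; to-• = λ a v → trans (cong g.to (f.to-• a v)) (g.to-• a _)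
  }
  where
  module f = Linear f
  module g = Linear g

linear-inverse : ∀ {k} {M N : Module k} (f : Linear M N) (g : Module.V N → Module.V M) →
  (∀ v → g (Linear.to f v) ≡ v) → (∀ w → Linear.to f (g w) ≡ w) → Linear N M
linear-inverse {M = M} {N} f g gf fg = record
  { to   = g
  ; to-⊕ = λ v w → trans (cong g (trans (sym (cong₂ N._⊕_ (fg v) (fg w))) (sym (f.to-⊕ _ _)))) (gf _)
  ; to-• = λ a v → trans (cong g (trans (sym (cong (a N.•_) (fg v))) (sym (f.to-• _ _)))) (gf _)
  }
  where
  module f = Linear f
  module N = Module N

record Hom {k : Field} (M N : Module k) : Set where
  private
    module M = Module M
    module N = Module N
  field
    linear : Linear M N
  open Linear linear public
  field
    to-T : ∀ v → to (M.T v) ≡ N.T (to v)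

  to-act : ∀ p v → to (Action.act M p v) ≡ Action.act N p (to v)
  to-act []      v = to-𝟘
  to-act (a ∷ p) v = trans (to-⊕ _ _) (cong₂ N._⊕_ (to-• a v) (trans (to-T _) (cong N.T (to-act p v))))

record Iso {k : Field} (M N : Module k) : Set where
  private
    module M = Module M
    module N = Module N
  field
    hom : Hom M N
  open Hom hom public
  field
    from    : N.V → M.V
    from-to : ∀ v → from (to v) ≡ v
    to-from : ∀ w → to (from w) ≡ w

  to-injective : ∀ {v w} → to v ≡ to w → v ≡ w
  to-injective {v} {w} e = trans (sym (from-to v)) (trans (cong from e) (from-to w))

  inverse-hom : Hom N M
  inverse-hom = record
    { linear = linear-inverse linear from from-to to-from
    ; to-T   = λ v → to-injective (trans (to-from _) (sym (trans (to-T _) (cong N.T (to-from v)))))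
    }

  iso-simple : Action.Simple M → Action.Simple N
  iso-simple simple v v≢𝟘 w with simple (from v) (λ e → v≢𝟘 (trans (sym (to-from v)) (trans (cong to e) to-𝟘))) (from w)
  ... | p , e = p , (begin
    Action.act N p v  ≡⟨ cong (Action.act N p) (to-from v) ⟨
    Action.act N p (to (from v))  ≡⟨ to-act p (from v) ⟨
    to (Action.act M p (from v))  ≡⟨ cong to e ⟩
    to (from w)  ≡⟨ to-from w ⟩
    w  ∎)
    where open ≡-Reasoning

iso-sym : ∀ {k} {M N : Module k} → Iso M N → Iso N M
iso-sym I = record { hom = I.inverse-hom ; from = I.to ; from-to = I.to-from ; to-from = I.from-to }
  where module I = Iso I

-- Coefficient vectors and the counting criterion for irreducibility

module VecPolynomials (k : Field) where
  open Field k
  open FieldProperties k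
  open Poly rawRing
  open Polynomials k

  poly : ∀ {n} → Vec Carrier n → Pol
  poly = Vec.toList

  poly-deg< : ∀ {n} (a : Vec Carrier n) → Deg< (poly a) n
  poly-deg< []      i       _         = refl
  poly-deg< (x ∷ a) (suc i) (s≤s n≤i) = poly-deg< a i n≤i

  coeff-poly : ∀ {n} (a : Vec Carrier n) i → coeff (poly a) (toℕ i) ≡ lookup a i
  coeff-poly (x ∷ a) Fin.zero    = refl
  coeff-poly (x ∷ a) (Fin.suc i) = coeff-poly a i

  poly-injective : ∀ {n} (a b : Vec Carrier n) → poly a ≈ₚ poly b → a ≡ b
  poly-injective []      []      h = refl
  poly-injective (x ∷ a) (y ∷ b) h = cong₂ _∷_ (h 0) (poly-injective a b (h ∘ suc))

  coeffs : ∀ n → Pol → Vec Carrier n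
  coeffs zero    p       = []
  coeffs (suc n) []      = 0# ∷ coeffs n []
  coeffs (suc n) (a ∷ p) = a ∷ coeffs n p

  poly-coeffs : ∀ n p → Deg< p n → poly (coeffs n p) ≈ₚ p
  poly-coeffs zero    p       h i       = sym (h i z≤n)
  poly-coeffs (suc n) []      h zero    = refl
  poly-coeffs (suc n) []      h (suc i) = poly-coeffs n [] (λ _ _ → refl) i
  poly-coeffs (suc n) (a ∷ p) h zero    = refl
  poly-coeffs (suc n) (a ∷ p) h (suc i) = poly-coeffs n p (deg<-∷ h) i

module Simplicity {k : Field} (M : Module k) {q} (finite-k : Finite (Field.Carrier k) q) where
  open Field k
  open FieldProperties k
  open Poly rawRing
  open Polynomials k
  open VecPolynomials k
  open Module M
  open Action M
  open ≡-Reasoning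

  private
    _≟_ : DecidableEquality Carrier
    _≟_ = finite-≟ finite-k

  eval : ∀ {n} → V → Vec Carrier n → V
  eval v a = act (poly a) v

  -- This says that v, T v, ..., T^(n-1) v are linearly independent.
  Faithful : ℕ → V → Set
  Faithful n v = ∀ p → Deg< p n → act p v ≡ 𝟘 → p ≈ₚ 0ₚ

  -- Euclidean descent: a monic p of minimal degree killing v divides f.
  irreducible⇒faithful : ∀ {n f v} → Irreducible f → Monic n f → v ≢ 𝟘 → act f v ≡ 𝟘 → Faithful n v
  irreducible⇒faithful {n} {f} {v} (_ , _ , split) (monic lead _) v≢𝟘 fv≡𝟘 = λ p → go n ℕ.≤-refl p
    where
    go : ∀ j → j ≤ n → ∀ p → Deg< p j → act p v ≡ 𝟘 → p ≈ₚ 0ₚ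
    go zero    _   p p< _ i = p< i z≤n
    go (suc j) j<n p p< pv≡𝟘 with coeff p j ≟ 0#
    ... | yes e = go j (ℕ.<⇒≤ j<n) p (deg<-pred p e p<) pv≡𝟘
    ... | no ¬e with make-monic p ¬e p<
    ...   | c , M₁@(monic lead₁ p₁<) = ⊥-elim (absurd j j<n M₁ go-rec)
      where
      p₁ : Pol
      p₁ = c ·ₚ p
      p₁v≡𝟘 : act p₁ v ≡ 𝟘
      p₁v≡𝟘 = trans (act-·ₚ c p v) (trans (cong (c •_) pv≡𝟘) (•-zeroʳ c))
      go-rec : ∀ r → Deg< r j → act r v ≡ 𝟘 → r ≈ₚ 0ₚ
      go-rec = go j (ℕ.<⇒≤ j<n)
      ¬unit : ¬ IsUnitₚ p₁
      ¬unit u = v≢𝟘 (act-unit p₁ v u p₁v≡𝟘)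
      absurd : ∀ j → j < n → Monic j p₁ → (∀ r → Deg< r j → act r v ≡ 𝟘 → r ≈ₚ 0ₚ) → ⊥
      absurd zero    _   (monic lead₁ p₁<) _   = ¬unit (constant-unit p₁ (λ e → 0≢1 (trans (sym e) lead₁)) p₁<)
      absurd (suc j) j<n M₁@(monic lead₁ p₁<) rec with divide M₁ f
      ... | e , r , f≈ , r< = by-split (split p₁ e f≈p₁e)
        where
        rv≡𝟘 : act r v ≡ 𝟘
        rv≡𝟘 = begin
          act r v  ≡⟨ ⊕-identityˡ _ ⟨
          𝟘 ⊕ act r v  ≡⟨ cong (_⊕ act r v) (act-𝟘 e) ⟨
          act e 𝟘 ⊕ act r v  ≡⟨ cong (λ z → act e z ⊕ act r v) p₁v≡𝟘 ⟨
          act e (act p₁ v) ⊕ act r v  ≡⟨ cong (_⊕ act r v) (trans (act-comm e p₁ v) (sym (act-*ₚ p₁ e v))) ⟩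
          act (p₁ *ₚ e) v ⊕ act r v  ≡⟨ act-+ₚ (p₁ *ₚ e) r v ⟨
          act (p₁ *ₚ e +ₚ r) v  ≡⟨ act-≈ f (p₁ *ₚ e +ₚ r) v f≈ ⟨
          act f v  ≡⟨ fv≡𝟘 ⟩
          𝟘  ∎
        f≈p₁e : f ≈ₚ p₁ *ₚ e
        f≈p₁e i = trans (f≈ i) (trans (coeff-+ (p₁ *ₚ e) r i)
          (trans (cong (coeff (p₁ *ₚ e) i +_) (rec r r< rv≡𝟘 i)) (+-identityʳ _)))
        by-split : IsUnitₚ p₁ ⊎ IsUnitₚ e → ⊥
        by-split (inj₁ unit) = ¬unit unit
        -- A unit e is a nonzero constant, so f = p₁ e would have degree below n, against its
        -- leading coefficient 1 in degree n.
        by-split (inj₂ unit) with degree _≟_ e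
        ... | inj₁ e≈0 = 0≢1 (trans (sym (trans (f≈p₁e n) (*ₚ-zeroʳ p₁ e e≈0 n))) lead)
        ... | inj₂ (d , e≢0 , e<) with unit-deg _≟_ e unit e≢0 e<
        ...   | refl = 0≢1 (trans (sym (trans (f≈p₁e n)
                (deg<-*ₚ p₁ e p₁< e< n (subst (λ z → suc (suc z) ≤ n) (sym (ℕ.+-identityʳ j)) j<n)))) lead)

  eval-injective : ∀ {n v} → Faithful n v → ∀ {a b : Vec Carrier n} → eval v a ≡ eval v b → a ≡ b
  eval-injective {n} {v} faithful {a} {b} e = poly-injective a b λ i → x-y≡0⇒x≡y (trans
    (sym (trans (coeff-+ (poly a) (-ₚ poly b) i) (cong (coeff (poly a) i +_) (coeff-neg (poly b) i))))
    (faithful (poly a +ₚ -ₚ poly b) (deg<-+ (poly a) _ (poly-deg< a) (deg<-neg (poly b) (poly-deg< b)))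
      (trans (act-difference (poly a) (poly b) v) (v≡w⇒v⊖w≡𝟘 e)) i))

  -- The q^n combinations of v, ..., T^(n-1) v are distinct, so they exhaust a space of q^n
  -- elements.
  faithful⇒cyclic : ∀ {n v} → Finite V (q ^ n) → Faithful n v → ∀ w → ∃[ a ] eval {n} v a ≡ w
  faithful⇒cyclic {n} {v} finite-V faithful =
    injective⇒surjective (finite-Vec finite-k n) finite-V (eval v) (eval-injective faithful)

  irreducible⇒simple : ∀ {n f} → Finite V (q ^ n) → Monic n f → (∀ v → act f v ≡ 𝟘) → Irreducible f → Simple
  irreducible⇒simple finite-V M f-kills irr v v≢𝟘 w =
    let a , e = faithful⇒cyclic finite-V (irreducible⇒faithful irr M v≢𝟘 (f-kills v)) w in poly a , e

  reduce : ∀ {n f v} → Monic (suc n) f → act f v ≡ 𝟘 → ∀ p → ∃[ r ] Deg< r (suc n) × act p v ≡ act r v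
  reduce {n} {f} {v} M fv≡𝟘 p with divide M p
  ... | e , r , p≈ , r< = r , r< , (begin
    act p v  ≡⟨ act-≈ p (f *ₚ e +ₚ r) v p≈ ⟩
    act (f *ₚ e +ₚ r) v  ≡⟨ act-+ₚ (f *ₚ e) r v ⟩
    act (f *ₚ e) v ⊕ act r v  ≡⟨ cong (_⊕ act r v) (trans (act-*ₚ f e v) (act-comm f e v)) ⟩
    act e (act f v) ⊕ act r v  ≡⟨ cong (λ z → act e z ⊕ act r v) fv≡𝟘 ⟩
    act e 𝟘 ⊕ act r v  ≡⟨ cong (_⊕ act r v) (act-𝟘 e) ⟩
    𝟘 ⊕ act r v  ≡⟨ ⊕-identityˡ _ ⟩
    act r v  ∎)

  reduce-eval : ∀ {n f v} → Monic (suc n) f → act f v ≡ 𝟘 → ∀ p → ∃[ a ] eval {suc n} v a ≡ act p v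
  reduce-eval {n} {v = v} M fv≡𝟘 p with reduce M fv≡𝟘 p
  ... | r , r< , e = coeffs (suc n) r , trans (act-≈ (poly (coeffs (suc n) r)) r v (poly-coeffs (suc n) r r<)) (sym e)

  -- Evaluation at v is a surjection between sets of q^n elements, hence injective, and p takes the
  -- same value there as the zero polynomial.
  cyclic⇒faithful : ∀ {n v} → Finite V (q ^ n) → (∀ w → ∃[ a ] eval {n} v a ≡ w) → Faithful n v
  cyclic⇒faithful {n} {v} finite-V cyclic p p< pv≡𝟘 i = begin
    coeff p i  ≡⟨ poly-coeffs n p p< i ⟨
    coeff (poly (coeffs n p)) i  ≡⟨ cong (λ a → coeff (poly a) i) coeffs≡ ⟩
    coeff (poly (coeffs n [])) i  ≡⟨ poly-coeffs n [] (λ _ _ → refl) i ⟩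
    0#  ∎
    where
    coeffs≡ : coeffs n p ≡ coeffs n []
    coeffs≡ = surjective⇒injective (finite-Vec finite-k n) finite-V (eval v) cyclic
      (trans (act-≈ (poly (coeffs n p)) p v (poly-coeffs n p p<)) (trans pv≡𝟘
        (sym (act-≈ (poly (coeffs n [])) [] v (poly-coeffs n [] (λ _ _ → refl))))))

  -- A simple module is generated by v, so v is faithful up to degree n. If f = g h with both
  -- factors of positive degree, then h v ≠ 0 because h has degree below n; simplicity yields p with
  -- p h v = v, and g v = p (g h) v = p f v = 0 contradicts faithfulness for g.
  simple⇒irreducible : ∀ {n f} → Finite V (q ^ suc n) → Monic (suc n) f → (∀ v → act f v ≡ 𝟘) →
    ∀ {v} → v ≢ 𝟘 → Simple → Irreducible f
  simple⇒irreducible {n} {f} finite-V M@(monic lead f<) f-kills {v} v≢𝟘 simple =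
    (λ f≈0 → 0≢1 (trans (sym (f≈0 (suc n))) lead)) ,
    (λ unit → ℕ.1+n≢0 (unit-deg _≟_ f unit (λ e → 0≢1 (trans (sym e) lead)) f<)) ,
    split
    where
    faithful : Faithful (suc n) v
    faithful = cyclic⇒faithful finite-V λ w → let p , e = simple v v≢𝟘 w
                                                  a , e′ = reduce-eval M (f-kills v) p in a , trans e′ e
    degrees : ∀ g h {a b} → f ≈ₚ g *ₚ h → coeff g a ≢ 0# → Deg< g (suc a) → coeff h b ≢ 0# → Deg< h (suc b) → a ℕ.+ b ≡ suc n
    degrees g h {a} {b} f≈ g≢0 g< h≢0 h< with ℕ.<-cmp (a ℕ.+ b) (suc n)
    ... | tri< a+b<n _ _ = contradiction (trans (sym (deg<-*ₚ g h g< h< (suc n) a+b<n)) (trans (sym (f≈ (suc n))) lead)) 0≢1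
    ... | tri≈ _ e _     = e
    ... | tri> _ _ n<a+b = contradiction (trans (sym (coeff-*ₚ g h g< h<)) (trans (sym (f≈ (a ℕ.+ b))) (f< (a ℕ.+ b) n<a+b))) (*-≢0 g≢0 h≢0)
    split : ∀ g h → f ≈ₚ g *ₚ h → IsUnitₚ g ⊎ IsUnitₚ h
    split g h f≈ with degree _≟_ g | degree _≟_ h
    ... | inj₁ g≈0 | _ = contradiction (trans (sym (zero-*ₚ g h (λ i _ → g≈0 i) (suc n) z≤n)) (trans (sym (f≈ (suc n))) lead)) 0≢1
    ... | inj₂ (a , g≢0 , g<) | inj₁ h≈0 = contradiction (trans (sym (*ₚ-zeroʳ g h h≈0 (suc n))) (trans (sym (f≈ (suc n))) lead)) 0≢1
    ... | inj₂ (zero  , g≢0 , g<) | inj₂ (b , h≢0 , h<) = inj₁ (constant-unit g g≢0 g<)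
    ... | inj₂ (suc a , g≢0 , g<) | inj₂ (zero , h≢0 , h<) = inj₂ (constant-unit h h≢0 h<)
    ... | inj₂ (suc a , g≢0 , g<) | inj₂ (suc b , h≢0 , h<) = ⊥-elim (g≢0 (faithful g g<n gv≡𝟘 (suc a)))
      where
      a+b : suc a ℕ.+ suc b ≡ suc n
      a+b = degrees g h f≈ g≢0 g< h≢0 h<
      g<n : Deg< g (suc n)
      g<n = deg<-mono g (ℕ.≤-trans (s≤s (s≤s (ℕ.m≤m+n a b))) (ℕ.≤-reflexive (trans (sym (ℕ.+-suc (suc a) b)) a+b))) g<
      h<n : Deg< h (suc n)
      h<n = deg<-mono h (ℕ.≤-trans (s≤s (s≤s (ℕ.m≤n+m b a))) (ℕ.≤-reflexive (trans (sym (ℕ.+-suc (suc a) b)) a+b))) h<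
      hv≢𝟘 : act h v ≢ 𝟘
      hv≢𝟘 e = h≢0 (faithful h h<n e (suc b))
      gv≡𝟘 : act g v ≡ 𝟘
      gv≡𝟘 with simple (act h v) hv≢𝟘 v
      ... | p , e = begin
        act g v  ≡⟨ cong (act g) e ⟨
        act g (act p (act h v))  ≡⟨ act-comm g p _ ⟩
        act p (act g (act h v))  ≡⟨ cong (act p) (act-*ₚ g h v) ⟨
        act p (act (g *ₚ h) v)  ≡⟨ cong (act p) (act-≈ f (g *ₚ h) v f≈) ⟨
        act p (act f v)  ≡⟨ cong (act p) (f-kills v) ⟩
        act p 𝟘  ≡⟨ act-𝟘 p ⟩
        𝟘  ∎

-- Determinants and the Cayley–Hamilton theorem

module ExteriorContraction {k : Field} (M : Module k) where
  open Field k
  open FieldProperties k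
  open Poly rawRing
  open Polynomials k
  open Module M
  open Action M
  open Det polyRawRing
  open ≡-Reasoning

  apply : ∀ {n} → Vec Pol n → (Fin n → V) → V
  apply []      v = 𝟘
  apply (p ∷ r) v = act p (v Fin.zero) ⊕ apply r (v ∘ Fin.suc)

  -- An element of the exterior algebra on n generators is given by its coefficients,
  -- indexed by the subsets of the generators: wedge r is left multiplication by the
  -- covector r (wedgeV with coefficients in V) and contract v is the interior product.

  wedge : ∀ {n} → Vec Pol n → (Vec Bool n → Pol) → Vec Bool n → Pol
  wedge []      ω []          = 0ₚ
  wedge (p ∷ r) ω (false ∷ S) = wedge r (ω ∘ (false ∷_)) S
  wedge (p ∷ r) ω (true ∷ S)  = p *ₚ ω (false ∷ S) +ₚ -ₚ wedge r (ω ∘ (true ∷_)) S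

  wedgeV : ∀ {n} → Vec Pol n → (Vec Bool n → V) → Vec Bool n → V
  wedgeV []      ω []          = 𝟘
  wedgeV (p ∷ r) ω (false ∷ S) = wedgeV r (ω ∘ (false ∷_)) S
  wedgeV (p ∷ r) ω (true ∷ S)  = act p (ω (false ∷ S)) ⊕ ⊖ wedgeV r (ω ∘ (true ∷_)) S

  contract : ∀ {n} → (Fin n → V) → (Vec Bool n → Pol) → Vec Bool n → V
  contract v ω []          = 𝟘
  contract v ω (false ∷ S) = act (ω (true ∷ S)) (v Fin.zero) ⊕ contract (v ∘ Fin.suc) (ω ∘ (false ∷_)) S
  contract v ω (true ∷ S)  = ⊖ contract (v ∘ Fin.suc) (ω ∘ (true ∷_)) S

  private
    ⊖-⊕ : ∀ x y → ⊖ (x ⊕ y) ≡ ⊖ x ⊕ ⊖ y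
    ⊖-⊕ x y = sym (⊖-⊕-comm x y)

  wedgeV-⊕ : ∀ {n} (r : Vec Pol n) α β S → wedgeV r (λ S → α S ⊕ β S) S ≡ wedgeV r α S ⊕ wedgeV r β S
  wedgeV-⊕ []      α β []          = sym (⊕-identityˡ 𝟘)
  wedgeV-⊕ (p ∷ r) α β (false ∷ S) = wedgeV-⊕ r _ _ S
  wedgeV-⊕ (p ∷ r) α β (true ∷ S)  = trans
    (cong₂ _⊕_ (act-⊕ p _ _) (trans (cong ⊖_ (wedgeV-⊕ r _ _ S)) (⊖-⊕ _ _))) (⊕-interchange _ _ _ _)

  wedgeV-⊖ : ∀ {n} (r : Vec Pol n) α S → wedgeV r (λ S → ⊖ α S) S ≡ ⊖ wedgeV r α S
  wedgeV-⊖ []      α []          = sym ⊖𝟘≡𝟘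
  wedgeV-⊖ (p ∷ r) α (false ∷ S) = wedgeV-⊖ r _ S
  wedgeV-⊖ (p ∷ r) α (true ∷ S)  = trans (cong₂ _⊕_ (act-⊖ p _) (cong ⊖_ (wedgeV-⊖ r _ S))) (sym (⊖-⊕ _ _))

  wedgeV-𝟘 : ∀ {n} (r : Vec Pol n) {α} S → (∀ S → α S ≡ 𝟘) → wedgeV r α S ≡ 𝟘
  wedgeV-𝟘 []      []          h = refl
  wedgeV-𝟘 (p ∷ r) (false ∷ S) h = wedgeV-𝟘 r S (h ∘ (false ∷_))
  wedgeV-𝟘 (p ∷ r) (true ∷ S)  h = trans
    (cong₂ _⊕_ (trans (cong (act p) (h _)) (act-𝟘 p)) (trans (cong ⊖_ (wedgeV-𝟘 r S (h ∘ (true ∷_)))) ⊖𝟘≡𝟘)) (⊕-identityˡ 𝟘)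

  wedgeV-act : ∀ {n} (r : Vec Pol n) ω v S → wedgeV r (λ S → act (ω S) v) S ≡ act (wedge r ω S) v
  wedgeV-act []      ω v []          = refl
  wedgeV-act (p ∷ r) ω v (false ∷ S) = wedgeV-act r _ v S
  wedgeV-act (p ∷ r) ω v (true ∷ S)  = trans
    (cong₂ _⊕_ (sym (act-*ₚ p _ v)) (cong ⊖_ (wedgeV-act r _ v S)))
    (sym (act-difference (p *ₚ ω (false ∷ S)) (wedge r (ω ∘ (true ∷_)) S) v))

  contract-linear : ∀ {n} (v : Fin n → V) p α β S →
    contract v (λ S → p *ₚ α S +ₚ -ₚ β S) S ≡ act p (contract v α S) ⊕ ⊖ contract v β S
  contract-linear v p α β []          = sym (trans (cong₂ _⊕_ (act-𝟘 p) ⊖𝟘≡𝟘) (⊕-identityˡ 𝟘))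
  contract-linear v p α β (false ∷ S) = begin
    act (p *ₚ a +ₚ -ₚ b) v₀ ⊕ contract v′ _ S
      ≡⟨ cong₂ _⊕_ (act-difference (p *ₚ a) b v₀) (contract-linear v′ p _ _ S) ⟩
    (act (p *ₚ a) v₀ ⊕ ⊖ act b v₀) ⊕ (act p (contract v′ _ S) ⊕ ⊖ contract v′ _ S)
      ≡⟨ ⊕-interchange _ _ _ _ ⟩
    (act (p *ₚ a) v₀ ⊕ act p (contract v′ _ S)) ⊕ (⊖ act b v₀ ⊕ ⊖ contract v′ _ S)
      ≡⟨ cong₂ _⊕_ (trans (cong₂ _⊕_ (act-*ₚ p a v₀) refl) (sym (act-⊕ p _ _))) (sym (⊖-⊕ _ _)) ⟩
    act p (act a v₀ ⊕ contract v′ _ S) ⊕ ⊖ (act b v₀ ⊕ contract v′ _ S)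
      ∎
    where
    v₀ = v Fin.zero
    v′ = v ∘ Fin.suc
    a = α (true ∷ S)
    b = β (true ∷ S)
  contract-linear v p α β (true ∷ S) = trans (cong ⊖_ (contract-linear (v ∘ Fin.suc) p _ _ S))
    (trans (⊖-⊕ _ _) (cong (_⊕ _) (sym (act-⊖ p _))))

  -- The antiderivation rule for the interior product: i_v(r ∧ ω) = r(v) ω - r ∧ i_v(ω).
  contract-wedge : ∀ {n} (v : Fin n → V) (r : Vec Pol n) ω S →
    contract v (wedge r ω) S ≡ act (ω S) (apply r v) ⊕ ⊖ wedgeV r (contract v ω) S
  contract-wedge v []      ω []          = sym (trans (cong₂ _⊕_ (act-𝟘 (ω [])) ⊖𝟘≡𝟘) (⊕-identityˡ 𝟘))
  contract-wedge v (p ∷ r) ω (false ∷ S) = begin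
    act (p *ₚ f +ₚ -ₚ wedge r ω₁ S) v₀ ⊕ contract v′ (wedge r ω₀) S
      ≡⟨ cong₂ _⊕_ (trans (act-difference (p *ₚ f) (wedge r ω₁ S) v₀)
                     (cong₂ (λ x y → x ⊕ ⊖ y) (trans (act-*ₚ p f v₀) (act-comm p f v₀)) (sym (wedgeV-act r ω₁ v₀ S))))
                   (contract-wedge v′ r ω₀ S) ⟩
    (act f (act p v₀) ⊕ ⊖ wedgeV r (λ S → act (ω₁ S) v₀) S) ⊕ (act f (apply r v′) ⊕ ⊖ wedgeV r (contract v′ ω₀) S)
      ≡⟨ ⊕-interchange _ _ _ _ ⟩
    (act f (act p v₀) ⊕ act f (apply r v′)) ⊕ (⊖ wedgeV r (λ S → act (ω₁ S) v₀) S ⊕ ⊖ wedgeV r (contract v′ ω₀) S)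
      ≡⟨ cong₂ _⊕_ (sym (act-⊕ f _ _)) (trans (sym (⊖-⊕ _ _)) (cong ⊖_ (sym (wedgeV-⊕ r _ _ S)))) ⟩
    act f (act p v₀ ⊕ apply r v′) ⊕ ⊖ wedgeV r (λ S → act (ω₁ S) v₀ ⊕ contract v′ ω₀ S) S
      ∎
    where
    v₀ = v Fin.zero
    v′ = v ∘ Fin.suc
    ω₀ = ω ∘ (false ∷_)
    ω₁ = ω ∘ (true ∷_)
    f = ω (false ∷ S)
  contract-wedge v (p ∷ r) ω (true ∷ S) = begin
    ⊖ contract v′ (λ S → p *ₚ ω₀ S +ₚ -ₚ wedge r ω₁ S) S
      ≡⟨ cong ⊖_ (contract-linear v′ p ω₀ (wedge r ω₁) S) ⟩
    ⊖ (x ⊕ ⊖ contract v′ (wedge r ω₁) S)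
      ≡⟨ ⊖-⊕ _ _ ⟩
    ⊖ x ⊕ ⊖ ⊖ contract v′ (wedge r ω₁) S
      ≡⟨ cong (⊖ x ⊕_) (trans (⊖-involutive _) (contract-wedge v′ r ω₁ S)) ⟩
    ⊖ x ⊕ (y ⊕ ⊖ z)
      ≡⟨ trans (sym (⊕-assoc _ _ _)) (cong (_⊕ ⊖ z) (⊕-comm _ _)) ⟩
    y ⊕ ⊖ x ⊕ ⊖ z
      -- The term u = ω(true ∷ S) p v₀ occurs both in r(v) ω and in r ∧ i_v(ω), so u - u is
      -- inserted.
      ≡⟨ cong (_⊕ ⊖ z) (trans (sym (⊕-identityˡ _)) (trans (cong (_⊕ (y ⊕ ⊖ x)) (sym (⊖-inverseʳ u))) (⊕-interchange _ _ _ _))) ⟩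
    (u ⊕ y) ⊕ (⊖ u ⊕ ⊖ x) ⊕ ⊖ z
      ≡⟨ ⊕-assoc _ _ _ ⟩
    (u ⊕ y) ⊕ ((⊖ u ⊕ ⊖ x) ⊕ ⊖ z)
      ≡⟨ cong₂ _⊕_ (sym (act-⊕ t _ _)) (trans (cong₂ _⊕_ (sym (⊖-⊕ u x)) refl) (sym (⊖-⊕ _ _))) ⟩
    act t (act p v₀ ⊕ apply r v′) ⊕ ⊖ ((u ⊕ x) ⊕ z)
      ≡⟨ cong (λ w → act t (act p v₀ ⊕ apply r v′) ⊕ ⊖ w) (cong₂ _⊕_
           (trans (cong (_⊕ x) (act-comm t p v₀)) (sym (act-⊕ p _ _)))
           (sym (trans (cong ⊖_ (wedgeV-⊖ r _ S)) (⊖-involutive z)))) ⟩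
    act t (act p v₀ ⊕ apply r v′) ⊕ ⊖ (act p (act t v₀ ⊕ contract v′ ω₀ S) ⊕ ⊖ wedgeV r (λ S → ⊖ contract v′ ω₁ S) S)
      ∎
    where
    v₀ = v Fin.zero
    v′ = v ∘ Fin.suc
    ω₀ = ω ∘ (false ∷_)
    ω₁ = ω ∘ (true ∷_)
    t = ω (true ∷ S)
    u = act t (act p v₀)
    x = act p (contract v′ ω₀ S)
    y = act t (apply r v′)
    z = wedgeV r (contract v′ ω₁) S

  one : ∀ {n} → Vec Bool n → Pol
  one []          = 1ₚ
  one (false ∷ S) = one S
  one (true ∷ S)  = 0ₚ

  wedges : ∀ {n m} → Vec (Vec Pol n) m → Vec Bool n → Pol
  wedges []         = one
  wedges (r ∷ rows) = wedge r (wedges rows)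

  contract-0ₚ : ∀ {n} (v : Fin n → V) S → contract v (λ _ → 0ₚ) S ≡ 𝟘
  contract-0ₚ v []          = refl
  contract-0ₚ v (false ∷ S) = trans (⊕-identityˡ _) (contract-0ₚ _ S)
  contract-0ₚ v (true ∷ S)  = trans (cong ⊖_ (contract-0ₚ _ S)) ⊖𝟘≡𝟘

  contract-one : ∀ {n} (v : Fin n → V) S → contract v one S ≡ 𝟘
  contract-one v []          = refl
  contract-one v (false ∷ S) = trans (⊕-identityˡ _) (contract-one _ S)
  contract-one v (true ∷ S)  = trans (cong ⊖_ (contract-0ₚ _ S)) ⊖𝟘≡𝟘

  contract-wedges : ∀ {n m} (v : Fin n → V) (rows : Vec (Vec Pol n) m) → (∀ i → apply (lookup rows i) v ≡ 𝟘) →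
    ∀ S → contract v (wedges rows) S ≡ 𝟘
  contract-wedges v []         h S = contract-one v S
  contract-wedges v (r ∷ rows) h S = begin
    contract v (wedge r (wedges rows)) S
      ≡⟨ contract-wedge v r _ S ⟩
    act (wedges rows S) (apply r v) ⊕ ⊖ wedgeV r (contract v (wedges rows)) S
      ≡⟨ cong₂ _⊕_ (trans (cong (act (wedges rows S)) (h Fin.zero)) (act-𝟘 (wedges rows S)))
                   (trans (cong ⊖_ (wedgeV-𝟘 r S (contract-wedges v rows (h ∘ Fin.suc)))) ⊖𝟘≡𝟘) ⟩
    𝟘 ⊕ 𝟘
      ≡⟨ ⊕-identityˡ 𝟘 ⟩
    𝟘 ∎

  full : ∀ n → Vec Bool n
  full n = Vec.replicate n true

  omit : ∀ {n} → Fin (suc n) → Vec Bool n → Vec Bool (suc n)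
  omit j S = Vec.insertAt S j false

  contract-full : ∀ {n} (v : Fin n → V) ω → contract v ω (full n) ≡ 𝟘
  contract-full {zero}  v ω = refl
  contract-full {suc n} v ω = trans (cong ⊖_ (contract-full (v ∘ Fin.suc) (ω ∘ (true ∷_)))) ⊖𝟘≡𝟘

  -- The contraction at S is a signed sum over the generators j outside S of ω(S ∪ {j}) applied to v
  -- j. The complement of {j} leaves a single term, so its vanishing is the desired relation up to
  -- sign.
  contract-omit : ∀ {n} (v : Fin (suc n) → V) ω j → contract v ω (omit j (full n)) ≡ 𝟘 → act (ω (full (suc n))) (v j) ≡ 𝟘
  contract-omit {n}     v ω Fin.zero    h =
    trans (sym (trans (cong (act (ω (full (suc n))) (v Fin.zero) ⊕_) (contract-full (v ∘ Fin.suc) (ω ∘ (false ∷_)))) (⊕-identityʳ _))) h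
  contract-omit {suc n} v ω (Fin.suc j) h = contract-omit (v ∘ Fin.suc) (ω ∘ (true ∷_)) j
    (trans (sym (⊖-involutive _)) (trans (cong ⊖_ h) ⊖𝟘≡𝟘))

  wedge-cong : ∀ {n} (r : Vec Pol n) {α β} → (∀ S → α S ≡ β S) → ∀ S → wedge r α S ≡ wedge r β S
  wedge-cong []      h []          = refl
  wedge-cong (p ∷ r) h (false ∷ S) = wedge-cong r (h ∘ (false ∷_)) S
  wedge-cong (p ∷ r) h (true ∷ S)  = cong₂ (λ x y → p *ₚ x +ₚ -ₚ y) (h _) (wedge-cong r (h ∘ (true ∷_)) S)

  wedge-omit : ∀ {n} (r : Vec Pol (suc n)) ω j S → wedge r ω (omit j S) ≡ wedge (removeAt r j) (ω ∘ omit j) S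
  wedge-omit (p ∷ r)     ω Fin.zero    S           = refl
  wedge-omit (p ∷ q ∷ r) ω (Fin.suc j) (false ∷ S) = wedge-omit (q ∷ r) _ j S
  wedge-omit (p ∷ q ∷ r) ω (Fin.suc j) (true ∷ S)  = cong (λ y → p *ₚ _ +ₚ -ₚ y) (wedge-omit (q ∷ r) _ j S)

  one-omit : ∀ {n} (j : Fin (suc n)) S → one (omit j S) ≡ one S
  one-omit Fin.zero    S           = refl
  one-omit (Fin.suc j) (false ∷ S) = one-omit j S
  one-omit (Fin.suc j) (true ∷ S)  = refl

  -- Coefficients at subsets that avoid generator j do not see column j: they are the coefficients
  -- for the minors on which the Laplace expansion in `det` recurses.
  wedges-omit : ∀ {n m} (rows : Vec (Vec Pol (suc n)) m) j S →
    wedges rows (omit j S) ≡ wedges (Vec.map (λ r → removeAt r j) rows) S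
  wedges-omit []         j S = one-omit j S
  wedges-omit (r ∷ rows) j S = trans (wedge-omit r _ j S) (wedge-cong (removeAt r j) (wedges-omit rows j) S)

  sgn-cong : ∀ {n} (j : Fin n) p q → p ≈ₚ q → sgn j p ≈ₚ sgn j q
  sgn-cong Fin.zero    p q h = h
  sgn-cong (Fin.suc j) p q h = -ₚ-cong (sgn j p) (sgn j q) (sgn-cong j p q h)

  sumV-cong : ∀ {n} (f g : Fin n → Pol) → (∀ j → f j ≈ₚ g j) → sumV (tabulate f) ≈ₚ sumV (tabulate g)
  sumV-cong {zero}  f g h i = refl
  sumV-cong {suc n} f g h   = +ₚ-cong (f Fin.zero) (g Fin.zero) (sumV (tabulate (f ∘ Fin.suc))) (sumV (tabulate (g ∘ Fin.suc)))
    (h Fin.zero) (sumV-cong (f ∘ Fin.suc) (g ∘ Fin.suc) (h ∘ Fin.suc))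

  -ₚ-sumV : ∀ {n} (f : Fin n → Pol) → -ₚ sumV (tabulate f) ≈ₚ sumV (tabulate (-ₚ_ ∘ f))
  -ₚ-sumV {zero}  f i = refl
  -ₚ-sumV {suc n} f i = begin
    coeff (-ₚ (f₀ +ₚ s)) i  ≡⟨ coeff-neg (f₀ +ₚ s) i ⟩
    - coeff (f₀ +ₚ s) i  ≡⟨ cong -_ (coeff-+ f₀ s i) ⟩
    - (coeff f₀ i + coeff s i)  ≡⟨ -‿+-comm _ _ ⟨
    - coeff f₀ i + - coeff s i  ≡⟨ cong₂ _+_ (coeff-neg f₀ i) (coeff-neg s i) ⟨
    coeff (-ₚ f₀) i + coeff (-ₚ s) i  ≡⟨ cong (coeff (-ₚ f₀) i +_) (-ₚ-sumV (f ∘ Fin.suc) i) ⟩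
    coeff (-ₚ f₀) i + coeff s′ i  ≡⟨ coeff-+ (-ₚ f₀) s′ i ⟨
    coeff (-ₚ f₀ +ₚ s′) i  ∎
    where
    f₀ = f Fin.zero
    s  = sumV (tabulate (f ∘ Fin.suc))
    s′ = sumV (tabulate (-ₚ_ ∘ f ∘ Fin.suc))

  -- This is the Laplace expansion along r: moving past each generator of the full set changes the
  -- sign once, just as `sgn` does.
  wedge-full : ∀ {n} (r : Vec Pol (suc n)) ω →
    wedge r ω (full (suc n)) ≈ₚ sumV (tabulate λ j → sgn j (lookup r j *ₚ ω (omit j (full n))))
  wedge-full {zero}  (p ∷ []) ω i = refl
  wedge-full {suc n} (p ∷ r)  ω = +ₚ-cong a a (-ₚ wedge r ω₁ (full (suc n))) (sumV (tabulate (-ₚ_ ∘ s))) (λ _ → refl)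
    λ i → trans (-ₚ-cong (wedge r ω₁ (full (suc n))) (sumV (tabulate s)) (wedge-full r ω₁) i) (-ₚ-sumV s i)
    where
    a = p *ₚ ω (false ∷ full (suc n))
    ω₁ = ω ∘ (true ∷_)
    s : Fin (suc n) → Pol
    s j = sgn j (lookup r j *ₚ ω₁ (omit j (full n)))

  det≈wedges : ∀ {n} (A : Matrix Pol n) → det A ≈ₚ wedges A (full n)
  det≈wedges {zero}  []         i = refl
  det≈wedges {suc n} (r ∷ rows) i = trans (sumV-cong (λ j → sgn j (x j)) (λ j → sgn j (y j)) (λ j → sgn-cong j (x j) (y j) (x≈y j)) i)
    (sym (wedge-full r (wedges rows) i))
    where
    minor : Fin (suc n) → Matrix Pol n
    minor j = Vec.map (λ r → removeAt r j) rows
    x y : Fin (suc n) → Pol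
    x j = lookup r j *ₚ det (minor j)
    y j = lookup r j *ₚ wedges rows (omit j (full n))
    x≈y : ∀ j → x j ≈ₚ y j
    x≈y j = *ₚ-congˡ (lookup r j) (det (minor j)) (wedges rows (omit j (full n))) λ i →
      trans (det≈wedges (minor j) i) (cong (λ p → coeff p i) (sym (wedges-omit rows j (full n))))

  -- Contraction with v is an antiderivation that annihilates each row of A, hence also the wedge
  -- product of the rows, whose top coefficient is the determinant. Reading this off at the
  -- complement of {j} gives the claim; the argument takes the place of multiplying by the adjugate.
  det-kills : ∀ {n} (A : Matrix Pol n) (v : Fin n → V) → (∀ i → apply (lookup A i) v ≡ 𝟘) → ∀ j → act (det A) (v j) ≡ 𝟘
  det-kills {suc n} A v h j = trans (act-≈ (det A) (wedges A (full (suc n))) (v j) (det≈wedges A))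
    (contract-omit v (wedges A) j (contract-wedges v A h (omit j (full n))))

-- Degree and leading coefficient of a determinant

module DeterminantDegree (k : Field) where
  open Field k
  open FieldProperties k
  open Poly rawRing
  open Polynomials k
  private
    module D  = Det rawRing
    module DP = Det polyRawRing
  open import Algebra.Properties.CommutativeMonoid.Sum +-commutativeMonoid using (sum; sum-cong-≗; sum-replicate-zero)
  open ≡-Reasoning

  removeAt-All : ∀ {A : Set} {P : A → Set} {n} {xs : Vec A (suc n)} → VecAll.All P xs → ∀ j → VecAll.All P (removeAt xs j)
  removeAt-All (_ ∷ ps)        Fin.zero    = ps
  removeAt-All (p ∷ ps@(_ ∷ _)) (Fin.suc j) = p ∷ removeAt-All ps j

  map-removeAt : ∀ {A B : Set} (f : A → B) {n} (xs : Vec A (suc n)) j → Vec.map f (removeAt xs j) ≡ removeAt (Vec.map f xs) j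
  map-removeAt f (x ∷ xs)         Fin.zero    = refl
  map-removeAt f (x ∷ xs@(_ ∷ _)) (Fin.suc j) = cong (f x ∷_) (map-removeAt f xs j)

  sumV-tabulate : ∀ {n} (f : Fin n → Carrier) → D.sumV (tabulate f) ≡ sum f
  sumV-tabulate {zero}  f = refl
  sumV-tabulate {suc n} f = cong (f Fin.zero +_) (sumV-tabulate (f ∘ Fin.suc))

  coeff-sumV : ∀ {n} (f : Fin n → Pol) i → coeff (DP.sumV (tabulate f)) i ≡ sum (λ j → coeff (f j) i)
  coeff-sumV {zero}  f i = refl
  coeff-sumV {suc n} f i = trans (coeff-+ (f Fin.zero) _ i) (cong (coeff (f Fin.zero) i +_) (coeff-sumV (f ∘ Fin.suc) i))

  coeff-sgn : ∀ {n} (j : Fin n) p i → coeff (DP.sgn j p) i ≡ D.sgn j (coeff p i)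
  coeff-sgn Fin.zero    p i = refl
  coeff-sgn (Fin.suc j) p i = trans (coeff-neg (DP.sgn j p) i) (cong -_ (coeff-sgn j p i))

  sgn-0 : ∀ {n} (j : Fin n) → D.sgn j 0# ≡ 0#
  sgn-0 Fin.zero    = refl
  sgn-0 (Fin.suc j) = trans (cong -_ (sgn-0 j)) -0#≈0#

  leading : ∀ {m n} → Vec (Vec Pol n) m → Vec (Vec Carrier n) m
  leading = Vec.map (Vec.map (λ p → coeff p 1))

  AffineEntries : ∀ {m n} → Vec (Vec Pol n) m → Set
  AffineEntries = VecAll.All (VecAll.All (λ p → Deg< p 2))

  det-deg< : ∀ {n} (A : Matrix Pol n) → AffineEntries A → Deg< (DP.det A) (suc n)
  -- With entries of degree at most 1, each term of the Laplace expansion has its coefficient of X^n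
  -- given by the product of the coefficients of X. For XI - A the result is the determinant of I.
  det-leading : ∀ {n} (A : Matrix Pol n) → AffineEntries A → coeff (DP.det A) n ≡ D.det (leading A)

  private
    minor : ∀ {n} → Vec (Vec Pol (suc n)) n → Fin (suc n) → Matrix Pol n
    minor rows j = Vec.map (λ r → removeAt r j) rows

    minor-affine : ∀ {n} {rows : Vec (Vec Pol (suc n)) n} → AffineEntries rows → ∀ j → AffineEntries (minor rows j)
    minor-affine h j = VecAll.map⁺ (VecAll.map (λ r → removeAt-All r j) h)

    lookup-affine : ∀ {n} {r : Vec Pol n} → VecAll.All (λ p → Deg< p 2) r → ∀ j → Deg< (lookup r j) 2
    lookup-affine h j = VecAll.lookup⁺ h j

  det-deg< []         h (suc i) _ = refl
  det-deg< {suc n} (r ∷ rows) (hr ∷ hs) i n<i = trans (coeff-sumV term i)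
    (trans (sum-cong-≗ (λ j → trans (coeff-sgn j (lookup r j *ₚ DP.det (minor rows j)) i) (trans (cong (D.sgn j) (term< j)) (sgn-0 j)))) (sum-replicate-zero (suc n)))
    where
    term : Fin (suc n) → Pol
    term j = DP.sgn j (lookup r j *ₚ DP.det (minor rows j))
    term< : ∀ j → coeff (lookup r j *ₚ DP.det (minor rows j)) i ≡ 0#
    term< j = deg<-*ₚ (lookup r j) (DP.det (minor rows j)) (lookup-affine hr j) (det-deg< (minor rows j) (minor-affine hs j)) i n<i

  det-leading []         h = refl
  det-leading {suc n} (r ∷ rows) (hr ∷ hs) = begin
    coeff (DP.sumV (tabulate term)) (suc n)  ≡⟨ coeff-sumV term (suc n) ⟩
    sum (λ j → coeff (term j) (suc n))  ≡⟨ sum-cong-≗ (λ j → trans (coeff-sgn j (lookup r j *ₚ DP.det (minor rows j)) (suc n)) (cong (D.sgn j) (term≡ j))) ⟩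
    sum term′  ≡⟨ sumV-tabulate term′ ⟨
    D.sumV (tabulate term′)  ∎
    where
    term : Fin (suc n) → Pol
    term j = DP.sgn j (lookup r j *ₚ DP.det (minor rows j))
    term′ : Fin (suc n) → Carrier
    term′ j = D.sgn j (lookup (Vec.map (λ p → coeff p 1) r) j * D.det (Vec.map (λ r → removeAt r j) (leading rows)))
    minor-leading : ∀ {m} (rows : Vec (Vec Pol (suc n)) m) j →
      leading (Vec.map (λ r → removeAt r j) rows) ≡ Vec.map (λ r → removeAt r j) (leading rows)
    minor-leading []         j = refl
    minor-leading (r ∷ rows) j = cong₂ _∷_ (map-removeAt _ r j) (minor-leading rows j)
    term≡ : ∀ j → coeff (lookup r j *ₚ DP.det (minor rows j)) (suc n) ≡
                  lookup (Vec.map (λ p → coeff p 1) r) j * D.det (Vec.map (λ r → removeAt r j) (leading rows))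
    term≡ j = trans
      (coeff-*ₚ (lookup r j) (DP.det (minor rows j)) (lookup-affine hr j) (det-deg< (minor rows j) (minor-affine hs j)))
      (cong₂ _*_ (sym (Vec.lookup-map j _ r))
        (trans (det-leading (minor rows j) (minor-affine hs j)) (cong D.det (minor-leading rows j))))

  δ-suc : ∀ {n} (i j : Fin n) → D.δ (Fin.suc i) (Fin.suc j) ≡ D.δ i j
  δ-suc i j with i Fin.≟ j
  ... | yes _ = refl
  ... | no _  = refl

  det-identity : ∀ n → D.det (D.identity {n}) ≡ 1#
  det-identity zero    = refl
  det-identity (suc n) = begin
    1# * D.det (Vec.map (λ r → removeAt r Fin.zero) below) + D.sumV (tabulate rest)
      ≡⟨ cong₂ _+_ (trans (*-identityˡ _) (trans (cong D.det minor₀) (det-identity n)))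
           (trans (sumV-tabulate rest) (trans (sum-cong-≗ rest≡0) (sum-replicate-zero n))) ⟩
    1# + 0#
      ≡⟨ +-identityʳ 1# ⟩
    1# ∎
    where
    below : Vec (Vec Carrier (suc n)) n
    below = tabulate λ i → tabulate λ j → D.δ (Fin.suc i) j
    minor₀ : Vec.map (λ r → removeAt r Fin.zero) below ≡ D.identity {n}
    minor₀ = trans (sym (Vec.tabulate-∘ (λ r → removeAt r Fin.zero) (λ i → tabulate λ j → D.δ (Fin.suc i) j)))
      (Vec.tabulate-cong λ i → Vec.tabulate-cong λ j → δ-suc i j)
    rest : Fin n → Carrier
    rest j = - D.sgn j (lookup (tabulate λ j → 0#) j * D.det (Vec.map (λ r → removeAt r (Fin.suc j)) below))
    rest≡0 : ∀ j → rest j ≡ 0#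
    rest≡0 j = trans (cong -_ (trans (cong (D.sgn j) (trans (cong₂ _*_ (Vec.lookup∘tabulate (λ _ → 0#) j) refl) (zeroˡ _))) (sgn-0 j))) -0#≈0#

  private module OF = OverField k

  charPoly-monic : ∀ {n} (A : Matrix Carrier n) → Monic n (OF.charPoly A)
  charPoly-monic {n} A = monic
    (trans (det-leading B B-affine) (trans (cong D.det B-leading) (det-identity n)))
    (det-deg< B B-affine)
    where
    b : Fin n → Fin n → Pol
    b i j = (if ⌊ i Fin.≟ j ⌋ then Xₚ else 0ₚ) +ₚ (-ₚ (entry A i j ∷ []))
    B : Matrix Pol n
    B = tabulate λ i → tabulate λ j → b i j
    b-affine : ∀ i j → Deg< (b i j) 2
    b-affine i j (suc (suc l)) _ with ⌊ i Fin.≟ j ⌋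
    ... | true  = refl
    ... | false = refl
    b-affine i j (suc zero) (s≤s ())
    B-affine : AffineEntries B
    B-affine = VecAll.tabulate⁺ λ i → VecAll.tabulate⁺ λ j → b-affine i j
    b-leading : ∀ i j → coeff (b i j) 1 ≡ D.δ i j
    b-leading i j with ⌊ i Fin.≟ j ⌋
    ... | true  = refl
    ... | false = refl
    B-leading : leading B ≡ D.identity
    B-leading = trans (sym (Vec.tabulate-∘ _ _)) (Vec.tabulate-cong λ i → trans (sym (Vec.tabulate-∘ _ _)) (Vec.tabulate-cong (b-leading i)))

-- Spaces of vectors, row vectors and matrices

module VectorModule {k : Field} (M : Module k) where
  open Field k using (Carrier)
  open Module M

  infixl 6 _⊞_
  _⊞_ : ∀ {n} → Vec V n → Vec V n → Vec V n
  _⊞_ = Vec.zipWith _⊕_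

  infixr 7 _▪_
  _▪_ : ∀ {n} → Carrier → Vec V n → Vec V n
  a ▪ v = Vec.map (a •_) v

  ⊞-isAbelianGroup : ∀ n → IsAbelianGroup {A = Vec V n} _≡_ _⊞_ (Vec.replicate n 𝟘) (Vec.map ⊖_)
  ⊞-isAbelianGroup n = record
    { isGroup = record
      { isMonoid = record
        { isSemigroup = record
          { isMagma = record { isEquivalence = isEquivalence ; ∙-cong = cong₂ _⊞_ }
          ; assoc   = Vec.zipWith-assoc ⊕-assoc }
        ; identity = Vec.zipWith-identityˡ ⊕-identityˡ , Vec.zipWith-identityʳ ⊕-identityʳ }
      ; inverse = Vec.zipWith-inverseˡ ⊖-inverseˡ , Vec.zipWith-inverseʳ ⊖-inverseʳ
      ; ⁻¹-cong = cong (Vec.map ⊖_) }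
    ; comm = Vec.zipWith-comm ⊕-comm }

  -- The operator S is a parameter, so that the same space carries a matrix action on row vectors,
  -- or the shift of a recurrence.
  vectors : ∀ n (S : Vec V n → Vec V n) → (∀ v w → S (v ⊞ w) ≡ S v ⊞ S w) → (∀ a v → S (a ▪ v) ≡ a ▪ S v) → Module k
  vectors n S S-⊞ S-▪ = record
    { V = Vec V n ; _⊕_ = _⊞_ ; ⊖_ = Vec.map ⊖_ ; 𝟘 = Vec.replicate n 𝟘
    ; isAbelianGroup = ⊞-isAbelianGroup n
    ; _•_ = _▪_
    ; •-distribˡ = distribˡ
    ; •-distribʳ = distribʳ
    ; •-assoc    = assoc
    ; •-identity = identity
    ; T = S ; T-⊕ = S-⊞ ; T-• = S-▪ }
    where
    module k = Field k
    distribˡ : ∀ {n} a (v w : Vec V n) → a ▪ (v ⊞ w) ≡ a ▪ v ⊞ a ▪ w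
    distribˡ a []      []      = refl
    distribˡ a (x ∷ v) (y ∷ w) = cong₂ _∷_ (•-distribˡ a x y) (distribˡ a v w)
    distribʳ : ∀ {n} a b (v : Vec V n) → (a k.+ b) ▪ v ≡ a ▪ v ⊞ b ▪ v
    distribʳ a b []      = refl
    distribʳ a b (x ∷ v) = cong₂ _∷_ (•-distribʳ a b x) (distribʳ a b v)
    assoc : ∀ {n} a b (v : Vec V n) → (a k.* b) ▪ v ≡ a ▪ b ▪ v
    assoc a b []      = refl
    assoc a b (x ∷ v) = cong₂ _∷_ (•-assoc a b x) (assoc a b v)
    identity : ∀ {n} (v : Vec V n) → k.1# ▪ v ≡ v
    identity []      = refl
    identity (x ∷ v) = cong₂ _∷_ (•-identity x) (identity v)

lookup-ext : ∀ {A : Set} {n} {v w : Vec A n} → (∀ i → lookup v i ≡ lookup w i) → v ≡ w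
lookup-ext {v = v} {w} h = trans (sym (Vec.tabulate∘lookup v)) (trans (Vec.tabulate-cong h) (Vec.tabulate∘lookup w))

-- The field as a module over k[X] with X acting as t, so that `act p 1#` is the value p(t).
scalars : (k : Field) → Field.Carrier k → Module k
scalars k t = record
  { V = Carrier ; _⊕_ = _+_ ; ⊖_ = -_ ; 𝟘 = 0#
  ; isAbelianGroup = AbelianGroup.isAbelianGroup +-abelianGroup
  ; _•_ = _*_
  ; •-distribˡ = distribˡ
  ; •-distribʳ = λ a b v → distribʳ v a b
  ; •-assoc    = *-assoc
  ; •-identity = *-identityˡ
  ; T   = t *_
  ; T-⊕ = distribˡ t
  ; T-• = λ a v → trans (sym (*-assoc t a v)) (trans (cong (_* v) (*-comm t a)) (*-assoc a t v))
  }
  where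
  open Field k
  open FieldProperties k

module RowVectors (k : Field) where
  open Field k
  open FieldProperties k
  open Poly rawRing
  open Polynomials k
  open Det rawRing using (δ; identity; _⊗_)
  open DeterminantDegree k using (δ-suc; sumV-tabulate)
  open VectorModule (scalars k 0#) public
  open import Algebra.Properties.Semiring.Sum semiring
    using (sum; sum-cong-≗; ∑-distrib-+; sum-replicate-zero; *-distribˡ-sum)
  open ≡-Reasoning

  infixl 7 _⋄_
  _⋄_ : ∀ {n} → Vec Carrier n → Matrix Carrier n → Vec Carrier n
  w ⋄ A = tabulate λ j → sum (λ i → lookup w i * entry A i j)

  lookup-⋄ : ∀ {n} (w : Vec Carrier n) A j → lookup (w ⋄ A) j ≡ sum (λ i → lookup w i * entry A i j)
  lookup-⋄ w A j = Vec.lookup∘tabulate _ j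

  ⋄-⊞ : ∀ {n} (A : Matrix Carrier n) v w → (v ⊞ w) ⋄ A ≡ v ⋄ A ⊞ w ⋄ A
  ⋄-⊞ A v w = lookup-ext λ j → begin
    lookup ((v ⊞ w) ⋄ A) j
      ≡⟨ Vec.lookup∘tabulate _ j ⟩
    sum (λ i → lookup (v ⊞ w) i * entry A i j)
      ≡⟨ sum-cong-≗ (λ i → trans (cong (_* entry A i j) (Vec.lookup-zipWith _+_ i v w)) (distribʳ _ _ _)) ⟩
    sum (λ i → lookup v i * entry A i j + lookup w i * entry A i j)
      ≡⟨ ∑-distrib-+ (λ i → lookup v i * entry A i j) _ ⟩
    sum (λ i → lookup v i * entry A i j) + sum (λ i → lookup w i * entry A i j)
      ≡⟨ cong₂ _+_ (Vec.lookup∘tabulate _ j) (Vec.lookup∘tabulate _ j) ⟨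
    lookup (v ⋄ A) j + lookup (w ⋄ A) j
      ≡⟨ Vec.lookup-zipWith _+_ j (v ⋄ A) (w ⋄ A) ⟨
    lookup (v ⋄ A ⊞ w ⋄ A) j
      ∎

  ⋄-▪ : ∀ {n} (A : Matrix Carrier n) a w → (a ▪ w) ⋄ A ≡ a ▪ (w ⋄ A)
  ⋄-▪ A a w = lookup-ext λ j → begin
    lookup ((a ▪ w) ⋄ A) j
      ≡⟨ Vec.lookup∘tabulate _ j ⟩
    sum (λ i → lookup (a ▪ w) i * entry A i j)
      ≡⟨ sum-cong-≗ (λ i → trans (cong (_* entry A i j) (Vec.lookup-map i (a *_) w)) (*-assoc _ _ _)) ⟩
    sum (λ i → a * (lookup w i * entry A i j))
      ≡⟨ *-distribˡ-sum a (λ i → lookup w i * entry A i j) ⟨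
    a * sum (λ i → lookup w i * entry A i j)
      ≡⟨ cong (a *_) (Vec.lookup∘tabulate _ j) ⟨
    a * lookup (w ⋄ A) j
      ≡⟨ Vec.lookup-map j (a *_) (w ⋄ A) ⟨
    lookup (a ▪ (w ⋄ A)) j
      ∎

  rows : ∀ {n} → Matrix Carrier n → Module k
  rows {n} A = vectors n (_⋄ A) (⋄-⊞ A) (⋄-▪ A)

  space : ℕ → Module k
  space n = vectors n id (λ _ _ → refl) (λ _ _ → refl)

  basis : ∀ {n} → Fin n → Vec Carrier n
  basis i = tabulate (δ i)

  sum-δˡ : ∀ {n} (f : Fin n → Carrier) j → sum (λ i → f i * δ i j) ≡ f j
  sum-δˡ {suc n} f Fin.zero    = trans (cong₂ _+_ (*-identityʳ _)
    (trans (sum-cong-≗ {n} (λ i → zeroʳ _)) (sum-replicate-zero n))) (+-identityʳ _)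
  sum-δˡ {suc n} f (Fin.suc j) = trans (cong₂ _+_ (zeroʳ _)
    (trans (sum-cong-≗ (λ i → cong (f (Fin.suc i) *_) (δ-suc i j))) (sum-δˡ (f ∘ Fin.suc) j))) (+-identityˡ _)

  sum-δʳ : ∀ {n} (f : Fin n → Carrier) i → sum (λ j → δ i j * f j) ≡ f i
  sum-δʳ {suc n} f Fin.zero    = trans (cong₂ _+_ (*-identityˡ _)
    (trans (sum-cong-≗ {n} (λ i → zeroˡ _)) (sum-replicate-zero n))) (+-identityʳ _)
  sum-δʳ {suc n} f (Fin.suc i) = trans (cong₂ _+_ (zeroˡ _)
    (trans (sum-cong-≗ (λ j → cong (_* f (Fin.suc j)) (δ-suc i j))) (sum-δʳ (f ∘ Fin.suc) i))) (+-identityˡ _)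

  basis-⋄ : ∀ {n} (A : Matrix Carrier n) i → basis i ⋄ A ≡ lookup A i
  basis-⋄ A i = lookup-ext λ j → trans (Vec.lookup∘tabulate _ j)
    (trans (sum-cong-≗ (λ l → cong (_* entry A l j) (Vec.lookup∘tabulate (δ i) l))) (sum-δʳ (λ l → entry A l j) i))

  lookup-sum : ∀ {m n} (f : Fin m → Vec Carrier n) j → lookup (Module.sum (space n) f) j ≡ sum (λ i → lookup (f i) j)
  lookup-sum {zero}  f j = Vec.lookup-replicate j 0#
  lookup-sum {suc m} f j = trans (Vec.lookup-zipWith _+_ j (f Fin.zero) _)
    (cong (lookup (f Fin.zero) j +_) (lookup-sum (f ∘ Fin.suc) j))

  expand : ∀ {n} (w : Vec Carrier n) → w ≡ Module.sum (space n) (λ i → lookup w i ▪ basis i)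
  expand w = lookup-ext λ j → sym (trans (lookup-sum (λ i → lookup w i ▪ basis i) j)
    (trans (sum-cong-≗ (λ i → trans (Vec.lookup-map j (lookup w i *_) (basis i)) (cong (lookup w i *_) (Vec.lookup∘tabulate (δ i) j))))
           (sum-δˡ (lookup w) j)))

  linear-expand : ∀ {n} {N : Module k} (f : Linear (space n) N) w →
    Linear.to f w ≡ Module.sum N (λ i → Module._•_ N (lookup w i) (Linear.to f (basis i)))
  linear-expand {N = N} f w = trans (cong f.to (expand w))
    (trans (f.to-sum (λ i → lookup w i ▪ basis i)) (Module.sum-cong-≗ N (λ i → f.to-• (lookup w i) (basis i))))
    where module f = Linear f

  linear-ext : ∀ {n} {N : Module k} (f g : Linear (space n) N) → (∀ i → Linear.to f (basis i) ≡ Linear.to g (basis i)) →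
    ∀ w → Linear.to f w ≡ Linear.to g w
  linear-ext {N = N} f g h w = trans (linear-expand f w)
    (trans (Module.sum-cong-≗ N (λ i → cong (Module._•_ N (lookup w i)) (h i))) (sym (linear-expand g w)))

  ⋄-linear : ∀ {n} → Matrix Carrier n → Linear (space n) (space n)
  ⋄-linear A = record { to = _⋄ A ; to-⊕ = ⋄-⊞ A ; to-• = ⋄-▪ A }

  matrix : ∀ {n} → (Vec Carrier n → Vec Carrier n) → Matrix Carrier n
  matrix f = tabulate (λ i → f (basis i))

  ⋄-matrix : ∀ {n} (f : Linear (space n) (space n)) w → w ⋄ matrix (Linear.to f) ≡ Linear.to f w
  ⋄-matrix f = linear-ext (⋄-linear (matrix (Linear.to f))) f
    λ i → trans (basis-⋄ (matrix (Linear.to f)) i) (Vec.lookup∘tabulate _ i)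

  matrix-ext : ∀ {n} (A B : Matrix Carrier n) → (∀ w → w ⋄ A ≡ w ⋄ B) → A ≡ B
  matrix-ext A B h = lookup-ext λ i → trans (sym (basis-⋄ A i)) (trans (h (basis i)) (basis-⋄ B i))

  ⋄-identity : ∀ {n} (w : Vec Carrier n) → w ⋄ identity ≡ w
  ⋄-identity w = lookup-ext λ j → trans (Vec.lookup∘tabulate _ j)
    (trans (sum-cong-≗ (λ i → cong (lookup w i *_)
      (trans (cong (λ r → lookup r j) (Vec.lookup∘tabulate (λ i → tabulate (δ i)) i)) (Vec.lookup∘tabulate (δ i) j))))
      (sum-δˡ (lookup w) j))

  lookup-⊗ : ∀ {n} (A B : Matrix Carrier n) i → lookup (A ⊗ B) i ≡ lookup A i ⋄ B
  lookup-⊗ A B i = trans (Vec.lookup∘tabulate _ i) (Vec.tabulate-cong λ j → sumV-tabulate (λ l → entry A i l * entry B l j))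

  ⋄-⊗ : ∀ {n} (A B : Matrix Carrier n) w → w ⋄ (A ⊗ B) ≡ w ⋄ A ⋄ B
  ⋄-⊗ A B = linear-ext (⋄-linear (A ⊗ B)) (linear-∘ (⋄-linear B) (⋄-linear A))
    λ i → trans (basis-⋄ (A ⊗ B) i) (trans (lookup-⊗ A B i) (cong (_⋄ B) (sym (basis-⋄ A i))))

  open OverField k using (IsInvertible; charPoly)

  bijective⇒invertible : ∀ {n} (A : Matrix Carrier n) (g : Vec Carrier n → Vec Carrier n) →
    (∀ w → g (w ⋄ A) ≡ w) → (∀ w → g w ⋄ A ≡ w) → IsInvertible A
  bijective⇒invertible {n} A g gA Ag = B ,
    matrix-ext (A ⊗ B) identity (λ w → trans (⋄-⊗ A B w) (trans (⋄-matrix G (w ⋄ A)) (trans (gA w) (sym (⋄-identity w))))) ,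
    matrix-ext (B ⊗ A) identity (λ w → trans (⋄-⊗ B A w) (trans (cong (_⋄ A) (⋄-matrix G w)) (trans (Ag w) (sym (⋄-identity w)))))
    where
    G : Linear (space n) (space n)
    G = linear-inverse (⋄-linear A) g gA Ag
    B : Matrix Carrier n
    B = matrix g

  module _ {n} {A : Matrix Carrier n} (invertible : IsInvertible A) where
    private
      B = proj₁ invertible

    ⋄-inverseʳ : ∀ w → w ⋄ A ⋄ B ≡ w
    ⋄-inverseʳ w = trans (sym (⋄-⊗ A B w)) (trans (cong (w ⋄_) (proj₁ (proj₂ invertible))) (⋄-identity w))

    ⋄-inverseˡ : ∀ w → w ⋄ B ⋄ A ≡ w
    ⋄-inverseˡ w = trans (sym (⋄-⊗ B A w)) (trans (cong (w ⋄_) (proj₂ (proj₂ invertible))) (⋄-identity w))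

  -- Cayley–Hamilton: the rows of XI - A annihilate the vector of basis vectors,
  -- so its determinant annihilates each basis vector.
  cayley-hamilton : ∀ {n} (A : Matrix Carrier n) w → Action.act (rows A) (charPoly A) w ≡ Vec.replicate n 0#
  cayley-hamilton {n} A = linear-ext kill zeroMap λ j →
      det-kills (tabulate λ i → tabulate (b i)) basis row-kills j
    where
    open Module (rows A) using (𝟘; _⊕_; ⊖_; _•_; T)
    module M = Module (rows A)
    open Action (rows A)
    open ExteriorContraction (rows A) using (apply; det-kills)
    kill zeroMap : Linear (space n) (space n)
    kill = record { to = act (charPoly A) ; to-⊕ = act-⊕ (charPoly A) ; to-• = act-• (charPoly A) }
    zeroMap = record { to = λ _ → 𝟘 ; to-⊕ = λ _ _ → sym (M.⊕-identityˡ 𝟘) ; to-• = λ a _ → sym (•-zeroʳ a) }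
    d : Fin n → Fin n → Pol
    d i j = if ⌊ i Fin.≟ j ⌋ then Xₚ else 0ₚ
    b : Fin n → Fin n → Pol
    b i j = d i j +ₚ (-ₚ (entry A i j ∷ []))
    apply-tabulate : ∀ {m} (f : Fin m → Pol) (v : Fin m → Vec Carrier n) → apply (tabulate f) v ≡ M.sum (λ j → act (f j) (v j))
    apply-tabulate {zero}  f v = refl
    apply-tabulate {suc m} f v = cong (act (f Fin.zero) (v Fin.zero) ⊕_) (apply-tabulate (f ∘ Fin.suc) (v ∘ Fin.suc))
    sum-if : ∀ {m} (v : Fin m → Vec Carrier n) i → M.sum (λ j → act (if ⌊ i Fin.≟ j ⌋ then Xₚ else 0ₚ) (v j)) ≡ T (v i)
    sum-if {suc m} v Fin.zero    = trans (cong₂ _⊕_ (act-X _) (M.sum-replicate-zero m)) (M.⊕-identityʳ _)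
    sum-if {suc m} v (Fin.suc i) = trans (M.⊕-identityˡ _) (trans (M.sum-cong-≗ tail) (sum-if (v ∘ Fin.suc) i))
      where
      tail : ∀ j → act (if ⌊ Fin.suc i Fin.≟ Fin.suc j ⌋ then Xₚ else 0ₚ) (v (Fin.suc j)) ≡
                   act (if ⌊ i Fin.≟ j ⌋ then Xₚ else 0ₚ) (v (Fin.suc j))
      tail j with i Fin.≟ j
      ... | yes _ = refl
      ... | no _  = refl
    row-kills : ∀ i → apply (lookup (tabulate λ i → tabulate (b i)) i) basis ≡ 𝟘
    row-kills i = begin
      apply (lookup (tabulate λ i → tabulate (b i)) i) basis
        ≡⟨ trans (cong (λ r → apply r basis) (Vec.lookup∘tabulate _ i)) (apply-tabulate (b i) basis) ⟩
      M.sum (λ j → act (b i j) (basis j))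
        ≡⟨ M.sum-cong-≗ (λ j → trans (act-+ₚ (d i j) _ (basis j)) (cong (act (d i j) (basis j) ⊕_)
             (trans (act-constant (- entry A i j) (basis j))
                    (trans (neg-• (entry A i j) (basis j)) (neg-as-scalar (entry A i j • basis j)))))) ⟩
      M.sum (λ j → act (d i j) (basis j) ⊕ (- 1#) • entry A i j • basis j)
        ≡⟨ M.∑-distrib-+ (λ j → act (d i j) (basis j)) _ ⟩
      M.sum (λ j → act (d i j) (basis j)) ⊕ M.sum (λ j → (- 1#) • entry A i j • basis j)
        ≡⟨ cong₂ _⊕_ (trans (sum-if basis i) (basis-⋄ A i)) (sym (Linear.to-sum negation (λ j → entry A i j • basis j))) ⟩
      lookup A i ⊕ (- 1#) • M.sum (λ j → entry A i j • basis j)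
        ≡⟨ cong (λ z → lookup A i ⊕ (- 1#) • z) (sym (expand (lookup A i))) ⟩
      lookup A i ⊕ (- 1#) • lookup A i
        ≡⟨ trans (cong (lookup A i ⊕_) (sym (neg-as-scalar (lookup A i)))) (M.⊖-inverseʳ _) ⟩
      𝟘 ∎
      where
      neg-as-scalar : ∀ v → ⊖ v ≡ (- 1#) • v
      neg-as-scalar v = sym (trans (neg-• 1# v) (cong ⊖_ (M.•-identity v)))
      negation : Linear (space n) (space n)
      negation = record { to = (- 1#) •_ ; to-⊕ = M.•-distribˡ (- 1#) ; to-• = λ a v →
        trans (sym (M.•-assoc _ a v)) (trans (cong (_• v) (*-comm _ a)) (M.•-assoc a _ v)) }

-- Fermat's theorem and roots of irreducible polynomials

iterate : ∀ {A : Set} → (A → A) → ℕ → A → A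
iterate f zero    x = x
iterate f (suc n) x = f (iterate f n x)

finite-Fin : ∀ n → Finite (Fin n) n
finite-Fin n = record { elem = id ; elem-P = λ _ → tt ; elem-inj = λ _ _ e → e ; index = λ i _ → i ; index-≈ = λ _ _ → refl }

-- `β-⋆` makes β behave like multiplication by a fixed element, so pulling β out of each of the N
-- factors of a product applies it N times to the whole product.
module _ {A : Set} {_⋆_ : A → A → A} {ε : A} (isCM : IsCommutativeMonoid _≡_ _⋆_ ε)
         {P : A → Set} {N} (E : Enum _≡_ P N)
         (β : A → A) (β-⋆ : ∀ x y → β x ⋆ y ≡ β (x ⋆ y)) (β-P : ∀ x → P x → P (β x))
         (β-inj : ∀ {x y} → β x ≡ β y → x ≡ y) where
  private
    CM : CommutativeMonoid 0ℓ 0ℓ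
    CM = record { isCommutativeMonoid = isCM }
    module CM = CommutativeMonoid CM
    module E = Enum E
  open import Algebra.Properties.CommutativeMonoid.Sum CM using (sum; sum-cong-≗; sum-permute)
  open ≡-Reasoning

  product-of-all : A
  product-of-all = sum E.elem

  private
    sum-β : ∀ {n} (f : Fin n → A) → sum (β ∘ f) ≡ iterate β n (sum f)
    sum-β {zero}  f = refl
    sum-β {suc n} f = trans (β-⋆ _ _) (cong β (trans (cong (f Fin.zero ⋆_) (sum-β (f ∘ Fin.suc))) (pull n)))
      where
      pull : ∀ n {x y} → x ⋆ iterate β n y ≡ iterate β n (x ⋆ y)
      pull zero    = refl
      pull (suc n) = trans (CM.comm _ _) (trans (β-⋆ _ _) (cong β (trans (CM.comm _ _) (pull n))))

    σ : Fin N → Fin N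
    σ i = E.index (β (E.elem i)) (β-P _ (E.elem-P i))

    elem-σ : ∀ i → E.elem (σ i) ≡ β (E.elem i)
    elem-σ i = sym (E.index-≈ _ _)

    σ-inj : ∀ {i j} → σ i ≡ σ j → i ≡ j
    σ-inj {i} {j} e = E.elem-inj i j (β-inj (trans (sym (elem-σ i)) (trans (cong E.elem e) (elem-σ j))))

    σ-surj : ∀ j → ∃[ i ] σ i ≡ j
    σ-surj = injective⇒surjective (finite-Fin N) (finite-Fin N) σ σ-inj

  -- β permutes the elements of P, hence fixes their product.
  iterate-product : iterate β N product-of-all ≡ product-of-all
  iterate-product = begin
    iterate β N (sum E.elem)  ≡⟨ sum-β E.elem ⟨
    sum (β ∘ E.elem)  ≡⟨ sum-cong-≗ elem-σ ⟨
    sum (E.elem ∘ σ)  ≡⟨ sum-permute E.elem (permutation σ (proj₁ ∘ σ-surj) (proj₂ ∘ σ-surj)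
                                    (λ i → σ-inj (proj₂ (σ-surj (σ i))))) ⟨
    sum E.elem  ∎

  product-P : P ε → (∀ {x y} → P x → P y → P (x ⋆ y)) → P product-of-all
  product-P P-ε P-⋆ = go E.elem E.elem-P
    where
    go : ∀ {n} (f : Fin n → A) → (∀ i → P (f i)) → P (sum f)
    go {zero}  f h = P-ε
    go {suc n} f h = P-⋆ (h Fin.zero) (go (f ∘ Fin.suc) (h ∘ Fin.suc))

module Fermat {k : Field} (M : Module k) where
  open Field k
  open FieldProperties k
  open Poly rawRing
  open Polynomials k
  open Module M
  open Action M
  open ≡-Reasoning

  act-Xpow : ∀ n v → act (Xpow n) v ≡ iterate T n v
  act-Xpow zero    v = act-1 v
  act-Xpow (suc n) v = trans (act-shift (Xpow n) v) (cong T (act-Xpow n v))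

  -- A simple module generated by u is a field with unit u, and Fermat's little theorem holds in it.
  fermat : ∀ {Q u} → Finite V Q → u ≢ 𝟘 → Simple → ∀ v → T (iterate T (Q ∸ 1) v) ≡ T v
  fermat {Q} {u} finite-V u≢𝟘 simple v with finite-≟ finite-V (T u) 𝟘
  ... | yes Tu≡𝟘 = trans (T≡𝟘 _) (sym (T≡𝟘 v))
    where
    T≡𝟘 : ∀ w → T w ≡ 𝟘
    T≡𝟘 w with simple u u≢𝟘 w
    ... | p , refl = trans (sym (act-T p u)) (trans (cong (act p) Tu≡𝟘) (act-𝟘 p))
  ... | no Tu≢𝟘 = cong T (iterate≡ v)
    where
    coord : V → Pol
    coord w = proj₁ (simple u u≢𝟘 w)
    coord-act : ∀ w → act (coord w) u ≡ w
    coord-act w = proj₂ (simple u u≢𝟘 w)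
    -- This is multiplication in k[X] modulo the annihilator of u: if v = p u and w = r u, then the
    -- product is p r u.
    _⋆_ : V → V → V
    v ⋆ w = act (coord v) w
    ⋆-comm : ∀ v w → v ⋆ w ≡ w ⋆ v
    ⋆-comm v w = begin
      act (coord v) w  ≡⟨ cong (act (coord v)) (coord-act w) ⟨
      act (coord v) (act (coord w) u)  ≡⟨ act-comm (coord v) (coord w) u ⟩
      act (coord w) (act (coord v) u)  ≡⟨ cong (act (coord w)) (coord-act v) ⟩
      act (coord w) v  ∎
    ⋆-assoc : ∀ v w x → (v ⋆ w) ⋆ x ≡ v ⋆ (w ⋆ x)
    ⋆-assoc v w x = begin
      (v ⋆ w) ⋆ x  ≡⟨ ⋆-comm (v ⋆ w) x ⟩
      act (coord x) (act (coord v) w)  ≡⟨ act-comm (coord x) (coord v) w ⟩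
      act (coord v) (x ⋆ w)  ≡⟨ cong (act (coord v)) (⋆-comm x w) ⟩
      v ⋆ (w ⋆ x)  ∎
    ⋆-identityˡ : ∀ v → u ⋆ v ≡ v
    ⋆-identityˡ v = trans (⋆-comm u v) (coord-act v)
    T-⋆ : ∀ v w → T v ⋆ w ≡ T (v ⋆ w)
    T-⋆ v w = trans (⋆-comm (T v) w) (trans (act-T (coord w) v) (cong T (⋆-comm w v)))
    isCM : IsCommutativeMonoid _≡_ _⋆_ u
    isCM = record
      { isMonoid = record
        { isSemigroup = record
          { isMagma = record { isEquivalence = isEquivalence ; ∙-cong = cong₂ _⋆_ }
          ; assoc = ⋆-assoc }
        ; identity = ⋆-identityˡ , λ v → trans (⋆-comm v u) (⋆-identityˡ v) }
      ; comm = ⋆-comm }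
    ⋆-≢𝟘 : ∀ {v w} → v ≢ 𝟘 → w ≢ 𝟘 → v ⋆ w ≢ 𝟘
    ⋆-≢𝟘 {v} {w} v≢𝟘 w≢𝟘 e with simple w w≢𝟘 u
    ... | p , pw≡u = v≢𝟘 (begin
      v  ≡⟨ coord-act v ⟨
      act (coord v) u  ≡⟨ cong (act (coord v)) pw≡u ⟨
      act (coord v) (act p w)  ≡⟨ act-comm (coord v) p w ⟩
      act p (v ⋆ w)  ≡⟨ cong (act p) e ⟩
      act p 𝟘  ≡⟨ act-𝟘 p ⟩
      𝟘  ∎)
    T-≢𝟘 : ∀ v → v ≢ 𝟘 → T v ≢ 𝟘
    T-≢𝟘 v v≢𝟘 e = ⋆-≢𝟘 Tu≢𝟘 v≢𝟘 (trans (T-⋆ u v) (trans (cong T (⋆-identityˡ v)) e))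
    T-inj : ∀ {v w} → T v ≡ T w → v ≡ w
    T-inj {v} {w} e with finite-≟ finite-V (v ⊕ ⊖ w) 𝟘
    ... | yes d≡𝟘 = v⊖w≡𝟘⇒v≡w v w d≡𝟘
    ... | no d≢𝟘  = contradiction
      (trans (T-⊕ v (⊖ w)) (trans (cong₂ _⊕_ e (T-⊖ w)) (⊖-inverseʳ (T w)))) (T-≢𝟘 _ d≢𝟘)
      where
      T-⊖ : ∀ w → T (⊖ w) ≡ ⊖ T w
      T-⊖ w = ⊖-unique (T w) (T (⊖ w)) (trans (sym (T-⊕ w (⊖ w))) (trans (cong T (⊖-inverseʳ w)) T-𝟘))
    nonzero : Enum _≡_ (_≢ 𝟘) (Q ∸ 1)
    nonzero = enum-remove finite-V 𝟘
    Π : V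
    Π = product-of-all isCM nonzero T T-⋆ T-≢𝟘 T-inj
    Π≢𝟘 : Π ≢ 𝟘
    Π≢𝟘 = product-P isCM nonzero T T-⋆ T-≢𝟘 T-inj u≢𝟘 ⋆-≢𝟘
    iterate≡ : ∀ v → iterate T (Q ∸ 1) v ≡ v
    -- Π is nonzero and hence a generator. Every v is p Π, and T^(Q-1) commutes with p, so it is
    -- enough that T^(Q-1) fixes Π.
    iterate≡ v with simple Π Π≢𝟘 v
    ... | p , refl = begin
      iterate T (Q ∸ 1) (act p Π)  ≡⟨ act-Xpow (Q ∸ 1) _ ⟨
      act (Xpow (Q ∸ 1)) (act p Π)  ≡⟨ act-comm (Xpow (Q ∸ 1)) p Π ⟩
      act p (act (Xpow (Q ∸ 1)) Π)  ≡⟨ cong (act p) (act-Xpow (Q ∸ 1) Π) ⟩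
      act p (iterate T (Q ∸ 1) Π)  ≡⟨ cong (act p) (iterate-product isCM nonzero T T-⋆ T-≢𝟘 T-inj) ⟩
      act p Π  ∎

-- Roots of polynomials over a field

module Roots (K : Field) where
  open Field K
  open FieldProperties K
  open Poly rawRing
  open Polynomials K
  open ≡-Reasoning

  eval-at : Carrier → Pol → Carrier
  eval-at x p = Action.act (scalars K x) p 1#

  -- Synthetic division: p = p(a) + (X - a) `quotient a p`. For c + X p, the quotient p + a q comes
  -- from X p - a p(a) = (X - a) p + a (p - p(a)).
  quotient : Carrier → Pol → Pol
  quotient a []      = []
  quotient a (c ∷ p) = p +ₚ a ·ₚ quotient a p

  eval-quotient : ∀ a y p → eval-at (a + y) p ≡ eval-at a p + y * eval-at (a + y) (quotient a p)
  eval-quotient a y []      = sym (trans (cong (0# +_) (zeroʳ y)) (+-identityˡ 0#))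
  eval-quotient a y (c ∷ p) = begin
    c * 1# + (a + y) * E
      ≡⟨ cong (c * 1# +_) (distribʳ E a y) ⟩
    c * 1# + (a * E + y * E)
      ≡⟨ cong (λ z → c * 1# + (a * z + y * E)) (eval-quotient a y p) ⟩
    c * 1# + (a * (eval-at a p + y * q) + y * E)
      ≡⟨ cong (λ z → c * 1# + (z + y * E)) (distribˡ a _ _) ⟩
    c * 1# + ((a * eval-at a p + a * (y * q)) + y * E)
      ≡⟨ cong (c * 1# +_) (+-assoc _ _ _) ⟩
    c * 1# + (a * eval-at a p + (a * (y * q) + y * E))
      ≡⟨ +-assoc _ _ _ ⟨
    (c * 1# + a * eval-at a p) + (a * (y * q) + y * E)
      ≡⟨ cong (eval-at a (c ∷ p) +_) (trans (+-comm _ _) (cong (y * E +_) swap)) ⟩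
    (c * 1# + a * eval-at a p) + (y * E + y * (a * q))
      ≡⟨ cong (eval-at a (c ∷ p) +_) (distribˡ y _ _) ⟨
    (c * 1# + a * eval-at a p) + y * (E + a * q)
      ≡⟨ cong (λ z → eval-at a (c ∷ p) + y * z) (trans (act-+ₚ p (a ·ₚ quotient a p) 1#) (cong (E +_) (act-·ₚ a (quotient a p) 1#))) ⟨
    eval-at a (c ∷ p) + y * eval-at (a + y) (quotient a (c ∷ p))
      ∎
    where
    open Action (scalars K (a + y)) using (act-+ₚ; act-·ₚ)
    E = eval-at (a + y) p
    q = eval-at (a + y) (quotient a p)
    swap : a * (y * q) ≡ y * (a * q)
    swap = trans (sym (*-assoc a y q)) (trans (cong (_* q) (*-comm a y)) (*-assoc y a q))

  quotient-deg< : ∀ a p {d} → Deg< p (suc d) → Deg< (quotient a p) d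
  quotient-deg< a []      h i _ = refl
  quotient-deg< a (c ∷ p) {d} h = deg<-+ p (a ·ₚ quotient a p) (deg<-∷ h) (deg<-· a (quotient a p) (tail d h))
    where
    tail : ∀ d → Deg< (c ∷ p) (suc d) → Deg< (quotient a p) d
    tail zero    h = quotient-deg< a p (deg<-mono p z≤n (deg<-∷ h))
    tail (suc d) h = deg<-mono (quotient a p) (ℕ.n≤1+n d) (quotient-deg< a p (deg<-∷ h))

  quotient-monic : ∀ a p {d} → Monic (suc d) p → Monic d (quotient a p)
  quotient-monic a [] (monic lead _) = contradiction lead 0≢1
  quotient-monic a (c ∷ p) {d} (monic lead h) = monic (begin
    coeff (p +ₚ a ·ₚ quotient a p) d  ≡⟨ coeff-+ p _ d ⟩
    coeff p d + coeff (a ·ₚ quotient a p) d  ≡⟨ cong₂ _+_ lead (trans (coeff-· a (quotient a p) d)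
                                                     (trans (cong (a *_) (quotient-deg< a p (deg<-∷ h) d ℕ.≤-refl)) (zeroʳ a))) ⟩
    1# + 0#  ≡⟨ +-identityʳ 1# ⟩
    1#  ∎)
    (quotient-deg< a (c ∷ p) h)

  -- Splitting off a first root a leaves (b - a) q(b) = p(b) = 0 for every other root b, so the
  -- other roots are roots of the quotient q, which is monic of degree one less.
  roots-≤ : ∀ {d r p} → Monic d p → (x : Fin r → Carrier) → (∀ i j → x i ≡ x j → i ≡ j) → (∀ i → eval-at (x i) p ≡ 0#) → r ≤ d
  roots-≤ {d} {zero} M x x-inj x-root = z≤n
  roots-≤ {zero} {suc r} {p} (monic lead h) x x-inj x-root = contradiction (begin
    0#  ≡⟨ x-root Fin.zero ⟨
    eval-at x₀ p  ≡⟨ Action.act-≈ (scalars K x₀) p 1ₚ 1# (λ { zero → lead ; (suc i) → h (suc i) (s≤s z≤n) }) ⟩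
    eval-at x₀ 1ₚ  ≡⟨ Action.act-1 (scalars K x₀) 1# ⟩
    1#  ∎) 0≢1
    where
    x₀ = x Fin.zero
  roots-≤ {suc d} {suc r} {p} M x x-inj x-root = s≤s (roots-≤ (quotient-monic a p M) (x ∘ Fin.suc)
      (λ i j e → Fin.suc-injective (x-inj (Fin.suc i) (Fin.suc j) e)) root)
    where
    a = x Fin.zero
    root : ∀ i → eval-at (x (Fin.suc i)) (quotient a p) ≡ 0#
    root i = *-cancel-0 y≢0 (begin
      y * eval-at b (quotient a p)  ≡⟨ cong (λ z → y * eval-at z (quotient a p)) b≡ ⟩
      y * eval-at (a + y) (quotient a p)  ≡⟨ +-identityˡ _ ⟨
      0# + y * eval-at (a + y) (quotient a p)  ≡⟨ cong (_+ (y * eval-at (a + y) (quotient a p))) (x-root Fin.zero) ⟨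
      eval-at a p + y * eval-at (a + y) (quotient a p)  ≡⟨ eval-quotient a y p ⟨
      eval-at (a + y) p  ≡⟨ cong (λ z → eval-at z p) b≡ ⟨
      eval-at b p  ≡⟨ x-root (Fin.suc i) ⟩
      0#  ∎)
      where
      b = x (Fin.suc i)
      y = b + - a
      b≡ : b ≡ a + y
      b≡ = sym (trans (+-comm a y) (trans (+-assoc b (- a) a) (trans (cong (b +_) (-‿inverseˡ a)) (+-identityʳ b))))
      y≢0 : y ≢ 0#
      y≢0 e with x-inj (Fin.suc i) Fin.zero (x-y≡0⇒x≡y e)
      ... | ()

module FermatPolynomial (k : Field) where
  open Field k
  open FieldProperties k
  open Poly rawRing
  open Polynomials k

  monic-∷ : ∀ a {p n} → Monic n p → Monic (suc n) (a ∷ p)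
  monic-∷ a (monic lead h) = monic lead λ { (suc i) (s≤s n<i) → h i n<i }

  Xpow-monic : ∀ n → Monic n (Xpow n)
  Xpow-monic zero    = monic refl λ { (suc i) _ → refl }
  Xpow-monic (suc n) = monic-∷ 0# (Xpow-monic n)

  monic-+ : ∀ {n} p q → Monic n p → Deg< q n → Monic n (p +ₚ q)
  monic-+ {n} p q (monic lead p<) q< = monic
    (trans (coeff-+ p q n) (trans (cong₂ _+_ lead (q< n ℕ.≤-refl)) (+-identityʳ 1#)))
    (deg<-+ p q p< (deg<-mono q (ℕ.n≤1+n n) q<))

  -- X (X^N - 1), which is X^Q - X for N = Q - 1.
  fermat-poly : ℕ → Pol
  fermat-poly N = 0# ∷ (Xpow N +ₚ -ₚ 1ₚ)

  fermat-poly-monic : ∀ N → Monic (suc (suc N)) (fermat-poly (suc N))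
  fermat-poly-monic N = monic-∷ 0# (monic-+ (Xpow (suc N)) (-ₚ 1ₚ) (Xpow-monic (suc N)) λ { (suc i) _ → refl })

  module _ (M : Module k) where
    open Module M
    open Action M
    open Fermat M

    fermat-poly-kills : ∀ N v → T (iterate T N v) ≡ T v → act (fermat-poly N) v ≡ 𝟘
    fermat-poly-kills N v e = begin
      act (fermat-poly N) v  ≡⟨ act-shift (Xpow N +ₚ -ₚ 1ₚ) v ⟩
      T (act (Xpow N +ₚ -ₚ 1ₚ) v)  ≡⟨ cong T (act-+ₚ (Xpow N) (-ₚ 1ₚ) v) ⟩
      T (act (Xpow N) v ⊕ act (-ₚ 1ₚ) v)  ≡⟨ T-⊕ _ _ ⟩
      T (act (Xpow N) v) ⊕ T (act (-ₚ 1ₚ) v)  ≡⟨ cong₂ _⊕_ (trans (cong T (act-Xpow N v)) e) (sym (act-T (-ₚ 1ₚ) v)) ⟩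
      T v ⊕ act (-ₚ 1ₚ) (T v)  ≡⟨ cong (T v ⊕_) (trans (act-negₚ 1ₚ (T v)) (cong ⊖_ (act-1 (T v)))) ⟩
      T v ⊕ ⊖ T v  ≡⟨ ⊖-inverseʳ (T v) ⟩
      𝟘  ∎
      where open ≡-Reasoning

scalars-simple : ∀ K t → Action.Simple (scalars K t)
scalars-simple K t v v≢0 w with Field.inverse K v v≢0
... | y , vy≡1 = (w * y ∷ []) , (begin
  act (w * y ∷ []) v  ≡⟨ act-constant (w * y) v ⟩
  w * y * v  ≡⟨ *-assoc w y v ⟩
  w * (y * v)  ≡⟨ cong (w *_) (trans (*-comm y v) vy≡1) ⟩
  w * 1#  ≡⟨ *-identityʳ w ⟩
  w  ∎)
  where
  open Field K
  open FieldProperties K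
  open Action (scalars K t)
  open ≡-Reasoning

scalars-act : ∀ K t p w → Action.act (scalars K t) p w ≡ Field._*_ K w (Action.act (scalars K t) p (Field.1# K))
scalars-act K t p w = trans (cong (act p) (sym (*-identityʳ w))) (act-• p w 1#)
  where
  open Field K
  open FieldProperties K
  open Action (scalars K t)

field-size : ∀ (k : Field) {q} → Finite (Field.Carrier k) q → ∃[ N ] q ≡ suc (suc N)
field-size k {q} E = go q (Enum.index E 0# tt) (Enum.index E 1# tt) λ e →
    0≢1 (trans (Enum.index-≈ E 0# tt) (trans (cong (Enum.elem E) e) (sym (Enum.index-≈ E 1# tt))))
  where
  open Field k
  go : ∀ q (i j : Fin q) → i ≢ j → ∃[ N ] q ≡ suc (suc N)
  go (suc zero)    Fin.zero Fin.zero i≢j = contradiction refl i≢j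
  go (suc (suc N)) _        _        _   = N , refl

-- Restriction of scalars and roots in the extension

module Restriction {F K : Field} (E : Extension F K) where
  open Extension E
  private
    module F  = Field F
    module K  = Field K
    module FP = FieldProperties F
    module KP = FieldProperties K
    module PF = Poly F.rawRing
    module PK = Poly K.rawRing
    module PolF = Polynomials F
    module PolK = Polynomials K
  open ≡-Reasoning

  ι-0 : ι F.0# ≡ K.0#
  ι-0 = begin
    ι F.0#  ≡⟨ KP.+-identityʳ _ ⟨
    ι F.0# K.+ K.0#  ≡⟨ cong (ι F.0# K.+_) (KP.-‿inverseʳ (ι F.0#)) ⟨
    ι F.0# K.+ (ι F.0# K.+ K.- ι F.0#)  ≡⟨ KP.+-assoc _ _ _ ⟨
    ι F.0# K.+ ι F.0# K.+ K.- ι F.0#  ≡⟨ cong (K._+ K.- ι F.0#) (trans (sym (ι-+ _ _)) (cong ι (FP.+-identityˡ F.0#))) ⟩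
    ι F.0# K.+ K.- ι F.0#  ≡⟨ KP.-‿inverseʳ (ι F.0#) ⟩
    K.0#  ∎

  coeff-map : ∀ p i → PK.coeff (map ι p) i ≡ ι (PF.coeff p i)
  coeff-map []      i       = sym ι-0
  coeff-map (a ∷ p) zero    = refl
  coeff-map (a ∷ p) (suc i) = coeff-map p i

  map-monic : ∀ {n} p → PolF.Monic n p → PolK.Monic n (map ι p)
  map-monic {n} p (PolF.monic lead h) = PolK.monic (trans (coeff-map p n) (trans (cong ι lead) ι-1))
    λ i n<i → trans (coeff-map p i) (trans (cong ι (h i n<i)) ι-0)

  restrict : Module K → Module F
  restrict M = record
    { V = V ; _⊕_ = _⊕_ ; ⊖_ = ⊖_ ; 𝟘 = 𝟘 ; isAbelianGroup = isAbelianGroup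
    ; _•_ = λ a v → ι a • v
    ; •-distribˡ = λ a v w → •-distribˡ (ι a) v w
    ; •-distribʳ = λ a b v → trans (cong (_• v) (ι-+ a b)) (•-distribʳ (ι a) (ι b) v)
    ; •-assoc    = λ a b v → trans (cong (_• v) (ι-* a b)) (•-assoc (ι a) (ι b) v)
    ; •-identity = λ v → trans (cong (_• v) ι-1) (•-identity v)
    ; T = T ; T-⊕ = T-⊕ ; T-• = λ a v → T-• (ι a) v }
    where open Module M

  act-restrict : ∀ (M : Module K) p v → Action.act (restrict M) p v ≡ Action.act M (map ι p) v
  act-restrict M []      v = refl
  act-restrict M (a ∷ p) v = cong (λ w → ι a • v ⊕ T w) (act-restrict M p v)
    where open Module M

  act-restrict-Xpow : ∀ (M : Module K) n w → Action.act (restrict M) (PF.Xpow n) w ≡ Action.act M (PK.Xpow n) w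
  act-restrict-Xpow M n w = trans (Fermat.act-Xpow (restrict M) n w) (sym (Fermat.act-Xpow M n w))

  restrict-simple : ∀ (M : Module K) → Action.Simple (restrict M) → Action.Simple M
  restrict-simple M simple v v≢𝟘 w with simple v v≢𝟘 w
  ... | p , e = map ι p , trans (sym (act-restrict M p v)) e

  -- K as a module over F[X] with X acting as x; the value of p at x is then `root-value x p`.
  adjoin : K.Carrier → Module F
  adjoin x = restrict (scalars K x)

  root-value : K.Carrier → PF.Pol → K.Carrier
  root-value x p = Action.act (adjoin x) p K.1#

  adjoin-act : ∀ x p w → Action.act (adjoin x) p w ≡ w K.* root-value x p
  adjoin-act x p w = trans (act-restrict (scalars K x) p w)
    (trans (scalars-act K x (map ι p) w) (cong (w K.*_) (sym (act-restrict (scalars K x) p K.1#))))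

  module _ {q m} (finite-F : Finite F.Carrier q) (finite-K : Finite K.Carrier (q ^ suc m)) where

    -- X^(q^m) - X = h e over F has all q^m elements of K as roots, while e has
    -- at most q^m - m of them.
    irreducible-roots : ∀ {h} (M : Module F) → Finite (Module.V M) (q ^ suc m) → ∀ {u} → u ≢ Module.𝟘 M →
      PF.Irreducible h → PolF.Monic (suc m) h → (∀ v → Action.act M h v ≡ Module.𝟘 M) →
      Enum _≡_ (λ x → root-value x h ≡ K.0#) (suc m)
    irreducible-roots {h} M finite-V {u} u≢𝟘 irr h-monic h-kills = roots
      where
      open Module M
      open Action M
      open Simplicity M finite-F
      open FermatPolynomial F
      open PF using (Pol; _≈ₚ_; _*ₚ_; _+ₚ_; coeff)

      -- M is a model of F[X]/(h). Fermat's theorem in M says that X^(q^m) - X vanishes modulo h,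
      -- and in K that every element is a root of it.
      G-kills-M : ∀ v → act (fermat-poly (q ^ suc m ∸ 1)) v ≡ 𝟘
      G-kills-M v = fermat-poly-kills M (q ^ suc m ∸ 1) v
        (Fermat.fermat M finite-V u≢𝟘 (irreducible⇒simple finite-V h-monic h-kills irr) v)

      G-kills-K : ∀ x → root-value x (fermat-poly (q ^ suc m ∸ 1)) ≡ K.0#
      G-kills-K x = fermat-poly-kills (adjoin x) (q ^ suc m ∸ 1) K.1#
        (Fermat.fermat (scalars K x) finite-K (λ e → K.0≢1 (sym e)) (scalars-simple K x) K.1#)

      N′ : ℕ
      N′ = proj₁ (field-size K finite-K)
      Q≡ : q ^ suc m ≡ suc (suc N′)
      Q≡ = proj₂ (field-size K finite-K)
      G : Pol
      G = fermat-poly (suc N′)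
      G-monic : PolF.Monic (suc (suc N′)) G
      G-monic = fermat-poly-monic N′
      open PolF.Monic G-monic renaming (leading to G-leading; deg< to G<)
      open PolF.Monic h-monic renaming (leading to h-leading; deg< to h<)

      roots : Enum _≡_ (λ x → root-value x h ≡ K.0#) (suc m)
      roots with PolF.divide h-monic G
      ... | e , rem , G≈ , rem< = by-degree (PolF.degree (finite-≟ finite-F) e)
        where
        rem-kills : act rem u ≡ 𝟘
        rem-kills = begin
          act rem u  ≡⟨ ⊕-identityˡ _ ⟨
          𝟘 ⊕ act rem u  ≡⟨ cong (_⊕ act rem u) (trans (act-*ₚ h e u) (h-kills _)) ⟨
          act (h *ₚ e) u ⊕ act rem u  ≡⟨ act-+ₚ (h *ₚ e) rem u ⟨
          act (h *ₚ e +ₚ rem) u  ≡⟨ act-≈ G (h *ₚ e +ₚ rem) u G≈ ⟨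
          act G u  ≡⟨ subst (λ Q → act (fermat-poly (Q ∸ 1)) u ≡ 𝟘) Q≡ (G-kills-M u) ⟩
          𝟘  ∎
        -- The remainder kills u and has degree below that of h, so faithfulness of u makes it zero.
        G≈he : G ≈ₚ h *ₚ e
        G≈he i = trans (G≈ i) (trans (PolF.coeff-+ (h *ₚ e) rem i)
          (trans (cong (coeff (h *ₚ e) i F.+_) (irreducible⇒faithful irr h-monic u≢𝟘 (h-kills u) rem rem< rem-kills i)) (FP.+-identityʳ _)))
        by-degree : e ≈ₚ [] ⊎ (∃[ d ] coeff e d ≢ F.0# × PolF.Deg< e (suc d)) → Enum _≡_ (λ x → root-value x h ≡ K.0#) (suc m)
        by-degree (inj₁ e≈0) = contradiction
          (trans (sym (PolF.*ₚ-zeroʳ h e e≈0 (suc (suc N′)))) (trans (sym (G≈he (suc (suc N′)))) G-leading)) F.0≢1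
        by-degree (inj₂ (d , e≢0 , e<)) with enum-dec finite-K (λ x → finite-≟ finite-K (root-value x h) K.0#)
        ... | r , s , R , S , r+s≡Q = subst (Enum _≡_ _) r≡m R
          where
          top : coeff G (suc m ℕ.+ d) ≡ coeff e d
          top = trans (G≈he (suc m ℕ.+ d)) (trans (PolF.coeff-*ₚ h e h< e<) (trans (cong (F._* coeff e d) h-leading) (FP.*-identityˡ _)))
          -- Since h is monic, h e has degree exactly m + d, writing m for the degree of h;
          -- comparison with G forces this to be q^m.
          m+d≡Q : suc m ℕ.+ d ≡ suc (suc N′)
          m+d≡Q with ℕ.<-cmp (suc m ℕ.+ d) (suc (suc N′))
          ... | tri< l _ _ = contradiction (trans (sym (PolF.deg<-*ₚ h e h< e< _ l)) (trans (sym (G≈he _)) G-leading)) F.0≢1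
          ... | tri≈ _ e _ = e
          ... | tri> _ _ l = contradiction (trans (sym top) (G< _ l)) e≢0
          e-monic : PolF.Monic d e
          e-monic = PolF.monic (trans (sym top) (trans (cong (coeff G) m+d≡Q) G-leading)) e<
          root-of : ∀ p x → root-value x p ≡ K.0# → Roots.eval-at K x (map ι p) ≡ K.0#
          root-of p x root = trans (sym (act-restrict (scalars K x) p K.1#)) root
          r≤ : r ≤ suc m
          r≤ = Roots.roots-≤ K (map-monic h h-monic) (Enum.elem R) (Enum.elem-inj R) λ i → root-of h _ (Enum.elem-P R i)
          s≤ : s ≤ d
          s≤ = Roots.roots-≤ K (map-monic e e-monic) (Enum.elem S) (Enum.elem-inj S) λ i → root-of e _ (e-root _ (Enum.elem-P S i))
            where
            e-root : ∀ x → root-value x h ≢ K.0# → root-value x e ≡ K.0#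
            e-root x h≢0 = KP.*-cancel-0 h≢0 (begin
              root-value x h K.* root-value x e  ≡⟨ KP.*-comm _ _ ⟩
              root-value x e K.* root-value x h  ≡⟨ adjoin-act x h (root-value x e) ⟨
              Action.act (adjoin x) h (root-value x e)  ≡⟨ Action.act-*ₚ (adjoin x) h e K.1# ⟨
              root-value x (h *ₚ e)  ≡⟨ Action.act-≈ (adjoin x) G (h *ₚ e) K.1# G≈he ⟨
              root-value x G  ≡⟨ subst (λ Q → root-value x (fermat-poly (Q ∸ 1)) ≡ K.0#) Q≡ (G-kills-K x) ⟩
              K.0#  ∎)
          -- The elements of K are r roots of h and s others, which are roots of e, so s ≤ d. From r
          -- + s = q^m and the degree of G = h e, r is at least the degree of h.
          r≡m : r ≡ suc m
          r≡m = ℕ.≤-antisym r≤ (ℕ.+-cancelʳ-≤ d (suc m) r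
            (ℕ.≤-trans (ℕ.≤-reflexive (trans m+d≡Q (trans (sym Q≡) (sym r+s≡Q)))) (ℕ.+-monoʳ-≤ r s≤)))

-- Linear recurrences and block companion matrices

lookup-∷ʳ-inject₁ : ∀ {A : Set} {n} (w : Vec A n) x i → lookup (w ∷ʳ x) (inject₁ i) ≡ lookup w i
lookup-∷ʳ-inject₁ (y ∷ w) x Fin.zero    = refl
lookup-∷ʳ-inject₁ (y ∷ w) x (Fin.suc i) = lookup-∷ʳ-inject₁ w x i

lookup-∷ʳ-last : ∀ {A : Set} {n} (w : Vec A n) x → lookup (w ∷ʳ x) (fromℕ n) ≡ x
lookup-∷ʳ-last []      x = refl
lookup-∷ʳ-last (y ∷ w) x = lookup-∷ʳ-last w x

∷ʳ-all : ∀ {A : Set} {n} (P : A → Set) (w : Vec A n) x → (∀ i → P (lookup w i)) → P x → ∀ i → P (lookup (w ∷ʳ x) i)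
∷ʳ-all P []      x h p Fin.zero    = p
∷ʳ-all P (y ∷ w) x h p Fin.zero    = h Fin.zero
∷ʳ-all P (y ∷ w) x h p (Fin.suc i) = ∷ʳ-all P w x (h ∘ Fin.suc) p i

lookup-tail : ∀ {A : Set} {n} (w : Vec A (suc n)) i → lookup (Vec.tail w) i ≡ lookup w (Fin.suc i)
lookup-tail (x ∷ w) i = refl

head-lookup : ∀ {A : Set} {n} (w : Vec A (suc n)) → Vec.head w ≡ lookup w Fin.zero
head-lookup (x ∷ w) = refl

iterate-inner : ∀ {A : Set} (f : A → A) n x → iterate f n (f x) ≡ f (iterate f n x)
iterate-inner f zero    x = refl
iterate-inner f (suc n) x = cong f (iterate-inner f n x)

module PolynomialSums {k : Field} (M : Module k) where
  open Field k
  open VecPolynomials k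
  open Module M
  open Action M

  T-linear : Linear M M
  T-linear = record { to = T ; to-⊕ = T-⊕ ; to-• = T-• }

  act-poly : ∀ {n} (a : Vec Carrier n) v → act (poly a) v ≡ sum (λ i → lookup a i • iterate T (toℕ i) v)
  act-poly []      v = refl
  act-poly (x ∷ a) v = cong (x • v ⊕_) (trans (cong T (act-poly a v))
    (trans (Linear.to-sum T-linear (λ i → lookup a i • iterate T (toℕ i) v)) (sum-cong-≗ (λ i → T-• (lookup a i) _))))

  act-iterate : ∀ p n v → act p (iterate T n v) ≡ iterate T n (act p v)
  act-iterate p zero    v = refl
  act-iterate p (suc n) v = trans (act-T p _) (cong T (act-iterate p n v))

  -- If T has a kernel then a simple module is one-dimensional.
  simple-kernel : ∀ {q N} → Finite Carrier q → Finite V (q ^ N) → 1 < N → Simple → ∀ v → v ≢ 𝟘 → T v ≢ 𝟘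
  simple-kernel {q} {N} finite-k finite-V 1<N simple v v≢𝟘 Tv≡𝟘 = contradiction
    (surjection-≥ finite-k finite-V (_• v) onto)
    (ℕ.<⇒≱ (subst (_< q ^ N) (ℕ.*-identityʳ q) (ℕ.^-monoʳ-< q 1<q 1<N)))
    where
    1<q : 1 < q
    1<q with field-size k finite-k
    ... | _ , refl = s≤s (s≤s z≤n)
    onto : ∀ w → ∃[ a ] a • v ≡ w
    onto w with simple v v≢𝟘 w
    ... | []    , e = 0# , trans (•-zeroˡ v) e
    -- Since T v = 0, only the constant term of the polynomial contributes.
    ... | a ∷ p , e = a , trans (sym (trans (cong (a • v ⊕_) (trans (sym (act-T p v)) (trans (cong (act p) Tv≡𝟘) (act-𝟘 p)))) (⊕-identityʳ _))) e

-- Sequences with w_{j+n} = T (c_0 w_j + … + c_{n-1} w_{j+n-1}) (with n = suc n′), X acting by shifting.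
module Shift {k : Field} (M : Module k) {n′ : ℕ} (c : Fin (suc n′) → Field.Carrier k) where
  open Field k
  open Poly rawRing
  open VecPolynomials k
  open VectorModule M
  private module M = Module M
  open M using (V; _⊕_; 𝟘; _•_; T)
  private module A = Action M
  open ≡-Reasoning

  combination : Vec V (suc n′) → V
  combination w = M.sum (λ i → c i • lookup w i)

  step : Vec V (suc n′) → Vec V (suc n′)
  step w = Vec.tail w ∷ʳ T (combination w)

  private
    •-comm : ∀ a b v → a • b • v ≡ b • a • v
    •-comm a b v = trans (sym (M.•-assoc a b v)) (trans (cong (_• v) (FieldProperties.*-comm k a b)) (M.•-assoc b a v))

    scale : Carrier → Linear M M
    scale a = record { to = a •_ ; to-⊕ = M.•-distribˡ a ; to-• = λ b v → •-comm a b v }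

    combination-⊞ : ∀ v w → combination (v ⊞ w) ≡ combination v ⊕ combination w
    combination-⊞ v w = trans
      (M.sum-cong-≗ (λ i → trans (cong (c i •_) (Vec.lookup-zipWith _⊕_ i v w)) (M.•-distribˡ (c i) _ _)))
      (M.∑-distrib-+ (λ i → c i • lookup v i) (λ i → c i • lookup w i))

    combination-▪ : ∀ a w → combination (a ▪ w) ≡ a • combination w
    combination-▪ a w = trans
      (M.sum-cong-≗ (λ i → trans (cong (c i •_) (Vec.lookup-map i (a •_) w)) (•-comm (c i) a _)))
      (sym (Linear.to-sum (scale a) (λ i → c i • lookup w i)))

    ∷ʳ-⊞ : ∀ {n} (v w : Vec V n) x y → (v ∷ʳ x) ⊞ (w ∷ʳ y) ≡ (v ⊞ w) ∷ʳ (x ⊕ y)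
    ∷ʳ-⊞ []      []      x y = refl
    ∷ʳ-⊞ (a ∷ v) (b ∷ w) x y = cong (a ⊕ b ∷_) (∷ʳ-⊞ v w x y)

    step-⊞ : ∀ v w → step (v ⊞ w) ≡ step v ⊞ step w
    step-⊞ v@(x ∷ v′) w@(y ∷ w′) = trans
      (cong ((v′ ⊞ w′) ∷ʳ_) (trans (cong T (combination-⊞ v w)) (M.T-⊕ _ _))) (sym (∷ʳ-⊞ v′ w′ _ _))

    step-▪ : ∀ a w → step (a ▪ w) ≡ a ▪ step w
    step-▪ a w@(x ∷ w′) = trans
      (cong ((a ▪ w′) ∷ʳ_) (trans (cong T (combination-▪ a w)) (M.T-• a _))) (sym (Vec.map-∷ʳ (a •_) _ w′))

  shift : Module k
  shift = vectors (suc n′) step step-⊞ step-▪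

  private module S = Module shift
  open Action shift using () renaming (act to shift-act)

  head-linear : Linear shift M
  head-linear = record
    { to   = Vec.head
    ; to-⊕ = λ { (x ∷ v) (y ∷ w) → refl }
    ; to-• = λ { a (x ∷ v) → refl }
    }

  -- A state is the window w_0, ..., w_{n-1} of a sequence, and t shifts bring w_t to the head.
  -- Statements about states thereby reduce to statements about heads.
  lookup-iterate : ∀ t (j : Fin (suc n′)) → toℕ j ≡ t → ∀ w → lookup w j ≡ Vec.head (iterate step t w)
  lookup-iterate zero    Fin.zero    _ w = sym (head-lookup w)
  lookup-iterate (suc t) (Fin.suc j) e w = begin
    lookup w (Fin.suc j)  ≡⟨ lookup-tail w j ⟨
    lookup (Vec.tail w) j  ≡⟨ lookup-∷ʳ-inject₁ (Vec.tail w) _ j ⟨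
    lookup (step w) (inject₁ j)  ≡⟨ lookup-iterate t (inject₁ j) (trans (Fin.toℕ-inject₁ j) (ℕ.suc-injective e)) (step w) ⟩
    Vec.head (iterate step t (step w))  ≡⟨ cong Vec.head (iterate-inner step t w) ⟩
    Vec.head (iterate step (suc t) w)  ∎

  -- The recurrence as a relation between X^n and T g(X). It is stated for heads, because T acts on
  -- single terms of the sequence rather than on states.
  recurrence : ∀ w → Vec.head (shift-act (Xpow (suc n′)) w) ≡ T (Vec.head (shift-act (poly (tabulate c)) w))
  recurrence w = begin
    Vec.head (shift-act (Xpow (suc n′)) w)
      ≡⟨ cong Vec.head (Fermat.act-Xpow shift (suc n′) w) ⟩
    Vec.head (iterate step (suc n′) w)
      ≡⟨ cong Vec.head (iterate-inner step n′ w) ⟨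
    Vec.head (iterate step n′ (step w))
      ≡⟨ lookup-iterate n′ (fromℕ n′) (Fin.toℕ-fromℕ n′) (step w) ⟨
    lookup (step w) (fromℕ n′)
      ≡⟨ lookup-∷ʳ-last (Vec.tail w) _ ⟩
    T (M.sum (λ i → c i • lookup w i))
      ≡⟨ cong T (M.sum-cong-≗ (λ i → cong₂ _•_ (sym (Vec.lookup∘tabulate c i)) (lookup-iterate (toℕ i) i refl w))) ⟩
    T (M.sum (λ i → lookup (tabulate c) i • Vec.head (iterate step (toℕ i) w)))
      ≡⟨ cong T (M.sum-cong-≗ (λ i → sym (head.to-• (lookup (tabulate c) i) (iterate step (toℕ i) w)))) ⟩
    T (M.sum (λ i → Vec.head (lookup (tabulate c) i ▪ iterate step (toℕ i) w)))
      ≡⟨ cong T (head.to-sum (λ i → lookup (tabulate c) i ▪ iterate step (toℕ i) w)) ⟨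
    T (Vec.head (S.sum (λ i → lookup (tabulate c) i ▪ iterate step (toℕ i) w)))
      ≡⟨ cong (T ∘ Vec.head) (PolynomialSums.act-poly shift (tabulate c) w) ⟨
    T (Vec.head (shift-act (poly (tabulate c)) w))
      ∎
    where module head = Linear head-linear

  -- Entry j of p w is the head of p (X^j w), since p commutes with the shift.
  head-kills : ∀ p → (∀ w → Vec.head (shift-act p w) ≡ 𝟘) → ∀ w → shift-act p w ≡ S.𝟘
  head-kills p h w = lookup-ext λ j → begin
    lookup (shift-act p w) j  ≡⟨ lookup-iterate (toℕ j) j refl (shift-act p w) ⟩
    Vec.head (iterate step (toℕ j) (shift-act p w))  ≡⟨ cong Vec.head (PolynomialSums.act-iterate shift p (toℕ j) w) ⟨
    Vec.head (shift-act p (iterate step (toℕ j) w))  ≡⟨ h _ ⟩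
    𝟘  ≡⟨ Vec.lookup-replicate j 𝟘 ⟨
    lookup S.𝟘 j  ∎

  initial : V → Vec V (suc n′)
  initial u = u ∷ Vec.replicate n′ 𝟘

  -- All entries of states reachable from (u, 0, ..., 0) stay in the submodule generated by u,
  -- because a step only uses linear combinations and T. As (w, 0, ..., 0) is reachable, w lies in
  -- that submodule.
  shift-simple : Action.Simple shift → A.Simple
  shift-simple simple u u≢𝟘 w with simple (initial u) (λ e → u≢𝟘 (cong Vec.head e)) (initial w)
  ... | p , e = subst Orbit (trans (sym (head-lookup (shift-act p (initial u)))) (cong Vec.head e)) (orbit p Fin.zero)
    where
    Orbit : V → Set
    Orbit x = ∃[ r ] A.act r u ≡ x
    orbit-𝟘 : Orbit 𝟘
    orbit-𝟘 = [] , refl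
    orbit-⊕ : ∀ {x y} → Orbit x → Orbit y → Orbit (x ⊕ y)
    orbit-⊕ (r , refl) (s , refl) = r +ₚ s , A.act-+ₚ r s u
    orbit-• : ∀ a {x} → Orbit x → Orbit (a • x)
    orbit-• a (r , refl) = a ·ₚ r , A.act-·ₚ a r u
    orbit-T : ∀ {x} → Orbit x → Orbit (T x)
    orbit-T (r , refl) = 0# ∷ r , A.act-shift r u
    orbit-sum : ∀ {n} (f : Fin n → V) → (∀ i → Orbit (f i)) → Orbit (M.sum f)
    orbit-sum {zero}  f h = orbit-𝟘
    orbit-sum {suc n} f h = orbit-⊕ (h Fin.zero) (orbit-sum (f ∘ Fin.suc) (h ∘ Fin.suc))
    orbit-initial : ∀ i → Orbit (lookup (initial u) i)
    orbit-initial Fin.zero    = 1ₚ , A.act-1 u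
    orbit-initial (Fin.suc i) = subst Orbit (sym (Vec.lookup-replicate i 𝟘)) orbit-𝟘
    orbit : ∀ p i → Orbit (lookup (shift-act p (initial u)) i)
    orbit []      i = subst Orbit (sym (Vec.lookup-replicate i 𝟘)) orbit-𝟘
    orbit (a ∷ p) i = subst Orbit (sym (trans (Vec.lookup-zipWith _⊕_ i (a ▪ initial u) (step z))
        (cong (_⊕ lookup (step z) i) (Vec.lookup-map i (a •_) (initial u)))))
      (orbit-⊕ (orbit-• a (orbit-initial i)) (∷ʳ-all Orbit (Vec.tail z) _
        (λ j → subst Orbit (sym (lookup-tail z j)) (orbit p (Fin.suc j)))
        (orbit-T (orbit-sum _ (λ j → orbit-• (c j) (orbit p j)))) i))
      where z = shift-act p (initial u)

shift-iso : ∀ {k : Field} {M N : Module k} {n′} (c : Fin (suc n′) → Field.Carrier k) → Iso M N → Iso (Shift.shift M c) (Shift.shift N c)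
shift-iso {k} {M} {N} {n′} c I = record
  { hom = record
    { linear = record
      { to   = Vec.map to
      ; to-⊕ = map-⊞
      ; to-• = map-▪
      }
    ; to-T = map-step
    }
  ; from    = Vec.map from
  ; from-to = map-inverse from to from-to
  ; to-from = map-inverse to from to-from
  }
  where
  open Iso I
  module M = Module M
  module N = Module N
  module VM = VectorModule M
  module VN = VectorModule N
  map-⊞ : ∀ {n} (v w : Vec M.V n) → Vec.map to (v VM.⊞ w) ≡ Vec.map to v VN.⊞ Vec.map to w
  map-⊞ []      []      = refl
  map-⊞ (x ∷ v) (y ∷ w) = cong₂ _∷_ (to-⊕ x y) (map-⊞ v w)
  map-▪ : ∀ {n} a (v : Vec M.V n) → Vec.map to (a VM.▪ v) ≡ a VN.▪ Vec.map to v
  map-▪ a []      = refl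
  map-▪ a (x ∷ v) = cong₂ _∷_ (to-• a x) (map-▪ a v)
  map-inverse : ∀ {A B : Set} (f : A → B) (g : B → A) → (∀ b → f (g b) ≡ b) → ∀ {n} (v : Vec B n) → Vec.map f (Vec.map g v) ≡ v
  map-inverse f g fg []      = refl
  map-inverse f g fg (x ∷ v) = cong₂ _∷_ (fg x) (map-inverse f g fg v)
  map-step : ∀ w → Vec.map to (Shift.step M c w) ≡ Shift.step N c (Vec.map to w)
  map-step w@(x ∷ w′) = trans (Vec.map-∷ʳ to _ w′) (cong (Vec.map to w′ ∷ʳ_) (trans (to-T _) (cong N.T (trans (to-sum (λ i → c i M.• lookup w i))
    (N.sum-cong-≗ (λ i → trans (to-• (c i) (lookup w i)) (cong (c i N.•_) (sym (Vec.lookup-map i to w)))))))))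

-- Two of the first Q + 1 iterates coincide, and injectivity cancels the common part. The exponent
-- is `suc d`, so that d further iterations invert f at x.
injective-cycle : ∀ {A : Set} {Q} → Finite A Q → (f : A → A) → (∀ {x y} → f x ≡ f y → x ≡ y) →
  ∀ x → ∃[ d ] iterate f (suc d) x ≡ x
injective-cycle {A} {Q} finite-A f f-inj x with Fin.pigeonhole (ℕ.n<1+n Q) (λ i → Enum.index finite-A (iterate f (toℕ i) x) tt)
... | i , j , i<j , e with ℕ.m≤n⇒∃[o]m+o≡n i<j
...   | d , i+d≡j = d , sym (cancel (toℕ i) (trans iterates≡ (cong (λ t → iterate f t x) (sym (trans (ℕ.+-suc (toℕ i) d) i+d≡j)))))
  where
  iterates≡ : iterate f (toℕ i) x ≡ iterate f (toℕ j) x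
  iterates≡ = trans (Enum.index-≈ finite-A _ tt) (trans (cong (Enum.elem finite-A) e) (sym (Enum.index-≈ finite-A _ tt)))
  cancel : ∀ i → iterate f i x ≡ iterate f (i ℕ.+ suc d) x → x ≡ iterate f (suc d) x
  cancel zero    e = e
  cancel (suc i) e = cancel i (f-inj e)

module ShiftInitial {k : Field} (M : Module k) {n′ : ℕ} (c : Fin (suc n′) → Field.Carrier k) where
  open Shift M c
  open Module M
  open Action M

  -- The state (u, 0, ..., 0) moves to (0, ..., 0, T c₀ u). Thus a vector u with T c₀ u = 0 gives a
  -- vector in the kernel of the shift.
  step-initial : ∀ u → T (c Fin.zero • u) ≡ 𝟘 → step (initial u) ≡ Vec.replicate (suc n′) 𝟘
  step-initial u e = trans (cong (Vec.replicate n′ 𝟘 ∷ʳ_) (trans (cong T combination≡) e)) (replicate-∷ʳ n′)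
    where
    combination≡ : combination (initial u) ≡ c Fin.zero • u
    combination≡ = trans (cong (c Fin.zero • u ⊕_) (trans
      (sum-cong-≗ {n′} (λ i → trans (cong (c (Fin.suc i) •_) (Vec.lookup-replicate i 𝟘)) (•-zeroʳ _))) (sum-replicate-zero n′)))
      (⊕-identityʳ _)
    replicate-∷ʳ : ∀ n → Vec.replicate n 𝟘 ∷ʳ 𝟘 ≡ Vec.replicate (suc n) 𝟘
    replicate-∷ʳ zero    = refl
    replicate-∷ʳ (suc n) = cong (𝟘 ∷_) (replicate-∷ʳ n)

-- Elements generating K over F

module Generators {F K : Field} (E : Extension F K) {q m′} (finite-F : Finite (Field.Carrier F) q)
                  (finite-K : Finite (Field.Carrier K) (q ^ suc m′)) where
  open Extension E
  open Restriction E
  private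
    module F  = Field F
    module K  = Field K
    module KP = FieldProperties K
    module PF = Poly F.rawRing
    module PolF = Polynomials F
  open ≡-Reasoning

  module _ (λ₀ : K.Carrier) where
    private module A = Action (adjoin λ₀)
    open Simplicity (adjoin λ₀) finite-F

    private
      InPoly : K.Carrier → Set
      InPoly x = ∃[ p ] root-value λ₀ p ≡ x

      poly-mul : ∀ {x y} → InPoly x → InPoly y → InPoly (x K.* y)
      poly-mul {x} {y} (p , p≡) (r , r≡) = p PF.*ₚ r , (begin
        root-value λ₀ (p PF.*ₚ r)  ≡⟨ A.act-*ₚ p r K.1# ⟩
        A.act p (root-value λ₀ r)  ≡⟨ adjoin-act λ₀ p _ ⟩
        root-value λ₀ r K.* root-value λ₀ p  ≡⟨ cong₂ K._*_ r≡ p≡ ⟩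
        y K.* x  ≡⟨ KP.*-comm y x ⟩
        x K.* y  ∎)

      -- By Fermat's theorem in K the inverse of x is its power with exponent q^m - 2, so values of
      -- polynomials are closed under inversion.
      poly-inv : ∀ {x y} → InPoly x → x K.* y ≡ K.1# → InPoly y
      poly-inv {x} {y} x-poly xy≡1 with field-size K finite-K
      ... | N′ , Q≡ = subst InPoly power≡y (power N′)
        where
        x≢0 : x ≢ K.0#
        x≢0 refl = K.0≢1 (trans (sym (KP.zeroˡ y)) xy≡1)
        cancel : ∀ {a b} → x K.* a ≡ x K.* b → a ≡ b
        cancel {a} {b} e = begin
          a  ≡⟨ KP.*-identityʳ a ⟨
          a K.* K.1#  ≡⟨ cong (a K.*_) xy≡1 ⟨
          a K.* (x K.* y)  ≡⟨ trans (sym (KP.*-assoc a x y)) (cong (K._* y) (KP.*-comm a x)) ⟩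
          x K.* a K.* y  ≡⟨ cong (K._* y) e ⟩
          x K.* b K.* y  ≡⟨ trans (cong (K._* y) (KP.*-comm x b)) (KP.*-assoc b x y) ⟩
          b K.* (x K.* y)  ≡⟨ cong (b K.*_) xy≡1 ⟩
          b K.* K.1#  ≡⟨ KP.*-identityʳ b ⟩
          b  ∎
        fermat-x : x K.* iterate (x K.*_) (suc N′) K.1# ≡ x K.* K.1#
        fermat-x = subst (λ Q → x K.* iterate (x K.*_) (Q ∸ 1) K.1# ≡ x K.* K.1#) Q≡
          (Fermat.fermat (scalars K x) finite-K (λ e → K.0≢1 (sym e)) (scalars-simple K x) K.1#)
        power≡y : iterate (x K.*_) N′ K.1# ≡ y
        power≡y = cancel (trans (cancel fermat-x) (sym xy≡1))
        power : ∀ t → InPoly (iterate (x K.*_) t K.1#)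
        power zero    = PF.1ₚ , A.act-1 K.1#
        power (suc t) = poly-mul x-poly (power t)

    subfield-poly : ∀ {x} → InSubfield E λ₀ x → ∃[ p ] root-value λ₀ p ≡ x
    subfield-poly (base a) = (a ∷ []) , trans (A.act-constant a K.1#) (KP.*-identityʳ (ι a))
    subfield-poly gen      = PF.Xₚ , trans (A.act-X K.1#) (KP.*-identityʳ λ₀)
    subfield-poly (add i j) with subfield-poly i | subfield-poly j
    ... | p , refl | r , refl = p PF.+ₚ r , A.act-+ₚ p r K.1#
    subfield-poly (mul i j) = poly-mul (subfield-poly i) (subfield-poly j)
    subfield-poly (neg i) with subfield-poly i
    ... | p , refl = PF.-ₚ p , A.act-negₚ p K.1#
    subfield-poly (inv i e) = poly-inv (subfield-poly i) e

    poly-subfield : ∀ p → InSubfield E λ₀ (root-value λ₀ p)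
    poly-subfield []      = subst (InSubfield E λ₀) ι-0 (base F.0#)
    poly-subfield (a ∷ p) = add (mul (base a) (subst (InSubfield E λ₀) ι-1 (base F.1#))) (mul gen (poly-subfield p))

    -- As h is irreducible and vanishes at λ₀, polynomials of degree below that of h take distinct
    -- values there. There are as many of them as elements of K, so they reach all of K.
    root-generates : ∀ {h} → PF.Irreducible h → PolF.Monic (suc m′) h → root-value λ₀ h ≡ K.0# → Generates E λ₀
    root-generates irr h-monic root x with
      faithful⇒cyclic finite-K (irreducible⇒faithful irr h-monic (λ e → K.0≢1 (sym e)) root) x
    ... | a , e = subst (InSubfield E λ₀) e (poly-subfield (VecPolynomials.poly F a))

    -- A relation of degree < m would leave fewer than q^m values of polynomials at λ₀.
    generates-faithful : Generates E λ₀ → Faithful (suc m′) K.1#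
    generates-faithful generates p p< p-root with PolF.degree (finite-≟ finite-F) p
    ... | inj₁ p≈0 = p≈0
    ... | inj₂ (d , p≢0 , p<d) with PolF.make-monic p p≢0 p<d
    ...   | c , p₁-monic = ⊥-elim (absurd d refl p₁-monic)
      where
      p₁ : PF.Pol
      p₁ = c PF.·ₚ p
      p₁-root : root-value λ₀ p₁ ≡ K.0#
      p₁-root = trans (A.act-·ₚ c p K.1#) (trans (cong (ι c K.*_) p-root) (KP.zeroʳ _))
      d<m : d < suc m′
      d<m = ℕ.≰⇒> (λ m≤d → p≢0 (p< d m≤d))
      -- The constant case stands apart because reduction modulo p₁ needs a divisor of positive
      -- degree; a nonzero constant is a unit and cannot kill 1.
      absurd : ∀ d′ → d ≡ d′ → PolF.Monic d′ p₁ → ⊥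
      absurd zero _ (PolF.monic lead h) = K.0≢1 (sym (A.act-unit p₁ K.1#
        (PolF.constant-unit p₁ (λ e → F.0≢1 (trans (sym e) lead)) h) p₁-root))
      absurd (suc d′) refl M = ℕ.<⇒≱ q^d<q^m (surjection-≥ (finite-Vec finite-F (suc d′)) finite-K (eval K.1#) onto)
        where
        onto : ∀ x → ∃[ a ] eval {suc d′} K.1# a ≡ x
        onto x with subfield-poly (generates x)
        ... | r , r≡ with reduce-eval M p₁-root r
        ...   | a , a≡ = a , trans a≡ r≡
        q^d<q^m : q ^ suc d′ < q ^ suc m′
        q^d<q^m with field-size F finite-F
        ... | _ , refl = ℕ.^-monoʳ-< q (s≤s (s≤s z≤n)) d<m

-- The polynomial X^n - λg and sequences over K

module TwistedPolynomial {F K : Field} (E : Extension F K) {q m′} (finite-F : Finite (Field.Carrier F) q)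
                         (finite-K : Finite (Field.Carrier K) (q ^ suc m′))
                         {n′ : ℕ} (λ₀ : Field.Carrier K) (γ : Vec (Field.Carrier F) n′) where
  open Extension E
  open Restriction E
  open Generators E {q} {m′} finite-F finite-K
  private
    module F  = Field F
    module K  = Field K
    module KP = FieldProperties K
    module PF = Poly F.rawRing
    module PK = Poly K.rawRing
    module PolK = Polynomials K
    module VF = VecPolynomials F
    module VK = VecPolynomials K
    n = suc n′
  open ≡-Reasoning

  g : PF.Pol
  g = VF.poly (F.1# ∷ γ)

  c : Fin n → F.Carrier
  c = lookup (F.1# ∷ γ)

  twisted : PK.Pol
  twisted = PK.Xpow n PK.+ₚ PK.-ₚ (λ₀ PK.·ₚ map ι g)

  shiftK : Module K
  shiftK = Shift.shift (scalars K λ₀) (ι ∘ c)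

  shiftF : Module F
  shiftF = Shift.shift (adjoin λ₀) c

  -- Forming sequences and restricting scalars commute definitionally, so the identity serves as the
  -- isomorphism.
  restrict-shift : Iso (restrict shiftK) shiftF
  restrict-shift = record
    { hom = record { linear = record { to = id ; to-⊕ = λ _ _ → refl ; to-• = λ _ _ → refl } ; to-T = λ _ → refl }
    ; from = id ; from-to = λ _ → refl ; to-from = λ _ → refl }

  private
    module S  = Module shiftK
    module AK = Action shiftK
    module AF = Action (restrict shiftK)
    open Shift (scalars K λ₀) (ι ∘ c) using (initial; recurrence; head-kills; head-linear)
    module head = Linear head-linear

    finite-S : Finite S.V ((q ^ suc m′) ^ n)
    finite-S = finite-Vec finite-K n

    poly-g : VK.poly (tabulate (ι ∘ c)) ≡ map ι g
    poly-g = trans (cong VK.poly (trans (Vec.tabulate-∘ ι c) (cong (Vec.map ι) (Vec.tabulate∘lookup (F.1# ∷ γ))))) (Vec.toList-map ι (F.1# ∷ γ))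

    g< : PolK.Deg< (map ι g) n
    g< i n≤i = trans (coeff-map g i) (trans (cong ι (VF.poly-deg< (F.1# ∷ γ) i n≤i)) ι-0)

  twisted-monic : PolK.Monic n twisted
  twisted-monic = FermatPolynomial.monic-+ K (PK.Xpow n) (PK.-ₚ (λ₀ PK.·ₚ map ι g)) (FermatPolynomial.Xpow-monic K n)
    (PolK.deg<-neg (λ₀ PK.·ₚ map ι g) (PolK.deg<-· λ₀ (map ι g) g<))

  private
    head-difference : ∀ x y z → z ≡ λ₀ S.• y → Vec.head x ≡ λ₀ K.* Vec.head y → Vec.head (x S.⊕ S.⊖ z) ≡ K.0#
    head-difference x y z refl e = trans (head.to-⊕ x (S.⊖ (λ₀ S.• y)))
      (trans (cong₂ K._+_ (trans e (sym (head.to-• λ₀ y))) (head.to-⊖ (λ₀ S.• y))) (KP.-‿inverseʳ _))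

    -- Over K the operator on the terms of a sequence is the scalar λ₀, so the recurrence becomes a
    -- relation among polynomials over K in the shift.
    recurrence-g : ∀ w → Vec.head (AK.act (PK.Xpow n) w) ≡ λ₀ K.* Vec.head (AK.act (map ι g) w)
    recurrence-g w = trans (recurrence w) (cong (λ p → λ₀ K.* Vec.head (AK.act p w)) poly-g)

    difference-kills : ∀ P G → (∀ w → Vec.head (AK.act P w) ≡ λ₀ K.* Vec.head (AK.act G w)) →
      ∀ w → AK.act (P PK.+ₚ PK.-ₚ (λ₀ PK.·ₚ G)) w ≡ S.𝟘
    difference-kills P G h = head-kills (P PK.+ₚ PK.-ₚ (λ₀ PK.·ₚ G)) λ w → trans
      (cong Vec.head (AK.act-difference P (λ₀ PK.·ₚ G) w))
      (head-difference (AK.act P w) (AK.act G w) (AK.act (λ₀ PK.·ₚ G) w) (AK.act-·ₚ λ₀ G w) (h w))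

    difference-action : ∀ P G w → AK.act (P PK.+ₚ PK.-ₚ (λ₀ PK.·ₚ G)) w ≡ S.𝟘 → AK.act P w ≡ λ₀ S.• AK.act G w
    difference-action P G w e = trans
      (S.v⊖w≡𝟘⇒v≡w (AK.act P w) (AK.act (λ₀ PK.·ₚ G) w) (trans (sym (AK.act-difference P (λ₀ PK.·ₚ G) w)) e))
      (AK.act-·ₚ λ₀ G w)

  twisted-kills : ∀ w → AK.act twisted w ≡ S.𝟘
  twisted-kills = difference-kills (PK.Xpow n) (map ι g) recurrence-g

  Xpow-action : ∀ w → AK.act (PK.Xpow n) w ≡ λ₀ S.• AK.act (map ι g) w
  Xpow-action w = difference-action (PK.Xpow n) (map ι g) w (twisted-kills w)

  initial≢𝟘 : initial K.1# ≢ S.𝟘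
  initial≢𝟘 e = K.0≢1 (sym (cong Vec.head e))

  -- What F[X] generates, K[X] generates as well. Over K the module has |K|^n elements and is killed
  -- by the monic `twisted` of degree n, so the counting criterion applies.
  simple⇒twisted-irreducible : Action.Simple shiftF → PK.Irreducible twisted
  simple⇒twisted-irreducible simple = Simplicity.simple⇒irreducible shiftK finite-K finite-S twisted-monic twisted-kills initial≢𝟘
    (restrict-simple shiftK (Iso.iso-simple (iso-sym restrict-shift) simple))

  module _ (irr : PK.Irreducible twisted) (generates : Generates E λ₀) where

    private
      gop : S.V → S.V
      gop = AK.act (map ι g)

      -- The polynomial g has degree below n and constant coefficient 1, while nothing nonzero of
      -- degree below n kills a nonzero vector of the K[X]-module.
      gop-≢𝟘 : ∀ {w} → w ≢ S.𝟘 → gop w ≢ S.𝟘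
      gop-≢𝟘 w≢𝟘 e = K.0≢1 (trans (sym (Simplicity.irreducible⇒faithful shiftK finite-K irr twisted-monic w≢𝟘 (twisted-kills _) (map ι g) g< e 0)) ι-1)

      gop-inj : ∀ {v w} → gop v ≡ gop w → v ≡ w
      gop-inj {v} {w} e with finite-≟ finite-S (v S.⊕ S.⊖ w) S.𝟘
      ... | yes d = S.v⊖w≡𝟘⇒v≡w v w d
      ... | no ¬d = contradiction (trans (AK.act-⊕ (map ι g) v (S.⊖ w))
        (trans (cong₂ S._⊕_ e (AK.act-⊖ (map ι g) w)) (S.⊖-inverseʳ (gop w)))) (gop-≢𝟘 ¬d)

      module _ (v : S.V) where
        g-power : ∀ t → ∃[ r ] AF.act r v ≡ iterate gop t v
        g-power zero    = PF.1ₚ , AF.act-1 v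
        g-power (suc t) = let r , e = g-power t in
          g PF.*ₚ r , trans (AF.act-*ₚ g r v) (trans (cong (AF.act g) e) (act-restrict shiftK g _))

        -- g acts invertibly, with inverse a power of g, so λ₀ = X^n / g acts as a polynomial over F.
        λ-action-via : ∀ P → (∀ w → AF.act P w ≡ λ₀ S.• gop w) → ∃[ r ] AF.act r v ≡ λ₀ S.• v
        λ-action-via P h =
          let d , cycle = injective-cycle finite-S gop gop-inj v
              r , e     = g-power d
          in P PF.*ₚ r , (begin
            AF.act (P PF.*ₚ r) v  ≡⟨ AF.act-*ₚ P r v ⟩
            AF.act P (AF.act r v)  ≡⟨ cong (AF.act P) e ⟩
            AF.act P (iterate gop d v)  ≡⟨ h (iterate gop d v) ⟩
            λ₀ S.• iterate gop (suc d) v  ≡⟨ cong (λ₀ S.•_) cycle ⟩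
            λ₀ S.• v  ∎)

        λ-action : ∃[ r ] AF.act r v ≡ λ₀ S.• v
        λ-action = λ-action-via (PF.Xpow n) λ w → trans (act-restrict-Xpow shiftK n w) (Xpow-action w)

        AF-• : ∀ r x → AF.act r (x S.• v) ≡ x S.• AF.act r v
        AF-• r x = trans (act-restrict shiftK r (x S.• v)) (trans (AK.act-• (map ι r) x v) (cong (x S.•_) (sym (act-restrict shiftK r v))))

        value-action : ∀ p → ∃[ r ] AF.act r v ≡ root-value λ₀ p S.• v
        value-action []      = [] , sym (AK.•-zeroˡ v)
        value-action (a ∷ p) =
          let s , s≡ = λ-action
              r , r≡ = value-action p
          in (a ∷ []) PF.+ₚ r PF.*ₚ s , (begin
            AF.act ((a ∷ []) PF.+ₚ r PF.*ₚ s) v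
              ≡⟨ AF.act-+ₚ (a ∷ []) (r PF.*ₚ s) v ⟩
            AF.act (a ∷ []) v S.⊕ AF.act (r PF.*ₚ s) v
              ≡⟨ cong₂ S._⊕_ (AF.act-constant a v) (trans (AF.act-*ₚ r s v) (trans (cong (AF.act r) s≡) (trans (AF-• r λ₀) (cong (λ₀ S.•_) r≡)))) ⟩
            ι a S.• v S.⊕ λ₀ S.• root-value λ₀ p S.• v
              ≡⟨ cong₂ S._⊕_ (cong (S._• v) (sym (KP.*-identityʳ (ι a)))) (sym (S.•-assoc λ₀ (root-value λ₀ p) v)) ⟩
            (ι a K.* K.1#) S.• v S.⊕ (λ₀ K.* root-value λ₀ p) S.• v
              ≡⟨ S.•-distribʳ _ _ v ⟨
            root-value λ₀ (a ∷ p) S.• v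
              ∎)

        -- Since λ₀ generates K, each coefficient of P is a polynomial in λ₀, and λ₀ acts on v as a
        -- polynomial over F. The result depends on v, which is enough for comparing the submodules
        -- generated by v.
        K-action : ∀ P → ∃[ r ] AF.act r v ≡ AK.act P v
        K-action []      = [] , refl
        K-action (x ∷ P) =
          let p , p≡ = subfield-poly λ₀ (generates x)
              r , r≡ = K-action P
              s , s≡ = value-action p
          in s PF.+ₚ (F.0# ∷ r) , trans (AF.act-+ₚ s (F.0# ∷ r) v)
            (cong₂ S._⊕_ (trans s≡ (cong (S._• v) p≡)) (trans (AF.act-shift r v) (cong S.T r≡)))

    twisted-irreducible⇒simple : Action.Simple shiftF
    twisted-irreducible⇒simple = Iso.iso-simple restrict-shift λ v v≢𝟘 w →
      let P , P≡ = Simplicity.irreducible⇒simple shiftK finite-K finite-S twisted-monic twisted-kills irr v v≢𝟘 w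
          r , r≡ = K-action v P
      in r , trans r≡ P≡

    -- If λ₀ were zero, the shift would kill (1, 0, ..., 0), which a simple module with q^(mn)
    -- elements excludes.
    λ≢0 : 1 < suc m′ ℕ.* n → λ₀ ≢ K.0#
    λ≢0 1<mn refl = PolynomialSums.simple-kernel shiftF finite-F
      (subst (Finite S.V) (ℕ.^-*-assoc q (suc m′) n) finite-S) 1<mn
      twisted-irreducible⇒simple (initial K.1#) initial≢𝟘
      (ShiftInitial.step-initial (adjoin λ₀) c K.1# (KP.zeroˡ _))

-- TSR matrices as shift operators

if-yes : ∀ {P A : Set} (d : Dec P) {x y : A} → P → (if ⌊ d ⌋ then x else y) ≡ x
if-yes (yes _) _ = refl
if-yes (no ¬p) p = contradiction p ¬p

if-no : ∀ {P A : Set} (d : Dec P) {x y : A} → ¬ P → (if ⌊ d ⌋ then x else y) ≡ y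
if-no (yes p) ¬p = contradiction p ¬p
if-no (no _)  _  = refl

module BlockCompanion (F : Field) (m n′ : ℕ) where
  open Field F
  open FieldProperties F
  open RowVectors F
  open Det rawRing using (δ)
  open OverField F using (tsrEntry)
  open import Algebra.Properties.CommutativeSemigroup (CommutativeRing.*-commutativeSemigroup commutativeRing) using (x∙yz≈y∙xz)
  open import Algebra.Properties.Semiring.Sum semiring
    using (sum; sum-cong-≗; *-distribˡ-sum)
  open ≡-Reasoning

  n : ℕ
  n = suc n′

  tsr : Vec Carrier n → Matrix Carrier m → Matrix Carrier (n ℕ.* m)
  tsr c B = tabulate λ x → tabulate λ y →
    tsrEntry c B (proj₁ (remQuot m x)) (proj₁ (remQuot m y)) (proj₂ (remQuot {n} m x)) (proj₂ (remQuot {n} m y))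

  entry-tsr : ∀ c B i j a b → entry (tsr c B) (combine i a) (combine j b) ≡ tsrEntry c B i j a b
  entry-tsr c B i j a b = trans (cong (λ r → lookup r (combine j b)) (Vec.lookup∘tabulate _ (combine i a)))
    (trans (Vec.lookup∘tabulate _ (combine j b))
      (cong₂ (λ ia jb → tsrEntry c B (proj₁ ia) (proj₁ jb) (proj₂ ia) (proj₂ jb)) (Fin.remQuot-combine i a) (Fin.remQuot-combine j b)))

  combine-ext : ∀ {A : Set} {v w : Vec A (n ℕ.* m)} →
    (∀ (i : Fin n) (a : Fin m) → lookup v (combine i a) ≡ lookup w (combine i a)) → v ≡ w
  combine-ext {v = v} {w} h = lookup-ext λ x →
    subst (λ x → lookup v x ≡ lookup w x) (Fin.combine-remQuot {n} m x) (h (proj₁ (remQuot m x)) (proj₂ (remQuot {n} m x)))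

  tsr-unique : ∀ c B (T : Matrix Carrier (n ℕ.* m)) →
    (∀ i j a b → entry T (combine i a) (combine j b) ≡ tsrEntry c B i j a b) → tsr c B ≡ T
  tsr-unique c B T h = combine-ext λ i a → combine-ext λ j b → trans (entry-tsr c B i j a b) (sym (h i j a b))

  flatten : Vec (Vec Carrier m) n → Vec Carrier (n ℕ.* m)
  flatten w = tabulate λ x → lookup (lookup w (proj₁ (remQuot m x))) (proj₂ (remQuot {n} m x))

  unflatten : Vec Carrier (n ℕ.* m) → Vec (Vec Carrier m) n
  unflatten v = tabulate λ i → tabulate λ a → lookup v (combine i a)

  lookup-flatten : ∀ w (i : Fin n) (a : Fin m) → lookup (flatten w) (combine i a) ≡ lookup (lookup w i) a
  lookup-flatten w i a = trans (Vec.lookup∘tabulate _ (combine i a))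
    (cong (λ ia → lookup (lookup w (proj₁ ia)) (proj₂ ia)) (Fin.remQuot-combine i a))

  lookup-unflatten : ∀ v (i : Fin n) (a : Fin m) → lookup (lookup (unflatten v) i) a ≡ lookup v (combine i a)
  lookup-unflatten v i a = trans
    (cong (λ r → lookup r a) (Vec.lookup∘tabulate (λ i → tabulate λ a → lookup v (combine i a)) i))
    (Vec.lookup∘tabulate (λ a → lookup v (combine i a)) a)

  sum-split : ∀ k {l} (f : Fin (k ℕ.+ l) → Carrier) → sum f ≡ sum (λ i → f (i Fin.↑ˡ l)) + sum (λ j → f (k Fin.↑ʳ j))
  sum-split zero    f = sym (+-identityˡ _)
  sum-split (suc k) f = trans (cong (f Fin.zero +_) (sum-split k (f ∘ Fin.suc))) (sym (+-assoc _ _ _))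

  sum-combine : ∀ l {k} (f : Fin (l ℕ.* k) → Carrier) → sum f ≡ sum (λ (i : Fin l) → sum (λ (a : Fin k) → f (combine i a)))
  sum-combine zero        f = refl
  sum-combine (suc l) {k} f = trans (sum-split k f) (cong (sum (λ a → f (a Fin.↑ˡ (l ℕ.* k))) +_) (sum-combine l (f ∘ (k Fin.↑ʳ_))))

  tsrEntry-last : ∀ (c : Vec Carrier n) (B : Matrix Carrier m) i a b → tsrEntry c B i (fromℕ n′) a b ≡ lookup c i * entry B a b
  tsrEntry-last c B i a b = if-yes (toℕ (fromℕ n′) ℕ.≟ n′) (Fin.toℕ-fromℕ n′)

  δ-refl : ∀ {l} (i : Fin l) → δ i i ≡ 1#
  δ-refl i with i Fin.≟ i
  ... | yes _ = refl
  ... | no ¬e = contradiction refl ¬e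

  δ-≢ : ∀ {l} {i j : Fin l} → i ≢ j → δ i j ≡ 0#
  δ-≢ {i = i} {j} i≢j with i Fin.≟ j
  ... | yes e = contradiction e i≢j
  ... | no _  = refl

  -- Turning the nested conditionals into a product of deltas lets the double sum over blocks and
  -- entries collapse one index at a time.
  tsrEntry-inject₁ : ∀ (c : Vec Carrier n) (B : Matrix Carrier m) i j a b → tsrEntry c B i (inject₁ j) a b ≡ δ i (Fin.suc j) * δ a b
  tsrEntry-inject₁ c B i j a b = trans
    (if-no (toℕ (inject₁ j) ℕ.≟ n′) (λ e → ℕ.<⇒≢ (Fin.toℕ<n j) (trans (sym (Fin.toℕ-inject₁ j)) e)))
    (below (i Fin.≟ Fin.suc j))
    where
    x? : Dec (toℕ i ≡ suc (toℕ (inject₁ j)))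
    x? = toℕ i ℕ.≟ suc (toℕ (inject₁ j))
    below : Dec (i ≡ Fin.suc j) → (if ⌊ x? ⌋ then δ a b else 0#) ≡ δ i (Fin.suc j) * δ a b
    below (yes refl) = trans (if-yes x? (cong suc (sym (Fin.toℕ-inject₁ j))))
      (sym (trans (cong (_* δ a b) (δ-refl i)) (*-identityˡ (δ a b))))
    below (no i≢j) = trans (if-no x? (λ e → i≢j (Fin.toℕ-injective (trans e (cong suc (Fin.toℕ-inject₁ j))))))
      (sym (trans (cong (_* δ a b) (δ-≢ i≢j)) (zeroˡ (δ a b))))

  module _ (c : Vec Carrier n) (B : Matrix Carrier m) where
    open Shift (rows B) (lookup c) using (shift; step; combination)
    private
      module M = Module (rows B)
      module V = VectorModule (rows B)

    lookup-⋄-tsr : ∀ w j b → lookup (flatten w ⋄ tsr c B) (combine j b) ≡ sum (λ i → sum (λ a → lookup (lookup w i) a * tsrEntry c B i j a b))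
    lookup-⋄-tsr w j b = begin
      lookup (flatten w ⋄ tsr c B) (combine j b)
        ≡⟨ lookup-⋄ (flatten w) (tsr c B) (combine j b) ⟩
      sum (λ x → lookup (flatten w) x * entry (tsr c B) x (combine j b))
        ≡⟨ sum-combine n {m} (λ x → lookup (flatten w) x * entry (tsr c B) x (combine j b)) ⟩
      sum (λ (i : Fin n) → sum (λ (a : Fin m) → lookup (flatten w) (combine i a) * entry (tsr c B) (combine i a) (combine j b)))
        ≡⟨ sum-cong-≗ {n} (λ i → sum-cong-≗ {m} (λ a → cong₂ _*_ (lookup-flatten w i a) (entry-tsr c B i j a b))) ⟩
      sum (λ i → sum (λ a → lookup (lookup w i) a * tsrEntry c B i j a b))
        ∎

    last-column : ∀ w b → lookup (combination w ⋄ B) b ≡ sum (λ i → sum (λ a → lookup (lookup w i) a * (lookup c i * entry B a b)))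
    last-column w b = begin
      lookup (combination w ⋄ B) b
        ≡⟨ cong (λ v → lookup v b) (Linear.to-sum (⋄-linear B) (λ i → lookup c i M.• lookup w i)) ⟩
      lookup (M.sum (λ i → (lookup c i M.• lookup w i) ⋄ B)) b
        ≡⟨ lookup-sum (λ i → (lookup c i M.• lookup w i) ⋄ B) b ⟩
      sum (λ i → lookup ((lookup c i M.• lookup w i) ⋄ B) b)
        ≡⟨ sum-cong-≗ {n} (λ i → trans (lookup-⋄ (lookup c i M.• lookup w i) B b) (sum-cong-≗ {m} (λ a → trans
             (cong (_* entry B a b) (trans (Vec.lookup-map a (lookup c i *_) (lookup w i)) (*-comm (lookup c i) (lookup (lookup w i) a))))
             (*-assoc (lookup (lookup w i) a) (lookup c i) (entry B a b))))) ⟩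
      sum (λ i → sum (λ a → lookup (lookup w i) a * (lookup c i * entry B a b)))
        ∎

    other-column : ∀ (w : Vec (Vec Carrier m) n) j b → lookup (lookup w (Fin.suc j)) b ≡
      sum (λ i → sum (λ a → lookup (lookup w i) a * (δ i (Fin.suc j) * δ a b)))
    other-column w j b = sym (begin
      sum (λ i → sum (λ a → lookup (lookup w i) a * (δ i (Fin.suc j) * δ a b)))
        ≡⟨ sum-cong-≗ {n} (λ i → trans (sum-cong-≗ {m} (λ a → x∙yz≈y∙xz (lookup (lookup w i) a) (δ i (Fin.suc j)) (δ a b)))
             (sym (*-distribˡ-sum (δ i (Fin.suc j)) (λ a → lookup (lookup w i) a * δ a b)))) ⟩
      sum (λ i → δ i (Fin.suc j) * sum (λ a → lookup (lookup w i) a * δ a b))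
        ≡⟨ sum-cong-≗ {n} (λ i → trans (cong (δ i (Fin.suc j) *_) (sum-δˡ (lookup (lookup w i)) b)) (*-comm _ _)) ⟩
      sum (λ i → lookup (lookup w i) b * δ i (Fin.suc j))
        ≡⟨ sum-δˡ (λ i → lookup (lookup w i) b) (Fin.suc j) ⟩
      lookup (lookup w (Fin.suc j)) b
        ∎)

    -- Multiplying a row vector by T, the identity block at (j+1, j) copies block j + 1 of w to
    -- place j, and the last block column produces (Σ c_i w_i) B.
    flatten-step : ∀ w → flatten (step w) ≡ flatten w ⋄ tsr c B
    flatten-step w = combine-ext λ j b → trans (lookup-flatten (step w) j b) (trans (entries j b) (sym (lookup-⋄-tsr w j b)))
      where
      entries : ∀ j b → lookup (lookup (step w) j) b ≡ sum (λ i → sum (λ a → lookup (lookup w i) a * tsrEntry c B i j a b))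
      entries j b with view j
      ... | ‵fromℕ = trans (cong (λ v → lookup v b) (lookup-∷ʳ-last (Vec.tail w) _)) (trans (last-column w b)
        (sum-cong-≗ {n} (λ i → sum-cong-≗ {m} (λ a → cong (lookup (lookup w i) a *_) (sym (tsrEntry-last c B i a b))))))
      ... | ‵inject₁ j′ = trans (cong (λ v → lookup v b) (trans (lookup-∷ʳ-inject₁ (Vec.tail w) _ j′) (lookup-tail w j′)))
        (trans (other-column w j′ b)
          (sum-cong-≗ {n} (λ i → sum-cong-≗ {m} (λ a → cong (lookup (lookup w i) a *_) (sym (tsrEntry-inject₁ c B i j′ a b))))))

    tsr-iso : Iso shift (rows (tsr c B))
    tsr-iso = record
      { hom = record
        { linear = record
          { to   = flatten
          ; to-⊕ = λ v w → combine-ext λ i a → begin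
              lookup (flatten (v V.⊞ w)) (combine i a)
                ≡⟨ lookup-flatten (v V.⊞ w) i a ⟩
              lookup (lookup (v V.⊞ w) i) a
                ≡⟨ trans (cong (λ r → lookup r a) (Vec.lookup-zipWith _⊞_ i v w)) (Vec.lookup-zipWith _+_ a (lookup v i) (lookup w i)) ⟩
              lookup (lookup v i) a + lookup (lookup w i) a
                ≡⟨ cong₂ _+_ (lookup-flatten v i a) (lookup-flatten w i a) ⟨
              lookup (flatten v) (combine i a) + lookup (flatten w) (combine i a)
                ≡⟨ Vec.lookup-zipWith _+_ (combine i a) (flatten v) (flatten w) ⟨
              lookup (flatten v ⊞ flatten w) (combine i a)
                ∎
          ; to-• = λ x w → combine-ext λ i a → begin
              lookup (flatten (x V.▪ w)) (combine i a)
                ≡⟨ lookup-flatten (x V.▪ w) i a ⟩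
              lookup (lookup (x V.▪ w) i) a
                ≡⟨ trans (cong (λ r → lookup r a) (Vec.lookup-map i (x ▪_) w)) (Vec.lookup-map a (x *_) (lookup w i)) ⟩
              x * lookup (lookup w i) a
                ≡⟨ cong (x *_) (lookup-flatten w i a) ⟨
              x * lookup (flatten w) (combine i a)
                ≡⟨ Vec.lookup-map (combine i a) (x *_) (flatten w) ⟨
              lookup (x ▪ flatten w) (combine i a)
                ∎
          }
        ; to-T = flatten-step
        }
      ; from    = unflatten
      ; from-to = λ w → lookup-ext λ i → lookup-ext λ a → trans (lookup-unflatten (flatten w) i a) (lookup-flatten w i a)
      ; to-from = λ v → combine-ext λ i a → trans (lookup-flatten (unflatten v) i a) (lookup-unflatten v i a)
      }

-- Irreducible characteristic polynomials and cyclic modules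

iso-refl : ∀ {k} {M : Module k} → Iso M M
iso-refl = record
  { hom = record { linear = record { to = id ; to-⊕ = λ _ _ → refl ; to-• = λ _ _ → refl } ; to-T = λ _ → refl }
  ; from = id ; from-to = λ _ → refl ; to-from = λ _ → refl }

module CharacteristicPolynomial (F : Field) {q} (finite-F : Finite (Field.Carrier F) q) where
  open Field F
  open RowVectors F
  open OverField F using (charPoly)
  open Poly rawRing using (Irreducible)
  open DeterminantDegree F using (charPoly-monic)

  module _ {N : ℕ} (A : Matrix Carrier N) (0<N : 0 < N) {M : Module F} (I : Iso M (rows A)) where

    charPoly-irreducible⇒simple : Irreducible (charPoly A) → Action.Simple M
    charPoly-irreducible⇒simple irr = Iso.iso-simple (iso-sym I)
      (Simplicity.irreducible⇒simple (rows A) finite-F (finite-Vec finite-F N) (charPoly-monic A) (cayley-hamilton A) irr)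

    simple⇒charPoly-irreducible : Action.Simple M → Irreducible (charPoly A)
    simple⇒charPoly-irreducible simple = go 0<N A (charPoly-monic A) (cayley-hamilton A) (Iso.iso-simple I simple)
      where
      -- N and f are generalised so that N can be matched as a successor, which the criterion
      -- requires; the all-ones vector then serves as the nonzero vector.
      go : ∀ {N} → 0 < N → (A : Matrix Carrier N) → ∀ {f} → Polynomials.Monic F N f →
        (∀ w → Action.act (rows A) f w ≡ Vec.replicate N 0#) → Action.Simple (rows A) → Irreducible f
      go {suc N} _ A f-monic f-kills = Simplicity.simple⇒irreducible (rows A) finite-F (finite-Vec finite-F (suc N)) f-monic f-kills
        {v = Vec.replicate (suc N) 1#} (λ e → 0≢1 (sym (cong Vec.head e)))

-- This replaces objects that are given up to `≈` or only with existing data, such as polynomials in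
-- S and TSR matrices, by unique parameters under `_≡_`.
enum-pull : ∀ {A B : Set} {_≈_ : B → B → Set} → IsEquivalence _≈_ → ∀ {P : A → Set} {Q : B → Set} {k} → Enum _≈_ Q k →
  (f : A → B) → (∀ x → P x → Q (f x)) → (∀ {x y} → P x → P y → f x ≈ f y → x ≡ y) →
  (∀ y → Q y → ∃[ x ] P x × f x ≈ y) → Enum _≡_ P k
enum-pull {A} {_≈_ = _≈_} eq {P} E f f-Q f-inj f-surj = record
  { elem     = pre
  ; elem-P   = λ i → proj₁ (proj₂ (f-surj _ (E.elem-P i)))
  ; elem-inj = λ i j e → E.elem-inj i j (≈.trans (≈.sym (f-pre i)) (subst (λ x → f x ≈ E.elem j) (sym e) (f-pre j)))
  ; index    = λ x p → E.index (f x) (f-Q x p)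
  ; index-≈  = λ x p → f-inj p (proj₁ (proj₂ (f-surj _ (E.elem-P _)))) (≈.trans (E.index-≈ (f x) (f-Q x p)) (≈.sym (f-pre _)))
  }
  where
  module E = Enum E
  module ≈ = IsEquivalence eq
  pre : _ → A
  pre i = proj₁ (f-surj (E.elem i) (E.elem-P i))
  f-pre : ∀ i → f (pre i) ≈ E.elem i
  f-pre i = proj₂ (proj₂ (f-surj (E.elem i) (E.elem-P i)))

module CyclicIso {k : Field} {q d} (finite-k : Finite (Field.Carrier k) q) {h : Poly.Pol (Field.rawRing k)}
                 (irr : Poly.Irreducible (Field.rawRing k) h) (h-monic : Polynomials.Monic k (suc d) h) where
  open Field k
  open Poly rawRing
  open Polynomials k
  open VecPolynomials k

  -- The polynomials p and r agree at v exactly when h divides p - r: the remainder of p - r modulo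
  -- h acts like p - r on both vectors, and a remainder that kills v is zero.
  transfer : (M N : Module k) → ∀ {v w} → v ≢ Module.𝟘 M → Action.act M h v ≡ Module.𝟘 M → Action.act N h w ≡ Module.𝟘 N →
    ∀ p r → Action.act M p v ≡ Action.act M r v → Action.act N p w ≡ Action.act N r w
  transfer M N {v} {w} v≢𝟘 hv≡𝟘 hw≡𝟘 p r e with divide h-monic (p +ₚ -ₚ r)
  ... | s , t , p-r≈ , t< = N.v⊖w≡𝟘⇒v≡w _ _ (trans (sym (AN.act-difference p r w)) (trans (remainder N hw≡𝟘)
      (AN.act-≈0 t w (Simplicity.irreducible⇒faithful M finite-k irr h-monic v≢𝟘 hv≡𝟘 t t<
        (trans (sym (remainder M hv≡𝟘)) (trans (AM.act-difference p r v) (M.v≡w⇒v⊖w≡𝟘 e)))))))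
    where
    module M = Module M
    module N = Module N
    module AM = Action M
    module AN = Action N
    remainder : ∀ (L : Module k) {x} → Action.act L h x ≡ Module.𝟘 L → Action.act L (p +ₚ -ₚ r) x ≡ Action.act L t x
    remainder L {x} hx≡𝟘 = begin
      act (p +ₚ -ₚ r) x  ≡⟨ act-≈ (p +ₚ -ₚ r) (h *ₚ s +ₚ t) x p-r≈ ⟩
      act (h *ₚ s +ₚ t) x  ≡⟨ act-+ₚ (h *ₚ s) t x ⟩
      act (h *ₚ s) x ⊕ act t x  ≡⟨ cong (_⊕ act t x) (trans (act-*ₚ h s x) (trans (act-comm h s x) (trans (cong (act s) hx≡𝟘) (act-𝟘 s)))) ⟩
      𝟘 ⊕ act t x  ≡⟨ ⊕-identityˡ _ ⟩
      act t x  ∎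
      where
      open Module L
      open Action L
      open ≡-Reasoning

  module _ (M N : Module k) (finite-M : Finite (Module.V M) (q ^ suc d)) (finite-N : Finite (Module.V N) (q ^ suc d))
           {v : Module.V M} {w : Module.V N} (v≢𝟘 : v ≢ Module.𝟘 M) (w≢𝟘 : w ≢ Module.𝟘 N)
           (hv≡𝟘 : Action.act M h v ≡ Module.𝟘 M) (hw≡𝟘 : Action.act N h w ≡ Module.𝟘 N) where
    private
      module M = Module M
      module N = Module N
      module AM = Action M
      module AN = Action N

      coordM : ∀ x → ∃[ p ] AM.act p v ≡ x
      coordM x = let a , e = Simplicity.faithful⇒cyclic M finite-k finite-M (Simplicity.irreducible⇒faithful M finite-k irr h-monic v≢𝟘 hv≡𝟘) x
                 in poly a , e

      coordN : ∀ y → ∃[ p ] AN.act p w ≡ y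
      coordN y = let a , e = Simplicity.faithful⇒cyclic N finite-k finite-N (Simplicity.irreducible⇒faithful N finite-k irr h-monic w≢𝟘 hw≡𝟘) y
                 in poly a , e

      to : M.V → N.V
      to x = AN.act (proj₁ (coordM x)) w

      from : N.V → M.V
      from y = AM.act (proj₁ (coordN y)) v

    cyclic-to : ∀ p → to (AM.act p v) ≡ AN.act p w
    cyclic-to p = transfer M N v≢𝟘 hv≡𝟘 hw≡𝟘 (proj₁ (coordM (AM.act p v))) p (proj₂ (coordM (AM.act p v)))

    private
      cyclic-from : ∀ p → from (AN.act p w) ≡ AM.act p v
      cyclic-from p = transfer N M w≢𝟘 hw≡𝟘 hv≡𝟘 (proj₁ (coordN (AN.act p w))) p (proj₂ (coordN (AN.act p w)))

      by-coord : ∀ {p x y} → AM.act p v ≡ x → AN.act p w ≡ y → to x ≡ y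
      by-coord {p} refl refl = cyclic-to p

    -- Both modules are k[X]/(h), with v and w in the place of the class of 1.
    cyclic-iso : Iso M N
    cyclic-iso = record
      { hom = record
        { linear = record
          { to   = to
          ; to-⊕ = λ x y → let p , p≡ = coordM x
                               r , r≡ = coordM y
                           in by-coord {p +ₚ r} (trans (AM.act-+ₚ p r v) (cong₂ M._⊕_ p≡ r≡)) (AN.act-+ₚ p r w)
          ; to-• = λ a x → let p , p≡ = coordM x
                           in by-coord {a ·ₚ p} (trans (AM.act-·ₚ a p v) (cong (a M.•_) p≡)) (AN.act-·ₚ a p w)
          }
        ; to-T = λ x → let p , p≡ = coordM x
                       in by-coord {0# ∷ p} (trans (AM.act-shift p v) (cong M.T p≡)) (AN.act-shift p w)
        }
      ; from    = from
      ; from-to = λ x → trans (cyclic-from (proj₁ (coordM x))) (proj₂ (coordM x))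
      ; to-from = λ y → trans (cyclic-to (proj₁ (coordN y))) (proj₂ (coordN y))
      }

module _ {k : Field} (M : Module k) where
  open Field k
  open RowVectors k
  open VecPolynomials k
  open Module M
  open Action M
  open PolynomialSums M

  eval-linear : ∀ n → V → Linear (space n) M
  eval-linear n v = record { to = λ a → act (poly a) v ; to-⊕ = eval-⊞ ; to-• = eval-▪ }
    where
    eval-⊞ : ∀ {n} (a b : Vec Carrier n) → act (poly (a ⊞ b)) v ≡ act (poly a) v ⊕ act (poly b) v
    eval-⊞ []      []      = sym (⊕-identityˡ 𝟘)
    eval-⊞ (x ∷ a) (y ∷ b) = trans (cong₂ _⊕_ (•-distribʳ x y v) (trans (cong T (eval-⊞ a b)) (T-⊕ _ _))) (⊕-interchange _ _ _ _)
    eval-▪ : ∀ {n} x (a : Vec Carrier n) → act (poly (x ▪ a)) v ≡ x • act (poly a) v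
    eval-▪ x []      = sym (•-zeroʳ x)
    eval-▪ x (y ∷ a) = trans (cong₂ _⊕_ (•-assoc x y v) (trans (cong T (eval-▪ x a)) (T-• x _))) (sym (•-distribˡ x _ _))

  eval-basis : ∀ {n} (i : Fin n) v → act (poly (basis i)) v ≡ iterate T (toℕ i) v
  eval-basis {n} i v = trans (act-poly (basis i) v) (trans
    (sum-cong-≗ {n} (λ j → cong (_• iterate T (toℕ j) v) (Vec.lookup∘tabulate (δ i) j))) (select i (λ j → iterate T (toℕ j) v)))
    where
    open Det rawRing using (δ)
    select : ∀ {n} (i : Fin n) (f : Fin n → V) → sum (λ j → δ i j • f j) ≡ f i
    select {suc n} Fin.zero    f = trans (cong₂ _⊕_ (•-identity _)
      (trans (sum-cong-≗ {n} (λ j → •-zeroˡ _)) (sum-replicate-zero n))) (⊕-identityʳ _)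
    select {suc n} (Fin.suc i) f = trans (cong₂ _⊕_ (•-zeroˡ _)
      (trans (sum-cong-≗ {n} (λ j → cong (_• f (Fin.suc j)) (DeterminantDegree.δ-suc k i j))) (select i (f ∘ Fin.suc)))) (⊕-identityˡ _)

module Orbits (F : Field) where
  open Field F
  open RowVectors F
  open VecPolynomials F

  -- In the correspondence this is the matrix of the isomorphism K → F^m, p(λ) ↦ u p(B), with
  -- respect to the basis 1, λ, ..., λ^(m-1) of K.
  orbit : ∀ {m} → Matrix Carrier m → Vec Carrier m → Matrix Carrier m
  orbit B u = tabulate λ i → iterate (_⋄ B) (toℕ i) u

  ⋄-orbit : ∀ {m} (B : Matrix Carrier m) u a → a ⋄ orbit B u ≡ Action.act (rows B) (poly a) u
  ⋄-orbit {m} B u a = linear-ext (⋄-linear (orbit B u)) eval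
    (λ i → trans (basis-⋄ (orbit B u) i) (trans (Vec.lookup∘tabulate _ i) (sym (eval-basis (rows B) i u)))) a
    where
    module E = Linear (eval-linear (rows B) m u)
    eval : Linear (space m) (space m)
    eval = record { to = E.to ; to-⊕ = E.to-⊕ ; to-• = E.to-• }

-- The correspondence

module Counting {F K : Field} (E : Extension F K) (q m′ n′ : ℕ) (finite-F : Finite (Field.Carrier F) q)
                (finite-K : Finite (Field.Carrier K) (q ^ suc m′)) (1<mn : 1 < suc m′ ℕ.* suc n′) where
  open Extension E
  open Restriction E
  open Generators E {q} {m′} finite-F finite-K
  private
    module F  = Field F
    module K  = Field K
    module FP = FieldProperties F
    module KP = FieldProperties K
    module PF = Poly F.rawRing
    module PK = Poly K.rawRing
    module PolK = Polynomials K
    module VF = VecPolynomials F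
    module CP = CharacteristicPolynomial F finite-F
    m = suc m′
    n = suc n′
  open RowVectors F using (_⋄_; rows; _▪_; ⋄-▪; lookup-⋄)
  open BlockCompanion F m n′ using (tsr; tsr-iso; entry-tsr; tsr-unique; tsrEntry-last)
  open OverField F using (charPoly; IsTSRI; tsrEntry)
  open Orbits F
  module Twisted (λ₀ : K.Carrier) (γ : Vec F.Carrier n′) = TwistedPolynomial E {q} {m′} finite-F finite-K {n′} λ₀ γ
  open ≡-Reasoning

  𝟎 : Vec F.Carrier m
  𝟎 = Vec.replicate m F.0#

  finite-vectors : Finite (Vec F.Carrier m) (q ^ m)
  finite-vectors = finite-Vec finite-F m

  module IrreducibleTSR (c : Vec F.Carrier n) (B : Matrix F.Carrier m) (irr : PF.Irreducible (charPoly (tsr c B))) where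
    open Shift (rows B) (lookup c) using (shift; initial)

    tsr-simple : Action.Simple shift
    tsr-simple = CP.charPoly-irreducible⇒simple (tsr c B) (s≤s z≤n) (tsr-iso c B) irr

    block-simple : Action.Simple (rows B)
    block-simple = Shift.shift-simple (rows B) (lookup c) tsr-simple

    block-irreducible : PF.Irreducible (charPoly B)
    block-irreducible = CP.simple⇒charPoly-irreducible B (s≤s z≤n) iso-refl block-simple

    -- Otherwise the shift would kill the nonzero state (u, 0, ..., 0).
    constant-block≢0 : ∀ u → u ≢ 𝟎 → (lookup c Fin.zero ▪ u) ⋄ B ≢ 𝟎
    constant-block≢0 u u≢𝟎 e = PolynomialSums.simple-kernel shift finite-F
      (subst (Finite _) (ℕ.^-*-assoc q m n) (finite-Vec finite-vectors n)) 1<mn tsr-simple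
      (initial u) (λ e → u≢𝟎 (cong Vec.head e)) (ShiftInitial.step-initial (rows B) (lookup c) u e)

  IsL : Matrix F.Carrier m × Vec F.Carrier n′ → Set
  IsL (B , γ) = PF.Irreducible (charPoly (tsr (F.1# ∷ γ) B))

  ones : Vec F.Carrier m
  ones = Vec.replicate m F.1#

  ones≢𝟎 : ones ≢ 𝟎
  ones≢𝟎 e = F.0≢1 (sym (cong Vec.head e))

  ⋄-zero : ∀ (B : Matrix F.Carrier m) → (∀ a b → entry B a b ≡ F.0#) → ∀ u → u ⋄ B ≡ 𝟎
  ⋄-zero B h u = trans (cong (u ⋄_) B≡) (lookup-ext λ j → trans (lookup-⋄ u zeros j) (trans
    (sum-cong-≗ {m} (λ i → trans (cong (lookup u i F.*_) (zeros-entry i j)) (FP.zeroʳ _)))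
    (trans (sum-replicate-zero m) (sym (Vec.lookup-replicate j F.0#)))))
    where
    open import Algebra.Properties.Semiring.Sum FP.semiring using (sum-cong-≗; sum-replicate-zero)
    zeros : Matrix F.Carrier m
    zeros = Vec.replicate m 𝟎
    zeros-entry : ∀ i j → entry zeros i j ≡ F.0#
    zeros-entry i j = trans (cong (λ r → lookup r j) (Vec.lookup-replicate i 𝟎)) (Vec.lookup-replicate j F.0#)
    B≡ : B ≡ zeros
    B≡ = lookup-ext λ i → lookup-ext λ j → trans (h i j) (sym (zeros-entry i j))

  L-entry≢0 : ∀ B γ → IsL (B , γ) → ¬ (∀ a b → entry B a b ≡ F.0#)
  L-entry≢0 B γ irr h = IrreducibleTSR.constant-block≢0 (F.1# ∷ γ) B irr ones ones≢𝟎 (⋄-zero B h (F.1# ▪ ones))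

  -- Data (c, B) and (x⁻¹c, xB) give the same matrix for every nonzero x. Irreducibility forces c₀ ≠
  -- 0, and taking x = c₀ selects the representative whose first coefficient is 1.
  enum-L : ∀ {t} → IsCard _≡_ (IsTSRI m n) t → Enum _≡_ IsL t
  enum-L card = enum-pull isEquivalence (enum isEquivalence card) (λ (B , γ) → tsr (F.1# ∷ γ) B)
    (λ (B , γ) irr → (F.1# ∷ γ , B , entry-tsr (F.1# ∷ γ) B) , irr) injective surjective
    where
    last-entry : ∀ {c c′ B B′} → tsr c B ≡ tsr c′ B′ → ∀ i a b → lookup c i F.* entry B a b ≡ lookup c′ i F.* entry B′ a b
    last-entry {c} {c′} {B} {B′} e i a b = begin
      lookup c i F.* entry B a b  ≡⟨ tsrEntry-last c B i a b ⟨
      tsrEntry c B i (fromℕ n′) a b  ≡⟨ entry-tsr c B i (fromℕ n′) a b ⟨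
      entry (tsr c B) (combine i a) (combine (fromℕ n′) b)  ≡⟨ cong (λ T → entry T (combine i a) (combine (fromℕ n′) b)) e ⟩
      entry (tsr c′ B′) (combine i a) (combine (fromℕ n′) b)  ≡⟨ entry-tsr c′ B′ i (fromℕ n′) a b ⟩
      tsrEntry c′ B′ i (fromℕ n′) a b  ≡⟨ tsrEntry-last c′ B′ i a b ⟩
      lookup c′ i F.* entry B′ a b  ∎
    injective : ∀ {x y} → IsL x → IsL y → tsr (F.1# ∷ proj₂ x) (proj₁ x) ≡ tsr (F.1# ∷ proj₂ y) (proj₁ y) → x ≡ y
    injective {B , γ} {B′ , γ′} irr irr′ e = cong₂ _,_ B≡ (lookup-ext γ≡)
      where
      entries : ∀ i a b → lookup (F.1# ∷ γ) i F.* entry B a b ≡ lookup (F.1# ∷ γ′) i F.* entry B′ a b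
      entries = last-entry {F.1# ∷ γ} {F.1# ∷ γ′} {B} {B′} e
      B-entry : ∀ a b → entry B a b ≡ entry B′ a b
      B-entry a b = trans (sym (FP.*-identityˡ _)) (trans (entries Fin.zero a b) (FP.*-identityˡ _))
      B≡ : B ≡ B′
      B≡ = lookup-ext λ a → lookup-ext λ b → B-entry a b
      γ≡ : ∀ i → lookup γ i ≡ lookup γ′ i
      -- The first block already gives B = B′. Block i + 1 then says (γ_i - γ′_i) B = 0, and B is
      -- not zero.
      γ≡ i with finite-≟ finite-F (lookup γ i F.+ F.- lookup γ′ i) F.0#
      ... | yes e = FP.x-y≡0⇒x≡y e
      ... | no ¬e = contradiction (λ a b → FP.*-cancel-0 ¬e (begin
        (lookup γ i F.+ F.- lookup γ′ i) F.* entry B a b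
          ≡⟨ FP.distribʳ (entry B a b) (lookup γ i) (F.- lookup γ′ i) ⟩
        lookup γ i F.* entry B a b F.+ (F.- lookup γ′ i) F.* entry B a b
          ≡⟨ cong₂ F._+_ (trans (entries (Fin.suc i) a b) (cong (lookup γ′ i F.*_) (sym (B-entry a b)))) (sym (FP.-‿distribˡ-* _ _)) ⟩
        lookup γ′ i F.* entry B a b F.+ F.- (lookup γ′ i F.* entry B a b)
          ≡⟨ FP.-‿inverseʳ _ ⟩
        F.0#
          ∎)) (L-entry≢0 B γ irr)
    surjective : ∀ T → IsTSRI m n T → ∃[ x ] IsL x × tsr (F.1# ∷ proj₂ x) (proj₁ x) ≡ T
    surjective T ((c₀ ∷ c , B , T-entry) , irr) with finite-≟ finite-F c₀ F.0#
    -- With c₀ = 0 the first block c₀B would vanish, and the shift would have a kernel.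
    ... | yes refl = contradiction
      (trans (⋄-▪ B F.0# ones) (Action.•-zeroˡ (rows B) (ones ⋄ B)))
      (IrreducibleTSR.constant-block≢0 (F.0# ∷ c) B (subst (PF.Irreducible ∘ charPoly) (sym (tsr-unique (F.0# ∷ c) B T T-entry)) irr) ones ones≢𝟎)
    ... | no c₀≢0 = (B′ , γ) , subst (PF.Irreducible ∘ charPoly) (sym T≡) irr , T≡
      where
      y : F.Carrier
      y = proj₁ (F.inverse c₀ c₀≢0)
      c₀y≡1 : c₀ F.* y ≡ F.1#
      c₀y≡1 = proj₂ (F.inverse c₀ c₀≢0)
      γ : Vec F.Carrier n′
      γ = Vec.map (F._* y) c
      B′ : Matrix F.Carrier m
      B′ = Vec.map (Vec.map (c₀ F.*_)) B
      entry-B′ : ∀ a b → entry B′ a b ≡ c₀ F.* entry B a b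
      entry-B′ a b = trans (cong (λ r → lookup r b) (Vec.lookup-map a (Vec.map (c₀ F.*_)) B)) (Vec.lookup-map b (c₀ F.*_) (lookup B a))
      scaled : ∀ i a b → lookup (F.1# ∷ γ) i F.* entry B′ a b ≡ lookup (c₀ ∷ c) i F.* entry B a b
      scaled Fin.zero    a b = trans (FP.*-identityˡ _) (entry-B′ a b)
      scaled (Fin.suc i) a b = begin
        lookup γ i F.* entry B′ a b  ≡⟨ cong₂ F._*_ (Vec.lookup-map i (F._* y) c) (entry-B′ a b) ⟩
        lookup c i F.* y F.* (c₀ F.* entry B a b)  ≡⟨ FP.*-assoc _ _ _ ⟩
        lookup c i F.* (y F.* (c₀ F.* entry B a b))  ≡⟨ cong (lookup c i F.*_) (FP.*-assoc _ _ _) ⟨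
        lookup c i F.* (y F.* c₀ F.* entry B a b)  ≡⟨ cong (λ z → lookup c i F.* (z F.* entry B a b)) (trans (FP.*-comm y c₀) c₀y≡1) ⟩
        lookup c i F.* (F.1# F.* entry B a b)  ≡⟨ cong (lookup c i F.*_) (FP.*-identityˡ _) ⟩
        lookup c i F.* entry B a b  ∎
      same : ∀ i j a b → tsrEntry (F.1# ∷ γ) B′ i j a b ≡ tsrEntry (c₀ ∷ c) B i j a b
      same i j a b = cong (λ z → if ⌊ toℕ j ℕ.≟ n ℕ.∸ 1 ⌋ then z else
        (if ⌊ toℕ i ℕ.≟ suc (toℕ j) ⌋ then Det.δ F.rawRing a b else F.0#)) (scaled i a b)
      T≡ : tsr (F.1# ∷ γ) B′ ≡ T
      T≡ = tsr-unique (F.1# ∷ γ) B′ T λ i j a b → trans (T-entry i j a b) (sym (same i j a b))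

  IsR : K.Carrier × Vec F.Carrier n′ → Set
  IsR (λ₀ , γ) = PK.Irreducible (Twisted.twisted λ₀ γ) × Generates E λ₀

  -- Below degree n the coefficients of X^n - λ g are -λ g_i. As g_0 = 1, the constant term reveals
  -- λ; as λ ≠ 0 and ι is injective, the others then reveal g.
  enum-R : ∀ {s} → IsCard PK._≈ₚ_ (InS E n) s → Enum _≡_ IsR s
  enum-R card = enum-pull ≈ₚ-isEquivalence (enum ≈ₚ-isEquivalence card) (λ (λ₀ , γ) → Twisted.twisted λ₀ γ)
    (λ (λ₀ , γ) (irr , generates) → irr , λ₀ , Twisted.g λ₀ γ , generates , refl ,
      (λ i n′<i → VF.poly-deg< (F.1# ∷ γ) i n′<i) , λ i → refl)
    injective surjective
    where
    ≈ₚ-isEquivalence : IsEquivalence PK._≈ₚ_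
    ≈ₚ-isEquivalence = record { refl = λ _ → refl ; sym = λ e i → sym (e i) ; trans = λ e e′ i → trans (e i) (e′ i) }
    coeff-low : ∀ λ₀ γ (i : Fin n) → PK.coeff (Twisted.twisted λ₀ γ) (toℕ i) ≡ K.- (λ₀ K.* ι (lookup (F.1# ∷ γ) i))
    coeff-low λ₀ γ i = begin
      PK.coeff (PK.Xpow n PK.+ₚ PK.-ₚ (λ₀ PK.·ₚ map ι g)) (toℕ i)
        ≡⟨ PolK.coeff-+ (PK.Xpow n) (PK.-ₚ (λ₀ PK.·ₚ map ι g)) (toℕ i) ⟩
      PK.coeff (PK.Xpow n) (toℕ i) K.+ PK.coeff (PK.-ₚ (λ₀ PK.·ₚ map ι g)) (toℕ i)
        ≡⟨ cong₂ K._+_ (Xpow-low n (toℕ i) (Fin.toℕ<n i)) (trans (PolK.coeff-neg (λ₀ PK.·ₚ map ι g) (toℕ i))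
             (cong K.-_ (trans (PolK.coeff-· λ₀ (map ι g) (toℕ i)) (cong (λ₀ K.*_)
               (trans (coeff-map g (toℕ i)) (cong ι (VF.coeff-poly (F.1# ∷ γ) i))))))) ⟩
      K.0# K.+ K.- (λ₀ K.* ι (lookup (F.1# ∷ γ) i))
        ≡⟨ KP.+-identityˡ _ ⟩
      K.- (λ₀ K.* ι (lookup (F.1# ∷ γ) i))
        ∎
      where
      g = Twisted.g λ₀ γ
      Xpow-low : ∀ n i → i < n → PK.coeff (PK.Xpow n) i ≡ K.0#
      Xpow-low (suc n) zero    _         = refl
      Xpow-low (suc n) (suc i) (s≤s i<n) = Xpow-low n i i<n
    ι-injective : ∀ {a b} → ι a ≡ ι b → a ≡ b
    ι-injective {a} {b} e with finite-≟ finite-F (a F.+ F.- b) F.0#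
    ... | yes d = FP.x-y≡0⇒x≡y d
    ... | no ¬d = contradiction (begin
      K.0#  ≡⟨ KP.zeroˡ _ ⟨
      K.0# K.* ι y  ≡⟨ cong (K._* ι y) ιd≡0 ⟨
      ι (a F.+ F.- b) K.* ι y  ≡⟨ ι-* _ _ ⟨
      ι ((a F.+ F.- b) F.* y)  ≡⟨ cong ι (proj₂ (F.inverse _ ¬d)) ⟩
      ι F.1#  ≡⟨ ι-1 ⟩
      K.1#  ∎) K.0≢1
      where
      y = proj₁ (F.inverse _ ¬d)
      ιd≡0 : ι (a F.+ F.- b) ≡ K.0#
      ιd≡0 = begin
        ι (a F.+ F.- b)  ≡⟨ ι-+ a (F.- b) ⟩
        ι a K.+ ι (F.- b)  ≡⟨ cong (K._+ ι (F.- b)) e ⟩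
        ι b K.+ ι (F.- b)  ≡⟨ ι-+ b (F.- b) ⟨
        ι (b F.+ F.- b)  ≡⟨ cong ι (FP.-‿inverseʳ b) ⟩
        ι F.0#  ≡⟨ ι-0 ⟩
        K.0#  ∎
    K-cancel : ∀ {x y z} → x ≢ K.0# → x K.* y ≡ x K.* z → y ≡ z
    K-cancel {x} {y} {z} x≢0 e = KP.x-y≡0⇒x≡y (KP.*-cancel-0 x≢0 (trans (KP.distribˡ x y (K.- z))
      (trans (cong₂ K._+_ e (sym (KP.-‿distribʳ-* x z))) (KP.-‿inverseʳ _))))
    injective : ∀ {x y} → IsR x → IsR y → Twisted.twisted (proj₁ x) (proj₂ x) PK.≈ₚ Twisted.twisted (proj₁ y) (proj₂ y) → x ≡ y
    injective {λ₀ , γ} {λ₁ , γ′} (irr , generates) _ e = cong₂ _,_ λ≡ (lookup-ext γ≡)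
      where
      products : ∀ i → λ₀ K.* ι (lookup (F.1# ∷ γ) i) ≡ λ₁ K.* ι (lookup (F.1# ∷ γ′) i)
      products i = trans (sym (KP.-‿involutive _)) (trans (cong K.-_ (trans (sym (coeff-low λ₀ γ i))
        (trans (e (toℕ i)) (coeff-low λ₁ γ′ i)))) (KP.-‿involutive _))
      times-one : ∀ x → x K.* ι F.1# ≡ x
      times-one x = trans (cong (x K.*_) ι-1) (KP.*-identityʳ x)
      λ≡ : λ₀ ≡ λ₁
      λ≡ = trans (sym (times-one λ₀)) (trans (products Fin.zero) (times-one λ₁))
      γ≡ : ∀ i → lookup γ i ≡ lookup γ′ i
      γ≡ i = ι-injective (K-cancel (Twisted.λ≢0 λ₀ γ irr generates 1<mn)
        (trans (products (Fin.suc i)) (cong (K._* ι (lookup γ′ i)) (sym λ≡))))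
    surjective : ∀ f → InS E n f → ∃[ x ] IsR x × Twisted.twisted (proj₁ x) (proj₂ x) PK.≈ₚ f
    surjective f (irr , λ₀ , g , generates , g₀≡1 , g-deg , f≈) =
      (λ₀ , γ) , (PolK.irreducible-cong f (Twisted.twisted λ₀ γ) (λ i → sym (twisted≈f i)) irr , generates) , twisted≈f
      where
      γ : Vec F.Carrier n′
      γ = Vec.tail (VF.coeffs n g)
      coeffs≡ : F.1# ∷ γ ≡ VF.coeffs n g
      coeffs≡ = trans (cong (_∷ γ) (sym (trans (head-coeffs g) g₀≡1))) (η (VF.coeffs n g))
        where
        head-coeffs : ∀ g → Vec.head (VF.coeffs n g) ≡ PF.coeff g 0
        head-coeffs []      = refl
        head-coeffs (a ∷ g) = refl
        η : ∀ {n} (v : Vec F.Carrier (suc n)) → Vec.head v ∷ Vec.tail v ≡ v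
        η (x ∷ v) = refl
      g≈ : VF.poly (F.1# ∷ γ) PF.≈ₚ g
      g≈ i = trans (cong (λ v → PF.coeff (VF.poly v) i) coeffs≡) (VF.poly-coeffs n g (λ i n≤i → g-deg i n≤i) i)
      twisted≈f : Twisted.twisted λ₀ γ PK.≈ₚ f
      twisted≈f i = trans
        (PolK.+ₚ-cong (PK.Xpow n) (PK.Xpow n) (PK.-ₚ (λ₀ PK.·ₚ map ι (VF.poly (F.1# ∷ γ)))) (PK.-ₚ (λ₀ PK.·ₚ map ι g)) (λ _ → refl)
          (PolK.-ₚ-cong (λ₀ PK.·ₚ map ι (VF.poly (F.1# ∷ γ))) (λ₀ PK.·ₚ map ι g) λ i → trans
            (PolK.coeff-· λ₀ (map ι (VF.poly (F.1# ∷ γ))) i) (trans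
              (cong (λ₀ K.*_) (trans (coeff-map (VF.poly (F.1# ∷ γ)) i) (trans (cong ι (g≈ i)) (sym (coeff-map g i)))))
              (sym (PolK.coeff-· λ₀ (map ι g) i)))) i)
        (sym (f≈ i))

-- The bijection between triples and pairs

module Correspondence {F K : Field} (E : Extension F K) (q m′ n′ : ℕ) (finite-F : Finite (Field.Carrier F) q)
                      (finite-K : Finite (Field.Carrier K) (q ^ suc m′)) (1<mn : 1 < suc m′ ℕ.* suc n′) where
  open Extension E
  open Restriction E
  open Generators E {q} {m′} finite-F finite-K
  open Counting E q m′ n′ finite-F finite-K 1<mn
  private
    module F  = Field F
    module K  = Field K
    m = suc m′
    n = suc n′
  open RowVectors F using (_⋄_; rows; space; basis; matrix; ⋄-matrix; ⋄-linear; ⋄-inverseʳ; ⋄-inverseˡ;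
    basis-⋄; matrix-ext; cayley-hamilton; bijective⇒invertible)
  open BlockCompanion F m n′ using (tsr; tsr-iso)
  open DeterminantDegree F using (charPoly-monic)
  open OverField F using (charPoly; IsTSRI; IsInvertible)
  open Orbits F
  open VecPolynomials F using (poly)
  open ≡-Reasoning

  1≢0 : K.1# ≢ K.0#
  1≢0 e = K.0≢1 (sym e)

  module FromMatrix (B : Matrix F.Carrier m) (γ : Vec F.Carrier n′) (λ₀ : K.Carrier) (u : Vec F.Carrier m)
                    (irr : IsL (B , γ)) (root : root-value λ₀ (charPoly B) ≡ K.0#) (u≢𝟎 : u ≢ 𝟎) where
    private
      module T = IrreducibleTSR (F.1# ∷ γ) B irr
      module C = CyclicIso finite-F {charPoly B} T.block-irreducible (charPoly-monic B)
      module S = Simplicity (rows B) finite-F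

    φ : Iso (adjoin λ₀) (rows B)
    φ = C.cyclic-iso (adjoin λ₀) (rows B) finite-K finite-vectors 1≢0 u≢𝟎 root (cayley-hamilton B u)

    φ-eval : ∀ a → Iso.to φ (root-value λ₀ (poly a)) ≡ a ⋄ orbit B u
    φ-eval a = trans (C.cyclic-to (adjoin λ₀) (rows B) finite-K finite-vectors 1≢0 u≢𝟎 root (cayley-hamilton B u) (poly a))
      (sym (⋄-orbit B u a))

    generates : Generates E λ₀
    generates = root-generates λ₀ T.block-irreducible (charPoly-monic B) root

    twisted-irreducible : Poly.Irreducible K.rawRing (Twisted.twisted λ₀ γ)
    twisted-irreducible = Twisted.simple⇒twisted-irreducible λ₀ γ
      (Iso.iso-simple (iso-sym (shift-iso (Vec.lookup (F.1# ∷ γ)) φ)) T.tsr-simple)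

    private
      faithful : S.Faithful m u
      faithful = S.irreducible⇒faithful T.block-irreducible (charPoly-monic B) u≢𝟎 (cayley-hamilton B u)
      coordinates : ∀ w → ∃[ a ] S.eval {m} u a ≡ w
      coordinates = S.faithful⇒cyclic finite-vectors faithful

    orbit-invertible : IsInvertible (orbit B u)
    orbit-invertible = bijective⇒invertible (orbit B u) (proj₁ ∘ coordinates)
      (λ w → S.eval-injective faithful (trans (proj₂ (coordinates (w ⋄ orbit B u))) (⋄-orbit B u w)))
      (λ w → trans (⋄-orbit B u (proj₁ (coordinates w))) (proj₂ (coordinates w)))

  -- The isomorphism φ sends the basis 1, λ, ..., λ^(m-1) of K to the rows of P, and B is
  -- multiplication by λ transported along φ. Then u, the image of 1, is the first row of P, and u
  -- B^i is the image of λ^i, which is row i.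
  module FromPolynomial (λ₀ : K.Carrier) (γ : Vec F.Carrier n′) (P : Matrix F.Carrier m)
                        (isR : IsR (λ₀ , γ)) (invertible : IsInvertible P) where
    private
      irr : Poly.Irreducible K.rawRing (Twisted.twisted λ₀ γ)
      irr = proj₁ isR
      generates : Generates E λ₀
      generates = proj₂ isR
      module S = Simplicity (adjoin λ₀) finite-F

      ψ : Linear (space m) (adjoin λ₀)
      ψ = eval-linear (adjoin λ₀) m K.1#
      coordinates : ∀ x → ∃[ a ] Linear.to ψ a ≡ x
      coordinates = S.faithful⇒cyclic finite-K (generates-faithful λ₀ generates)
      ψ⁻¹ : K.Carrier → Vec F.Carrier m
      ψ⁻¹ = proj₁ ∘ coordinates
      ψ⁻¹-ψ : ∀ a → ψ⁻¹ (Linear.to ψ a) ≡ a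
      ψ⁻¹-ψ a = S.eval-injective (generates-faithful λ₀ generates) (proj₂ (coordinates (Linear.to ψ a)))

      to-linear : Linear (adjoin λ₀) (space m)
      to-linear = linear-∘ (⋄-linear P) (linear-inverse ψ ψ⁻¹ ψ⁻¹-ψ (proj₂ ∘ coordinates))
      to : K.Carrier → Vec F.Carrier m
      to x = ψ⁻¹ x ⋄ P
      from : Vec F.Carrier m → K.Carrier
      from w = Linear.to ψ (w ⋄ proj₁ invertible)
      from-to : ∀ x → from (to x) ≡ x
      from-to x = trans (cong (Linear.to ψ) (⋄-inverseʳ {A = P} invertible (ψ⁻¹ x))) (proj₂ (coordinates x))
      to-from : ∀ w → to (from w) ≡ w
      to-from w = trans (cong (_⋄ P) (ψ⁻¹-ψ (w ⋄ proj₁ invertible))) (⋄-inverseˡ {A = P} invertible w)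

      conjugate : Linear (space m) (space m)
      conjugate = linear-∘ to-linear (linear-∘ (PolynomialSums.T-linear (adjoin λ₀)) (linear-inverse to-linear from from-to to-from))

    B : Matrix F.Carrier m
    B = matrix (Linear.to conjugate)

    φ : Iso (adjoin λ₀) (rows B)
    φ = record
      { hom = record
        { linear = record { to = to ; to-⊕ = Linear.to-⊕ to-linear ; to-• = Linear.to-• to-linear }
        ; to-T   = λ x → sym (trans (⋄-matrix conjugate (to x)) (cong (λ y → to (λ₀ K.* y)) (from-to x)))
        }
      ; from = from ; from-to = from-to ; to-from = to-from }

    u : Vec F.Carrier m
    u = Iso.to φ K.1#

    u≢𝟎 : u ≢ 𝟎
    u≢𝟎 e = 1≢0 (Iso.to-injective φ (trans e (sym (Iso.to-𝟘 φ))))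

    isL : IsL (B , γ)
    isL = CharacteristicPolynomial.simple⇒charPoly-irreducible F finite-F (tsr (F.1# ∷ γ) B) (s≤s z≤n)
      (tsr-iso (F.1# ∷ γ) B) (Iso.iso-simple (shift-iso (Vec.lookup (F.1# ∷ γ)) φ)
        (Twisted.twisted-irreducible⇒simple λ₀ γ irr generates))

    root : root-value λ₀ (charPoly B) ≡ K.0#
    root = Iso.to-injective φ (trans (Iso.to-act φ (charPoly B) K.1#) (trans (cayley-hamilton B u) (sym (Iso.to-𝟘 φ))))

    orbit≡P : orbit B u ≡ P
    orbit≡P = lookup-ext λ i → begin
      lookup (orbit B u) i  ≡⟨ Vec.lookup∘tabulate (λ i → iterate (_⋄ B) (toℕ i) u) i ⟩
      iterate (_⋄ B) (toℕ i) u  ≡⟨ to-iterate (toℕ i) ⟨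
      to (iterate (λ₀ K.*_) (toℕ i) K.1#)  ≡⟨ cong to (eval-basis (adjoin λ₀) i K.1#) ⟨
      ψ⁻¹ (Linear.to ψ (basis i)) ⋄ P  ≡⟨ cong (_⋄ P) (ψ⁻¹-ψ (basis i)) ⟩
      basis i ⋄ P  ≡⟨ basis-⋄ P i ⟩
      lookup P i  ∎
      where
      to-iterate : ∀ t → to (iterate (λ₀ K.*_) t K.1#) ≡ iterate (_⋄ B) t u
      to-iterate zero    = refl
      to-iterate (suc t) = trans (Iso.to-T φ (iterate (λ₀ K.*_) t K.1#)) (cong (_⋄ B) (to-iterate t))

  Left : ((Matrix F.Carrier m × Vec F.Carrier n′) × K.Carrier) × Vec F.Carrier m → Set
  Left (((B , γ) , λ₀) , u) = (IsL (B , γ) × root-value λ₀ (charPoly B) ≡ K.0#) × u ≢ 𝟎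

  Right : (K.Carrier × Vec F.Carrier n′) × Matrix F.Carrier m → Set
  Right (x , P) = IsR x × IsInvertible P

  enum-Left : ∀ {t} → IsCard _≡_ (IsTSRI m n) t → Enum _≡_ Left (t ℕ.* m ℕ.* (q ^ m ∸ 1))
  enum-Left card = enum-Σ (enum-Σ {Q = λ x λ₀ → root-value λ₀ (charPoly (proj₁ x)) ≡ K.0#} (enum-L card) roots)
      (λ _ _ → enum-remove finite-vectors 𝟎)
    where
    roots : ∀ x → IsL x → Enum _≡_ (λ λ₀ → root-value λ₀ (charPoly (proj₁ x)) ≡ K.0#) m
    roots (B , γ) irr = irreducible-roots finite-F finite-K {charPoly B} (rows B) finite-vectors ones≢𝟎
      (IrreducibleTSR.block-irreducible (F.1# ∷ γ) B irr) (charPoly-monic B) (cayley-hamilton B)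

  enum-Right : ∀ {s g} → IsCard (Poly._≈ₚ_ K.rawRing) (InS E n) s → IsCard _≡_ (IsInvertible {m}) g → Enum _≡_ Right (s ℕ.* g)
  enum-Right S-card GL-card = enum-× (enum-R S-card) (enum isEquivalence GL-card)

  to-right : ∀ x → Left x → (K.Carrier × Vec F.Carrier n′) × Matrix F.Carrier m
  to-right (((B , γ) , λ₀) , u) _ = (λ₀ , γ) , orbit B u

  to-right-Right : ∀ x p → Right (to-right x p)
  to-right-Right (((B , γ) , λ₀) , u) ((irr , root) , u≢𝟎) = (twisted-irreducible , generates) , orbit-invertible
    where open FromMatrix B γ λ₀ u irr root u≢𝟎

  -- The orbit matrix contains u as its first row. Together with λ it determines φ, which takes p(λ)
  -- to the combination of the rows with the coefficients of p, and B is multiplication by λ seen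
  -- through φ.
  to-right-injective : ∀ {x y} p p′ → to-right x p ≡ to-right y p′ → x ≡ y
  to-right-injective {((B , γ) , λ₀) , u} {((B′ , γ′) , λ₁) , u′} ((irr , root) , u≢𝟎) ((irr′ , root′) , u′≢𝟎) e =
    same (,-injectiveˡ (,-injectiveˡ e)) (,-injectiveʳ (,-injectiveˡ e)) (,-injectiveʳ e) root′
    where
    same : λ₀ ≡ λ₁ → γ ≡ γ′ → orbit B u ≡ orbit B′ u′ → root-value λ₁ (charPoly B′) ≡ K.0# →
      (((B , γ) , λ₀) , u) ≡ (((B′ , γ′) , λ₁) , u′)
    same refl refl orbits root′ = cong₂ (λ B u → ((B , γ) , λ₀) , u) B≡ (cong Vec.head orbits)
      where
      module L = FromMatrix B γ λ₀ u irr root u≢𝟎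
      module R = FromMatrix B′ γ λ₀ u′ irr′ root′ u′≢𝟎
      φ≡ : ∀ x → Iso.to L.φ x ≡ Iso.to R.φ x
      φ≡ x = let a , e = Simplicity.faithful⇒cyclic (adjoin λ₀) finite-F finite-K (generates-faithful λ₀ L.generates) x in begin
        Iso.to L.φ x  ≡⟨ cong (Iso.to L.φ) e ⟨
        Iso.to L.φ (root-value λ₀ (poly a))  ≡⟨ L.φ-eval a ⟩
        a ⋄ orbit B u  ≡⟨ cong (a ⋄_) orbits ⟩
        a ⋄ orbit B′ u′  ≡⟨ R.φ-eval a ⟨
        Iso.to R.φ (root-value λ₀ (poly a))  ≡⟨ cong (Iso.to R.φ) e ⟩
        Iso.to R.φ x  ∎
      B≡ : B ≡ B′
      B≡ = matrix-ext B B′ λ w → begin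
        w ⋄ B  ≡⟨ cong (_⋄ B) (Iso.to-from L.φ w) ⟨
        Iso.to L.φ (Iso.from L.φ w) ⋄ B  ≡⟨ Iso.to-T L.φ (Iso.from L.φ w) ⟨
        Iso.to L.φ (λ₀ K.* Iso.from L.φ w)  ≡⟨ φ≡ (λ₀ K.* Iso.from L.φ w) ⟩
        Iso.to R.φ (λ₀ K.* Iso.from L.φ w)  ≡⟨ Iso.to-T R.φ (Iso.from L.φ w) ⟩
        Iso.to R.φ (Iso.from L.φ w) ⋄ B′  ≡⟨ cong (_⋄ B′) (trans (sym (φ≡ (Iso.from L.φ w))) (Iso.to-from L.φ w)) ⟩
        w ⋄ B′  ∎

  to-left : ∀ x → Right x → ((Matrix F.Carrier m × Vec F.Carrier n′) × K.Carrier) × Vec F.Carrier m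
  to-left ((λ₀ , γ) , P) (isR , invertible) = ((B , γ) , λ₀) , u
    where open FromPolynomial λ₀ γ P isR invertible

  to-left-Left : ∀ x p → Left (to-left x p)
  to-left-Left ((λ₀ , γ) , P) (isR , invertible) = (isL , root) , u≢𝟎
    where open FromPolynomial λ₀ γ P isR invertible

  to-right-to-left : ∀ x p → to-right (to-left x p) (to-left-Left x p) ≡ x
  to-right-to-left ((λ₀ , γ) , P) (isR , invertible) = cong ((λ₀ , γ) ,_) orbit≡P
    where open FromPolynomial λ₀ γ P isR invertible

  to-left-injective : ∀ {x y} p p′ → to-left x p ≡ to-left y p′ → x ≡ y
  to-left-injective {x} {y} p p′ e = trans (sym (to-right-to-left x p)) (trans (cong right e) (to-right-to-left y p′))
    where
    -- This is `to-right` without its membership argument, so that it can be applied to the equation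
    -- e.
    right : ((Matrix F.Carrier m × Vec F.Carrier n′) × K.Carrier) × Vec F.Carrier m → (K.Carrier × Vec F.Carrier n′) × Matrix F.Carrier m
    right (((B , γ) , λ₀) , u) = (λ₀ , γ) , orbit B u

  count : ∀ {t s g} → IsCard _≡_ (IsTSRI m n) t → IsCard (Poly._≈ₚ_ K.rawRing) (InS E n) s → IsCard _≡_ (IsInvertible {m}) g →
    t ℕ.* m ℕ.* (q ^ m ∸ 1) ≡ s ℕ.* g
  count T-card S-card GL-card = ℕ.≤-antisym
    (enum-≤ isEquivalence (enum-Left T-card) (enum-Right S-card GL-card) to-right to-right-Right to-right-injective)
    (enum-≤ isEquivalence (enum-Right S-card GL-card) (enum-Left T-card) to-left to-left-Left to-left-injective)

-- The counting formula

1<m⊔n⇒1<m*n : ∀ m n → 1 < suc m ⊔ suc n → 1 < suc m ℕ.* suc n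
1<m⊔n⇒1<m*n m n 1<m⊔n = ℕ.≤-trans 1<m⊔n (ℕ.⊔-lub (ℕ.m≤m*n (suc m) (suc n)) (ℕ.m≤n*m (suc n) (suc m)))

open import Data.Nat using (_*_)

theorem4p2 : (q m n : ℕ) → 1 ≤ m → 1 ≤ n → 1 < m ⊔ n →
    (F K : Field) → HasSize F q → HasSize K (q ^ m) → (E : Extension F K) →
    (t s g : ℕ) →
    IsCard _≡_ (OverField.IsTSRI F m n) t →
    IsCard (Poly._≈ₚ_ (Field.rawRing K)) (InS E n) s →
    IsCard _≡_ (OverField.IsInvertible F {m}) g →
    t * m * (q ^ m ∸ 1) ≡ s * g
theorem4p2 q (suc m) (suc n) _ _ 1<m⊔n F K F-size K-size E t s g =
  Correspondence.count E q m n (enum isEquivalence F-size) (enum isEquivalence K-size) (1<m⊔n⇒1<m*n m n 1<m⊔n)
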